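{- We have $$A^{3214}(x,q)=1+I^{3214}(x,q)+I^{321}(x,q)\left(A^{3214}(x,q)-1\right).$$ Moreover, $$I^{3214}(x)=\frac12\left(\sqrt{1-4x}+1\right)\left(E(x)-1\right),$$ $I^{3214}_1=1$, and for $n\ge2$, $$I^{3214}_n=E_n-\sum_{i=0}^{n-2}C_iE_{n-1-i},$$ where $C_i=\frac1{i+1}\binom{2i}i$ is the $i$-th Catalan number, $E_m$ is the number of $1234$-avoiding permutations of $[m]$ ($E_0=1$), and $E(x)=\sum_{m\ge0}E_mx^m$.
   Context: For a permutation $\pi=\pi_1\cdots\pi_n$ of $[n]$, let $i_\pi$ be the smallest index $i$ with $\{\pi_1,\dots,\pi_i\}=\{1,\dots,i\}$; $\pi$ is indecomposable if $i_\pi=n$ (the empty permutation is not indecomposable). A permutation $\pi$ avoids a pattern $\tau\in\mathfrak S_k$ if no subsequence $\pi_{j_1}\cdots\pi_{j_k}$ ($j_1<\cdots<j_k$) is order-isomorphic to $\tau$. A descent of $\pi$ is an index $i$ with $\pi_i>\pi_{i+1}$. For a pattern $\sigma$, $A^\sigma_{n,i}$ (resp. $I^\sigma_{n,i}$) is the number of $\sigma$-avoiding permutations (resp. $\sigma$-avoiding indecomposable permutations) of $[n]$ with $i$ descents; $A^\sigma(x,q)=1+\sum_{n\ge1}\sum_iA^\sigma_{n,i}x^nq^i$, $I^\sigma(x,q)=\sum_{n\ge1}\sum_iI^\sigma_{n,i}x^nq^i$, $I^\sigma(x)=I^\sigma(x,1)=\sum_{n\ge1}I^\sigma_nx^n$.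 It is known that $1234$ and $3214$ are Wilf-equivalent, i.e. $E_m$ also equals the number of $3214$-avoiding permutations of $[m]$. -}

module Defs where

open import Data.Nat using (ℕ; zero; suc; _+_; _*_; _∸_; _≤_; _<_; _<ᵇ_)
import Data.Nat as ℕ
open import Data.Nat.Combinatorics using (_C_)
open import Data.Bool using (if_then_else_)
open import Data.Fin using (Fin; toℕ) renaming (_<_ to _<ᶠ_; _<?_ to _<ᶠ?_)
open import Data.Fin.Properties using (any?; all?) renaming (_≟_ to _≟ᶠ_)
open import Data.List using (List; []; _∷_; map; concatMap; length; filter)
open import Data.List.Base using (allFin)
import Data.List.Base as L
open import Data.Vec using (Vec; []; _∷_; lookup; toList)
open import Data.Product using (Σ; ∃; _×_; _,_)
open import Relation.Nullary using (Dec; ¬_)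
open import Relation.Nullary.Decidable using (_×-dec_; _→-dec_; ¬?)
open import Relation.Binary.PropositionalEquality using (_≡_)
open import Data.Integer using (ℤ) renaming (_+_ to _+ℤ_; _*_ to _*ℤ_)
import Data.Integer as ℤ

-- Words / permutations of [n].
-- A permutation of [n] is represented by its one-line notation
-- π = π₀ ⋯ π_{n-1}, a vector of length n with entries in Fin n
-- (values 0..n-1 instead of 1..n; only relative order matters).

allVec : (n m : ℕ) → List (Vec (Fin m) n)
allVec zero    m = [] ∷ []
allVec (suc n) m = concatMap (λ x → map (x ∷_) (allVec n m)) (allFin m)

IsPerm : ∀ {n} → Vec (Fin n) n → Set
IsPerm {n} π = (i j : Fin n) → lookup π i ≡ lookup π j → i ≡ j

isPerm? : ∀ {n} (π : Vec (Fin n) n) → Dec (IsPerm π)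
isPerm? π = all? λ i → all? λ j → (lookup π i ≟ᶠ lookup π j) →-dec (i ≟ᶠ j)

Contains321 : ∀ {n} → Vec (Fin n) n → Set
Contains321 {n} π = ∃ λ (i : Fin n) → ∃ λ (j : Fin n) → ∃ λ (l : Fin n) →
  (i <ᶠ j) × (j <ᶠ l) × (lookup π l <ᶠ lookup π j) × (lookup π j <ᶠ lookup π i)

contains321? : ∀ {n} (π : Vec (Fin n) n) → Dec (Contains321 π)
contains321? π = any? λ i → any? λ j → any? λ l →
  (i <ᶠ? j) ×-dec (j <ᶠ? l) ×-dec (lookup π l <ᶠ? lookup π j) ×-dec (lookup π j <ᶠ? lookup π i)

Contains3214 : ∀ {n} → Vec (Fin n) n → Set
Contains3214 {n} π = ∃ λ (i : Fin n) → ∃ λ (j : Fin n) → ∃ λ (l : Fin n) → ∃ λ (m : Fin n) →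
  (i <ᶠ j) × (j <ᶠ l) × (l <ᶠ m) ×
  (lookup π l <ᶠ lookup π j) × (lookup π j <ᶠ lookup π i) × (lookup π i <ᶠ lookup π m)

contains3214? : ∀ {n} (π : Vec (Fin n) n) → Dec (Contains3214 π)
contains3214? π = any? λ i → any? λ j → any? λ l → any? λ m →
  (i <ᶠ? j) ×-dec (j <ᶠ? l) ×-dec (l <ᶠ? m) ×-dec
  (lookup π l <ᶠ? lookup π j) ×-dec (lookup π j <ᶠ? lookup π i) ×-dec (lookup π i <ᶠ? lookup π m)

Contains1234 : ∀ {n} → Vec (Fin n) n → Set
Contains1234 {n} π = ∃ λ (i : Fin n) → ∃ λ (j : Fin n) → ∃ λ (l : Fin n) → ∃ λ (m : Fin n) →
  (i <ᶠ j) × (j <ᶠ l) × (l <ᶠ m) ×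
  (lookup π i <ᶠ lookup π j) × (lookup π j <ᶠ lookup π l) × (lookup π l <ᶠ lookup π m)

contains1234? : ∀ {n} (π : Vec (Fin n) n) → Dec (Contains1234 π)
contains1234? π = any? λ i → any? λ j → any? λ l → any? λ m →
  (i <ᶠ? j) ×-dec (j <ᶠ? l) ×-dec (l <ᶠ? m) ×-dec
  (lookup π i <ᶠ? lookup π j) ×-dec (lookup π j <ᶠ? lookup π l) ×-dec (lookup π l <ᶠ? lookup π m)

desList : List ℕ → ℕ
desList []           = 0
desList (a ∷ [])     = 0
desList (a ∷ b ∷ xs) = (if b <ᵇ a then 1 else 0) + desList (b ∷ xs)

des : ∀ {n} → Vec (Fin n) n → ℕ
des π = desList (map toℕ (toList π))

PrefixInit : ∀ {n} → Vec (Fin n) n → ℕ → Set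
PrefixInit {n} π i =
  ((p : Fin n) → toℕ p < i → toℕ (lookup π p) < i) ×
  ((v : Fin n) → toℕ v < i → ∃ λ (p : Fin n) → toℕ p < i × lookup π p ≡ v)

prefixInit? : ∀ {n} (π : Vec (Fin n) n) (i : ℕ) → Dec (PrefixInit π i)
prefixInit? π i =
  (all? λ p → (toℕ p ℕ.<? i) →-dec (toℕ (lookup π p) ℕ.<? i)) ×-dec
  (all? λ v → (toℕ v ℕ.<? i) →-dec (any? λ p → (toℕ p ℕ.<? i) ×-dec (lookup π p ≟ᶠ v)))

-- i_π = n, i.e. the smallest i ≥ 1 with PrefixInit π i is n; since
-- PrefixInit π n always holds for a permutation, this says: n ≥ 1 and no
-- i with 1 ≤ i < n has PrefixInit π i.  (Empty permutation excluded.)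
Indecomposable : ∀ {n} → Vec (Fin n) n → Set
Indecomposable {n} π = (1 ≤ n) × ((i : Fin n) → 1 ≤ toℕ i → ¬ PrefixInit π (toℕ i))

indecomposable? : ∀ {n} (π : Vec (Fin n) n) → Dec (Indecomposable π)
indecomposable? {n} π = (1 ℕ.≤? n) ×-dec
  (all? λ i → (1 ℕ.≤? toℕ i) →-dec ¬? (prefixInit? π (toℕ i)))

countPerms : (n : ℕ) {P : Vec (Fin n) n → Set} → ((π : Vec (Fin n) n) → Dec (P π)) → ℕ
countPerms n P? = length (filter (λ π → isPerm? π ×-dec P? π) (allVec n n))

A3214 : ℕ → ℕ → ℕ
A3214 n k = countPerms n (λ π → ¬? (contains3214? π) ×-dec (des π ℕ.≟ k))

I3214 : ℕ → ℕ → ℕ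
I3214 n k = countPerms n (λ π → ¬? (contains3214? π) ×-dec indecomposable? π ×-dec (des π ℕ.≟ k))

I321 : ℕ → ℕ → ℕ
I321 n k = countPerms n (λ π → ¬? (contains321? π) ×-dec indecomposable? π ×-dec (des π ℕ.≟ k))

I3214ₙ : ℕ → ℕ
I3214ₙ n = countPerms n (λ π → ¬? (contains3214? π) ×-dec indecomposable? π)

E : ℕ → ℕ
E m = countPerms m (λ π → ¬? (contains1234? π))

catalan : ℕ → ℕ
catalan i = ((2 * i) C i) ℕ./ suc i

sumℕ : ℕ → (ℕ → ℕ) → ℕ
sumℕ zero    f = 0
sumℕ (suc n) f = sumℕ n f + f n

sumℤ : ℕ → (ℕ → ℤ) → ℤ
sumℤ zero    f = ℤ.0ℤ
sumℤ (suc n) f = sumℤ n f +ℤ f n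

-- formal power series over ℤ as coefficient sequences; Cauchy product coefficient
cauchy : (ℕ → ℤ) → (ℕ → ℤ) → ℕ → ℤ
cauchy f g n = sumℤ (suc n) (λ i → f i *ℤ g (n ∸ i))

oneMinus4x : ℕ → ℤ
oneMinus4x zero          = ℤ.1ℤ
oneMinus4x (suc zero)    = ℤ.- (ℤ.+ 4)
oneMinus4x (suc (suc n)) = ℤ.0ℤ

oneS : ℕ → ℤ
oneS zero    = ℤ.1ℤ
oneS (suc n) = ℤ.0ℤ

Eℤ : ℕ → ℤ
Eℤ m = ℤ.+ (E m)

{-# OPTIONS --safe #-}
module Submission where

-- A permutation with first component σ is σ ⊕ τ; if τ is nonempty, any entry of τ plays the 4 of 3214, so σ ⊕ τ
-- avoids 3214 iff σ avoids 321 and τ avoids 3214, and descents add up.  The same decomposition of the Catalan-many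
-- 321-avoiders shows that the indecomposable ones of length m + 1 are counted by the m-th Catalan number.
--
-- The remaining point is the Wilf equivalence of 3214 and 1234.  Insert the maxima one at a time.  For 1234, the number
-- of ways to continue depends on two lengths; for 3214, on the descent word of the longest 321-avoiding prefix.  The
-- two generating trees are not isomorphic, but sum the first one over the initial runs, and the second one over the
-- descent words, of all ballot words (two-row standard Young tableaux) of shape λ: both sums then obey
--   a_λ(n + 1) = a_{λ+(1,0)}(n) + a_{λ+(0,1)}(n) + ∑ f^{λ/ν} a_ν(n)   (ν ⊆ λ with nonempty second row),
-- the last term coming from the insertions that cut off part of the prefix.

open import Defs
open import Data.Nat using (ℕ; zero; suc; _+_; _*_; _∸_; _/_; _≤_; _<_; _>_; _≮_; _<ᵇ_; _<?_; _>?_; _≤?_; _≟_; z≤n; s≤s; s≤s⁻¹)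
open import Data.Nat.Properties hiding (_<?_; _>?_; _≤?_; _≟_)
open import Data.Nat.Combinatorics using (_C_; nCk≡nC[n∸k]; nC1≡n; nCk+nC[k+1]≡[n+1]C[k+1])
open import Data.Nat.DivMod using (m*n/n≡m; /-congˡ)
open import Data.Nat.Induction using (<-rec)
open import Data.Nat.ListAction using (sum)
open import Data.Nat.ListAction.Properties using (sum-++)
open import Data.Nat.Tactic.RingSolver renaming (solve-∀ to solveℕ-∀) using ()
open import Data.Bool using (Bool; true; false; _∧_; not; if_then_else_)
open import Data.Fin using (Fin; toℕ; fromℕ<) renaming (zero to fzero; suc to fsuc; _<_ to _<ᶠ_)
open import Data.Fin.Properties using (toℕ-injective; toℕ<n; toℕ-fromℕ<) renaming (suc-injective to fsuc-injective)
open import Data.Vec using (Vec; []; _∷_; lookup; toList)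
open import Data.List using (List; []; _∷_; [_]; _++_; replicate; length; map; concatMap; filter; upTo; reverse; take; drop; cartesianProduct)
open import Data.List.Properties using (length-++; ++-assoc; ∷-injective; ∷-injectiveˡ; ∷-injectiveʳ; length-++-≤ʳ; ++-identityʳ; ++-cancelˡ; map-∘; map-cong; map-++; map-id-local; map-injective; length-upTo; length-map; reverse-involutive; reverse-++; reverse-map; length-reverse; length-take; length-drop; take-all; take-take; take++drop≡id)
open import Data.List.Membership.Propositional using (_∈_; _∉_; find; lose)
open import Data.List.Membership.Propositional.Properties
open import Data.List.Relation.Unary.All as All using (All; []; _∷_)
import Data.List.Relation.Unary.All.Properties as Allₚ
open import Data.List.Relation.Unary.AllPairs as AllPairs using (AllPairs; []; _∷_; allPairs?)
import Data.List.Relation.Unary.AllPairs.Properties as AllPairsₚ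
open import Data.List.Relation.Unary.Any using (here; there)
open import Data.List.Relation.Unary.Unique.Propositional using (Unique)
import Data.List.Relation.Unary.Unique.Propositional.Properties as Uniqueₚ
open import Data.List.Relation.Binary.Permutation.Propositional using (_↭_; ↭-sym; ↭-refl; ↭⇒↭ₛ)
open import Data.List.Relation.Binary.Permutation.Propositional.Properties using (shift; ↭-length; All-resp-↭; ∈-resp-↭; ↭-reverse)
import Data.List.Relation.Binary.Permutation.Setoid.Properties as Permutationₛ
open import Data.List.Relation.Binary.Sublist.Propositional using (_⊆_; []; _∷_; ⊆-refl; ⊆-trans; minimum; from∈) renaming (_∷ʳ_ to skip)
open import Data.List.Relation.Binary.Sublist.Propositional.Properties using (++⁺; ++⁺ˡ; ++⁺ʳ; All-resp-⊆; reverse⁺) renaming (map⁺ to ⊆-map⁺)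
open import Data.Product using (∃; ∃₂; _×_; _,_; proj₁; proj₂)
open import Data.Product.Function.NonDependent.Propositional using (_×-⇔_)
open import Data.Sum using (_⊎_; inj₁; inj₂; [_,_]′)
open import Function using (_∘_; id; _⇔_; Equivalence; mk⇔)
open import Function.Properties.Equivalence using () renaming (refl to ⇔-refl; trans to ⇔-trans)
open import Relation.Nullary using (Dec; yes; no; ¬_; does; contradiction)
open import Relation.Nullary.Decidable using (dec-true; dec-false; map′; ¬?; _×-dec_; _⊎-dec_; _→-dec_)
open import Relation.Unary using (Decidable)
open import Relation.Binary.Definitions using (tri<; tri≈; tri>)
open import Relation.Binary.PropositionalEquality using (_≡_; _≢_; refl; sym; trans; cong; cong₂; subst; setoid; ≢-sym; module ≡-Reasoning)
open import Algebra.Properties.CommutativeSemigroup +-commutativeSemigroup using (interchange; x∙yz≈y∙xz)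

-- The trees are compared only through shape sums; a single tableau has no partner. On the 1234 side
-- a state is a pair (k , N), and a ballot word of shape λ contributes its initial run as k and |λ|
-- as N. An insertion that cuts N down to some j with k < j ≤ N picks the prefix of length j of the
-- word: as j > k, this prefix has the same initial run and a nonempty second row, which explains
-- the condition on ν. On the 3214 side the state is the descent word of the tableau. An insertion
-- into the last run between descents amounts to adding a box. An insertion into an earlier run
-- forgets everything after a prefix of shape ν, and its outcomes range over all ballot words of
-- shape ν. On both sides f^{λ/ν} counts the ways to continue the prefix to a word of shape λ. The
-- 3214 recurrence fails for the empty shape, since the empty word and the one-letter word share the
-- empty descent word. The comparison therefore starts at one box, where there is a single tableau
-- and both sums have a single term.

sumℕ-cong : ∀ n {f g : ℕ → ℕ} → (∀ i → i < n → f i ≡ g i) → sumℕ n f ≡ sumℕ n g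
sumℕ-cong zero    eq = refl
sumℕ-cong (suc n) eq =
  cong₂ _+_ (sumℕ-cong n λ i i<n → eq i (m<n⇒m<1+n i<n)) (eq n (n<1+n n))

-- Ballot words and generating trees

-- Ballot words are read from their last letter, so that suffixes are ballot words again.  The words of shape (d , q)
-- have q letters `true` (second row of the tableau) and q + d letters `false` (first row).
ballotSum : ℕ → ℕ → (List Bool → ℕ) → ℕ
ballotSum zero    zero    f = f []
ballotSum (suc d) zero    f = ballotSum d zero (f ∘ (false ∷_))
ballotSum zero    (suc q) f = ballotSum 1 q (f ∘ (true ∷_))
ballotSum (suc d) (suc q) f =
  ballotSum d (suc q) (f ∘ (false ∷_)) + ballotSum (suc (suc d)) q (f ∘ (true ∷_))

ballotSum-cong : ∀ d q {f g : List Bool → ℕ} → (∀ Q → f Q ≡ g Q) → ballotSum d q f ≡ ballotSum d q g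
ballotSum-cong zero    zero    eq = eq []
ballotSum-cong (suc d) zero    eq = ballotSum-cong d zero (eq ∘ (false ∷_))
ballotSum-cong zero    (suc q) eq = ballotSum-cong 1 q (eq ∘ (true ∷_))
ballotSum-cong (suc d) (suc q) eq =
  cong₂ _+_ (ballotSum-cong d (suc q) (eq ∘ (false ∷_))) (ballotSum-cong (suc (suc d)) q (eq ∘ (true ∷_)))

ballotSum-cong₊ : ∀ d q {f g : List Bool → ℕ} → 1 ≤ d + q →
  (∀ x Q → f (x ∷ Q) ≡ g (x ∷ Q)) → ballotSum d q f ≡ ballotSum d q g
ballotSum-cong₊ (suc d) zero    _ eq = ballotSum-cong d zero (eq false)
ballotSum-cong₊ zero    (suc q) _ eq = ballotSum-cong 1 q (eq true)
ballotSum-cong₊ (suc d) (suc q) _ eq =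
  cong₂ _+_ (ballotSum-cong d (suc q) (eq false)) (ballotSum-cong (suc (suc d)) q (eq true))

ballotSum-+ : ∀ d q (f g : List Bool → ℕ) →
  ballotSum d q (λ Q → f Q + g Q) ≡ ballotSum d q f + ballotSum d q g
ballotSum-+ zero    zero    f g = refl
ballotSum-+ (suc d) zero    f g = ballotSum-+ d zero (f ∘ (false ∷_)) (g ∘ (false ∷_))
ballotSum-+ zero    (suc q) f g = ballotSum-+ 1 q (f ∘ (true ∷_)) (g ∘ (true ∷_))
ballotSum-+ (suc d) (suc q) f g =
  trans (cong₂ _+_ (ballotSum-+ d (suc q) _ _) (ballotSum-+ (suc (suc d)) q _ _))
        (interchange (ballotSum d (suc q) (f ∘ (false ∷_))) _ _ _)

ballotSum-0 : ∀ d q → ballotSum d q (λ _ → 0) ≡ 0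
ballotSum-0 zero    zero    = refl
ballotSum-0 (suc d) zero    = ballotSum-0 d zero
ballotSum-0 zero    (suc q) = ballotSum-0 1 q
ballotSum-0 (suc d) (suc q) = cong₂ _+_ (ballotSum-0 d (suc q)) (ballotSum-0 (suc (suc d)) q)

-- A box added to the second row lowers d by one, which is impossible at d = 0.
onShrunk : ℕ → (ℕ → ℕ) → ℕ
onShrunk zero    X = 0
onShrunk (suc d) X = X d

-- The descent set of a tableau: i lies in the first row and i + 1 in the second. As words are read
-- from the end, `x` is the later of the two letters.
descents : List Bool → List Bool
descents []          = []
descents (x ∷ [])    = []
descents (x ∷ y ∷ Q) = (x ∧ not y) ∷ descents (y ∷ Q)

-- The state of the 3214 tree is the descent word of the longest 321-avoiding prefix, read from the end.  The counter k
-- is the number of ascents passed since the last descent; an insertion erases everything passed before them.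
sites : (List Bool → ℕ) → ℕ → List Bool → ℕ
sites f k []      = f (replicate k false ++ true ∷ [])
sites f k (b ∷ c) = f (replicate k false ++ true ∷ false ∷ c) + sites f (if b then 0 else suc k) c

tree3214 : ℕ → List Bool → ℕ
tree3214 zero    c = 1
tree3214 (suc n) c = tree3214 n (false ∷ c) + sites (tree3214 n) 0 c

-- The insertions into the last run of a ballot word (1^a 0^b read from the end as 0^b 1^a) are encoded by ballot words:
-- 1^j 0 1^{a-j} for b = 0; 0^k 1 0^{b-k} 1^a and 0^{b-1} 1^j 0 1^{a-j+1} for b > 0.  These are all the
-- ballot words with one more letter 0 that start with 1, respectively all those with one more letter 1.
onesSites : (List Bool → ℕ) → List Bool → ℕ
onesSites g (true ∷ Q) = g (true ∷ false ∷ Q) + onesSites (g ∘ (true ∷_)) Q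
onesSites g _          = 0

zerosSites : (List Bool → ℕ) → List Bool → ℕ
zerosSites g (false ∷ Q) =
  g (true ∷ false ∷ Q) + (zerosSites (g ∘ (false ∷_)) Q + onesSites (g ∘ (true ∷_)) Q)
zerosSites g _           = 0

-- Insertions into an earlier run, after which only a suffix of the list survives. The `true`
-- heading that suffix belongs to the run that is cut off; dropping it makes room for the `true`
-- that `zerosSites` adds, so the result has the shape of the suffix again.
laterSites : (List Bool → ℕ) → List Bool → ℕ
laterSites g (true ∷ Q) = zerosSites g Q
laterSites g _          = 0

suffixSum : (List Bool → ℕ) → List Bool → ℕ
suffixSum h []      = h []
suffixSum h (x ∷ Q) = h (x ∷ Q) + suffixSum h Q

laterSum : (List Bool → ℕ) → List Bool → ℕ
laterSum g = suffixSum (laterSites g)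

-- Before its first descent a run enters the descent word only through its length. The `j + 0`
-- matches the hypotheses of `sites-ones` and `sites-zeros` at counter 0.
descents-run : ∀ i j Q → descents (replicate i false ++ replicate j true ++ true ∷ false ∷ Q)
                       ≡ replicate (i + (j + 0)) false ++ true ∷ descents (false ∷ Q)
descents-run zero          zero          Q = refl
descents-run zero          (suc zero)    Q = refl
descents-run zero          (suc (suc j)) Q = cong (false ∷_) (descents-run zero (suc j) Q)
descents-run (suc zero)    zero          Q = refl
descents-run (suc zero)    (suc j)       Q = cong (false ∷_) (descents-run zero (suc j) Q)
descents-run (suc (suc i)) j             Q = cong (false ∷_) (descents-run (suc i) j Q)

module _ (f : List Bool → ℕ) where

  private
    g : List Bool → ℕ
    g = f ∘ descents

  -- Generalised over a function `h` that prepends the letters fixed by the sites already passed;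
  -- all that matters about them is that they show up as falls in the descent word. At a descent
  -- both `h` and the counter start afresh, and the remaining sites make up `laterSum`.
  sites-ones : ∀ k h →
    (∀ j Q → h (replicate j true ++ true ∷ false ∷ Q) ≡ f (replicate (j + k) false ++ true ∷ descents (false ∷ Q))) →
    ∀ Q → sites f k (descents (true ∷ Q)) ≡ onesSites h (true ∷ Q) + laterSum g (true ∷ Q)
  sites-zeros : ∀ k h →
    (∀ i j Q → h (replicate i false ++ replicate j true ++ true ∷ false ∷ Q)
             ≡ f (replicate (i + (j + k)) false ++ true ∷ descents (false ∷ Q))) →
    ∀ Q → sites f k (descents (false ∷ Q)) ≡ zerosSites h (false ∷ Q) + laterSum g (false ∷ Q)

  sites-ones k h eq [] = trans (sym (eq 0 [])) (sym (trans (+-identityʳ _) (+-identityʳ _)))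
  sites-ones k h eq (true ∷ Q) = trans
    (cong₂ _+_ (sym (eq 0 (true ∷ Q)))
      (sites-ones (suc k) (h ∘ (true ∷_)) (λ j Q′ → subst
        (λ m → h (replicate (suc j) true ++ true ∷ false ∷ Q′)
             ≡ f (replicate m false ++ true ∷ descents (false ∷ Q′)))
        (sym (+-suc j k)) (eq (suc j) Q′)) Q))
    (sym (+-assoc (h (true ∷ false ∷ true ∷ Q)) _ _))
  sites-ones k h eq (false ∷ Q) =
    cong₂ _+_ (trans (sym (eq 0 (false ∷ Q))) (sym (+-identityʳ _)))
              (sites-zeros 0 g (λ i j Q′ → cong f (descents-run i j Q′)) Q)

  sites-zeros k h eq [] = trans (sym (eq 0 0 [])) (sym (trans (+-identityʳ _) (+-identityʳ _)))
  sites-zeros k h eq (false ∷ Q) = trans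
    (cong₂ _+_ (sym (eq 0 0 (false ∷ Q)))
      (sites-zeros (suc k) (h ∘ (false ∷_)) (λ i j Q′ → subst
        (λ m → h (replicate (suc i) false ++ replicate j true ++ true ∷ false ∷ Q′)
             ≡ f (replicate m false ++ true ∷ descents (false ∷ Q′)))
        (sym (trans (cong (i +_) (+-suc j k)) (+-suc i (j + k)))) (eq (suc i) j Q′)) Q))
    (trans (sym (+-assoc (h (true ∷ false ∷ false ∷ Q)) _ _))
           (cong (λ m → h (true ∷ false ∷ false ∷ Q) + m + laterSum g (false ∷ Q)) (sym (+-identityʳ _))))
  -- The last zero of the run is traded for a `true`; the sites that follow put a `false` back among
  -- the ones.
  sites-zeros k h eq (true ∷ Q) = trans
    (cong₂ _+_ (sym (eq 0 0 (true ∷ Q)))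
      (sites-ones (suc k) (h ∘ (true ∷_)) (λ j Q′ → subst
        (λ m → h (replicate (suc j) true ++ true ∷ false ∷ Q′)
             ≡ f (replicate m false ++ true ∷ descents (false ∷ Q′)))
        (sym (+-suc j k)) (eq 0 (suc j) Q′)) Q))
    (sym (+-assoc (h (true ∷ false ∷ true ∷ Q)) _ _))

  sites-split : ∀ x Q → sites f 0 (descents (x ∷ Q))
    ≡ onesSites g (x ∷ Q) + (zerosSites g (x ∷ Q) + laterSum g (x ∷ Q))
  sites-split true  Q = sites-ones 0 g (λ j Q′ → cong f (descents-run 0 j Q′)) Q
  sites-split false Q = sites-zeros 0 g (λ i j Q′ → cong f (descents-run i j Q′)) Q

-- A list of shape (d + 1 , q) contains a `false`. If its first `false` is not the head, deleting it
-- leaves a ballot word of shape (d , q) headed by ones, and `onesSites` reinserts it in every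
-- possible place.
ballotSum-onesSites : ∀ d q g →
  ballotSum (suc d) q g ≡ ballotSum d q (g ∘ (false ∷_)) + ballotSum d q (onesSites g)
ballotSum-onesSites d zero g =
  sym (trans (cong (ballotSum d zero (g ∘ (false ∷_)) +_) (none d)) (+-identityʳ _))
  where
  none : ∀ d → ballotSum d zero (onesSites g) ≡ 0
  none zero    = refl
  none (suc d) = ballotSum-0 d zero
ballotSum-onesSites d (suc q) g = cong (ballotSum d (suc q) (g ∘ (false ∷_)) +_) (begin
  ballotSum (suc (suc d)) q (g ∘ (true ∷_))
    ≡⟨ ballotSum-onesSites (suc d) q (g ∘ (true ∷_)) ⟩
  ballotSum (suc d) q (λ Q → g (true ∷ false ∷ Q)) + ballotSum (suc d) q (onesSites (g ∘ (true ∷_)))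
    ≡⟨ ballotSum-+ (suc d) q _ _ ⟨
  ballotSum (suc d) q (onesSites g ∘ (true ∷_))
    ≡⟨ startsWithOne d ⟨
  ballotSum d (suc q) (onesSites g) ∎)
  where
  open ≡-Reasoning
  startsWithOne : ∀ d → ballotSum d (suc q) (onesSites g) ≡ ballotSum (suc d) q (onesSites g ∘ (true ∷_))
  startsWithOne zero    = refl
  startsWithOne (suc d) = cong (_+ ballotSum (suc (suc d)) q (onesSites g ∘ (true ∷_))) (ballotSum-0 d (suc q))

-- Induction on d. The outcomes headed by `true` come from the first and third summands of
-- `zerosSites`, joined by `ballotSum-onesSites`; those headed by `false` come from the middle
-- summand.
ballotSum-zerosSites : ∀ d q g → ballotSum (suc d) q (zerosSites g) ≡ ballotSum d (suc q) g
ballotSum-zerosSites d q g = begin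
  ballotSum (suc d) q (zerosSites g)
    ≡⟨ startsWithZero q ⟩
  ballotSum d q (λ Q → g (true ∷ false ∷ Q) + (zerosSites (g ∘ (false ∷_)) Q + onesSites (g ∘ (true ∷_)) Q))
    ≡⟨ trans (ballotSum-+ d q _ _) (cong (ballotSum d q (λ Q → g (true ∷ false ∷ Q)) +_) (ballotSum-+ d q _ _)) ⟩
  ballotSum d q (λ Q → g (true ∷ false ∷ Q)) +
    (ballotSum d q (zerosSites (g ∘ (false ∷_))) + ballotSum d q (onesSites (g ∘ (true ∷_))))
    ≡⟨ x∙yz≈y∙xz (ballotSum d q (λ Q → g (true ∷ false ∷ Q))) (ballotSum d q (zerosSites (g ∘ (false ∷_)))) _ ⟩
  ballotSum d q (zerosSites (g ∘ (false ∷_))) +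
    (ballotSum d q (λ Q → g (true ∷ false ∷ Q)) + ballotSum d q (onesSites (g ∘ (true ∷_))))
    ≡⟨ cong (ballotSum d q (zerosSites (g ∘ (false ∷_))) +_) (ballotSum-onesSites d q (g ∘ (true ∷_))) ⟨
  ballotSum d q (zerosSites (g ∘ (false ∷_))) + ballotSum (suc d) q (g ∘ (true ∷_))
    ≡⟨ assemble d ⟩
  ballotSum d (suc q) g ∎
  where
  open ≡-Reasoning
  startsWithZero : ∀ q → ballotSum (suc d) q (zerosSites g) ≡ ballotSum d q (zerosSites g ∘ (false ∷_))
  startsWithZero zero    = refl
  startsWithZero (suc q) =
    trans (cong (ballotSum d (suc q) (zerosSites g ∘ (false ∷_)) +_) (ballotSum-0 (suc (suc d)) q)) (+-identityʳ _)
  assemble : ∀ d → ballotSum d q (zerosSites (g ∘ (false ∷_))) + ballotSum (suc d) q (g ∘ (true ∷_))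
                 ≡ ballotSum d (suc q) g
  assemble (suc d) = cong (_+ ballotSum (suc (suc d)) q (g ∘ (true ∷_))) (ballotSum-zerosSites d q (g ∘ (false ∷_)))
  -- A nonempty word with d = 0 is headed by `true`, where `zerosSites` vanishes.
  assemble zero    = cong (_+ ballotSum 1 q (g ∘ (true ∷_))) (none q)
    where
    none : ∀ q → ballotSum 0 q (zerosSites (g ∘ (false ∷_))) ≡ 0
    none zero    = refl
    none (suc q) = ballotSum-0 1 q

ballotSum-zerosSites′ : ∀ d q g →
  ballotSum d q (zerosSites g) ≡ onShrunk d (λ e → ballotSum e (suc q) g)
ballotSum-zerosSites′ (suc d) q g = ballotSum-zerosSites d q g
ballotSum-zerosSites′ zero zero    g = refl
ballotSum-zerosSites′ zero (suc q) g = ballotSum-0 1 q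

ballotSum-laterSites : ∀ d q g → ballotSum d (suc q) (laterSites g) ≡ ballotSum d (suc q) g
ballotSum-laterSites d q g = trans (startsWithOne d) (ballotSum-zerosSites d q g)
  where
  startsWithOne : ∀ d → ballotSum d (suc q) (laterSites g) ≡ ballotSum (suc d) q (zerosSites g)
  startsWithOne zero    = refl
  startsWithOne (suc d) = cong (_+ ballotSum (suc (suc d)) q (zerosSites g)) (ballotSum-0 d (suc q))

-- The sum over ballot words of a sum over their suffixes depends only on the totals X of the shapes.
shapeSum : (ℕ → ℕ → ℕ) → ℕ → ℕ → ℕ
shapeSum X zero    zero    = 0
shapeSum X (suc d) zero    = shapeSum X d zero
shapeSum X zero    (suc q) = X zero (suc q) + shapeSum X 1 q
shapeSum X (suc d) (suc q) = X (suc d) (suc q) + (shapeSum X d (suc q) + shapeSum X (suc (suc d)) q)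

shapeSum-cong : ∀ {X Y : ℕ → ℕ → ℕ} → (∀ d q → X d (suc q) ≡ Y d (suc q)) → ∀ d q → shapeSum X d q ≡ shapeSum Y d q
shapeSum-cong eq zero    zero    = refl
shapeSum-cong eq (suc d) zero    = shapeSum-cong eq d zero
shapeSum-cong eq zero    (suc q) = cong₂ _+_ (eq zero q) (shapeSum-cong eq 1 q)
shapeSum-cong eq (suc d) (suc q) =
  cong₂ _+_ (eq (suc d) q) (cong₂ _+_ (shapeSum-cong eq d (suc q)) (shapeSum-cong eq (suc (suc d)) q))

ballotSum-laterSum : ∀ d q g →
  ballotSum d q (laterSum g) ≡ shapeSum (λ e r → ballotSum e r g) d q
ballotSum-laterSum zero    zero    g = refl
ballotSum-laterSum (suc d) zero    g = ballotSum-laterSum d zero g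
ballotSum-laterSum zero    (suc q) g = trans (ballotSum-+ 1 q _ _)
  (cong₂ _+_ (ballotSum-laterSites zero q g) (ballotSum-laterSum 1 q g))
ballotSum-laterSum (suc d) (suc q) g = begin
  ballotSum d (suc q) (laterSum g) + ballotSum (suc (suc d)) q (λ Q → laterSites g (true ∷ Q) + laterSum g Q)
    ≡⟨ cong (ballotSum d (suc q) (laterSum g) +_) (ballotSum-+ (suc (suc d)) q _ _) ⟩
  ballotSum d (suc q) (laterSum g) + (ballotSum (suc (suc d)) q (zerosSites g) + ballotSum (suc (suc d)) q (laterSum g))
    ≡⟨ x∙yz≈y∙xz (ballotSum d (suc q) (laterSum g)) (ballotSum (suc (suc d)) q (zerosSites g)) _ ⟩
  ballotSum (suc (suc d)) q (zerosSites g) + (ballotSum d (suc q) (laterSum g) + ballotSum (suc (suc d)) q (laterSum g))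
    ≡⟨ cong₂ _+_ (ballotSum-zerosSites (suc d) q g)
                 (cong₂ _+_ (ballotSum-laterSum d (suc q) g) (ballotSum-laterSum (suc (suc d)) q g)) ⟩
  shapeSum (λ e r → ballotSum e r g) (suc d) (suc q) ∎
  where open ≡-Reasoning

-- A maximum in front of the active part together with `onesSites` accounts for a box in the first
-- row, `zerosSites` for a box in the second row, and `laterSum` for the cuts.
tree3214-step : ∀ n d q → 1 ≤ d + q → let X = λ e r → ballotSum e r (tree3214 n ∘ descents) in
  ballotSum d q (tree3214 (suc n) ∘ descents)
    ≡ X (suc d) q + (onShrunk d (λ e → X e (suc q)) + shapeSum X d q)
tree3214-step n d q 1≤ = begin
  ballotSum d q (tree3214 (suc n) ∘ descents)
    ≡⟨ ballotSum-cong₊ d q 1≤ pointwise ⟩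
  ballotSum d q (λ Q → (g (false ∷ Q) + onesSites g Q) + (zerosSites g Q + laterSum g Q))
    ≡⟨ trans (ballotSum-+ d q _ _) (cong₂ _+_ (ballotSum-+ d q _ _) (ballotSum-+ d q _ _)) ⟩
  (ballotSum d q (g ∘ (false ∷_)) + ballotSum d q (onesSites g))
    + (ballotSum d q (zerosSites g) + ballotSum d q (laterSum g))
    ≡⟨ cong₂ _+_ (sym (ballotSum-onesSites d q g))
                 (cong₂ _+_ (ballotSum-zerosSites′ d q g) (ballotSum-laterSum d q g)) ⟩
  ballotSum (suc d) q g + (onShrunk d (λ e → ballotSum e (suc q) g) + shapeSum (λ e r → ballotSum e r g) d q) ∎
  where
  open ≡-Reasoning
  g : List Bool → ℕ
  g = tree3214 n ∘ descents
  pointwise : ∀ x Q → tree3214 (suc n) (descents (x ∷ Q))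
    ≡ (g (false ∷ x ∷ Q) + onesSites g (x ∷ Q)) + (zerosSites g (x ∷ Q) + laterSum g (x ∷ Q))
  pointwise x Q = trans (cong (g (false ∷ x ∷ Q) +_) (sites-split (tree3214 n) x Q))
                        (sym (+-assoc (g (false ∷ x ∷ Q)) _ _))

-- The 1234 tree and initial runs of ballot words

sumAbove : (ℕ → ℕ) → ℕ → ℕ → ℕ
sumAbove f k zero    = 0
sumAbove f k (suc N) = (if does (k ≤? N) then f (suc N) else 0) + sumAbove f k N

-- `k` and `N` are the lengths of the longest prefixes avoiding 12 and 123. A new maximum placed
-- after i entries leads to (k + 1 , N + 1) for i = 0, to (i , N + 1) for 1 ≤ i ≤ k and to (k , i)
-- for k < i ≤ N; for larger i it completes a 1234.
tree1234 : ℕ → ℕ → ℕ → ℕ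
tree1234 zero    k N = 1
tree1234 (suc n) k N = sumℕ (suc k) (λ i → tree1234 n (suc i) (suc N)) + sumAbove (tree1234 n k) k N

-- The sum of f over the lengths of the initial run of `false` (read from the first letter) of the ballot words.
initialRunSum : ℕ → ℕ → (ℕ → ℕ) → ℕ
initialRunSum d       zero    f = f d
initialRunSum zero    (suc q) f = initialRunSum 1 q f
initialRunSum (suc d) (suc q) f = initialRunSum d (suc q) f + initialRunSum (suc (suc d)) q f

initialRunSum-+ : ∀ d q (f g : ℕ → ℕ) →
  initialRunSum d q (λ k → f k + g k) ≡ initialRunSum d q f + initialRunSum d q g
initialRunSum-+ d       zero    f g = refl
initialRunSum-+ zero    (suc q) f g = initialRunSum-+ 1 q f g
initialRunSum-+ (suc d) (suc q) f g =
  trans (cong₂ _+_ (initialRunSum-+ d (suc q) f g) (initialRunSum-+ (suc (suc d)) q f g))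
        (interchange (initialRunSum d (suc q) f) _ _ _)

initialRunSum-cong : ∀ d q {f g : ℕ → ℕ} → (∀ k → k ≤ q + d → f k ≡ g k) → initialRunSum d q f ≡ initialRunSum d q g
initialRunSum-cong d zero eq = eq d ≤-refl
initialRunSum-cong zero (suc q) eq =
  initialRunSum-cong 1 q λ k k≤ → eq k (≤-trans k≤ (≤-reflexive (+-suc q 0)))
initialRunSum-cong (suc d) (suc q) eq = cong₂ _+_
  (initialRunSum-cong d (suc q) λ k k≤ → eq k (≤-trans k≤ (+-monoʳ-≤ (suc q) (n≤1+n d))))
  (initialRunSum-cong (suc (suc d)) q λ k k≤ → eq k (≤-trans k≤ (≤-reflexive (+-suc q (suc d)))))

-- For one row of length d, the run d + 1 belongs to the longer row and the runs 1, ..., d to the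
-- words with one `true`. In the inductive step, adding a box is interchanged with removing the last
-- one; the shape itself, `A`, arises once from each removal.
initialRunSum-prefixes : ∀ d q f →
  initialRunSum d q (λ k → sumℕ (suc k) (f ∘ suc))
    ≡ initialRunSum (suc d) q f + onShrunk d (λ e → initialRunSum e (suc q) f)
initialRunSum-prefixes zero    zero    f = sym (+-identityʳ _)
initialRunSum-prefixes (suc d) zero    f = begin
  sumℕ (suc d) (f ∘ suc) + f (suc (suc d))      ≡⟨ cong (_+ f (suc (suc d))) (run d) ⟩
  initialRunSum d 1 f + f (suc (suc d))         ≡⟨ +-comm (initialRunSum d 1 f) _ ⟩
  f (suc (suc d)) + initialRunSum d 1 f         ∎
  where
  open ≡-Reasoning
  run : ∀ d → sumℕ (suc d) (f ∘ suc) ≡ initialRunSum d 1 f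
  run zero    = refl
  run (suc d) = cong (_+ f (suc (suc d))) (run d)
initialRunSum-prefixes zero    (suc q) f = begin
  initialRunSum 1 q (λ k → sumℕ (suc k) (f ∘ suc))   ≡⟨ initialRunSum-prefixes 1 q f ⟩
  initialRunSum 2 q f + initialRunSum 0 (suc q) f    ≡⟨ +-comm (initialRunSum 2 q f) _ ⟩
  initialRunSum 0 (suc q) f + initialRunSum 2 q f    ≡⟨ +-identityʳ _ ⟨
  initialRunSum 0 (suc q) f + initialRunSum 2 q f + 0 ∎
  where open ≡-Reasoning
initialRunSum-prefixes (suc d) (suc q) f = begin
  initialRunSum d (suc q) s + initialRunSum (suc (suc d)) q s
    ≡⟨ cong₂ _+_ (initialRunSum-prefixes d (suc q) f) (initialRunSum-prefixes (suc (suc d)) q f) ⟩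
  (A + onShrunk d (λ e → initialRunSum e (suc (suc q)) f)) + (B + A)
    ≡⟨ cong ((A + onShrunk d (λ e → initialRunSum e (suc (suc q)) f)) +_) (+-comm B A) ⟩
  (A + onShrunk d (λ e → initialRunSum e (suc (suc q)) f)) + (A + B)
    ≡⟨ +-comm (A + onShrunk d (λ e → initialRunSum e (suc (suc q)) f)) (A + B) ⟩
  (A + B) + (A + onShrunk d (λ e → initialRunSum e (suc (suc q)) f))
    ≡⟨ cong ((A + B) +_) (assemble d) ⟩
  (A + B) + initialRunSum d (suc (suc q)) f ∎
  where
  open ≡-Reasoning
  s : ℕ → ℕ
  s k = sumℕ (suc k) (f ∘ suc)
  A B : ℕ
  A = initialRunSum (suc d) (suc q) f
  B = initialRunSum (suc (suc (suc d))) q f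
  assemble : ∀ d → initialRunSum (suc d) (suc q) f + onShrunk d (λ e → initialRunSum e (suc (suc q)) f)
                 ≡ initialRunSum d (suc (suc q)) f
  assemble zero    = +-identityʳ _
  assemble (suc d) = +-comm (initialRunSum (suc (suc d)) (suc q) f) _

weight : ℕ → ℕ → ℕ
weight d q = q + (q + d)

sumAbove-0 : ∀ f k N → N ≤ k → sumAbove f k N ≡ 0
sumAbove-0 f k zero    _   = refl
sumAbove-0 f k (suc N) N<k rewrite dec-false (k ≤? N) (<⇒≱ N<k) = sumAbove-0 f k N (<⇒≤ N<k)

sumAbove-suc : ∀ f k N → k ≤ N → sumAbove f k (suc N) ≡ f (suc N) + sumAbove f k N
sumAbove-suc f k N k≤N rewrite dec-true (k ≤? N) k≤N = refl

-- The summand split off belongs to the whole word, which is longer than its initial run because the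
-- second row is nonempty. The remaining summands belong to prefixes of the word without its last
-- letter.
initialRunSum-sumAbove-peel : ∀ (G : ℕ → ℕ → ℕ) d q →
  initialRunSum d (suc q) (λ k → sumAbove (G k) k (weight d (suc q)))
    ≡ initialRunSum d (suc q) (λ k → G k (weight d (suc q)))
      + initialRunSum d (suc q) (λ k → sumAbove (G k) k (q + suc (q + d)))
initialRunSum-sumAbove-peel G d q = trans
  (initialRunSum-cong d (suc q) (λ k k≤ → sumAbove-suc (G k) k _ (≤-trans k≤ (m≤n+m _ q))))
  (initialRunSum-+ d (suc q) _ _)

initialRunSum-sumAbove : ∀ (G : ℕ → ℕ → ℕ) d q →
  initialRunSum d q (λ k → sumAbove (G k) k (weight d q))
    ≡ shapeSum (λ e r → initialRunSum e r (λ k → G k (weight e r))) d q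
initialRunSum-sumAbove G d zero = trans (sumAbove-0 (G d) d d ≤-refl) (sym (empty d))
  where
  empty : ∀ d → shapeSum (λ e r → initialRunSum e r (λ k → G k (weight e r))) d zero ≡ 0
  empty zero    = refl
  empty (suc d) = empty d
initialRunSum-sumAbove G zero (suc q) = trans (initialRunSum-sumAbove-peel G zero q)
  (cong (initialRunSum zero (suc q) (λ k → G k (weight zero (suc q))) +_) (trans
    (cong (λ N → initialRunSum 1 q (λ k → sumAbove (G k) k N)) (cong (q +_) (sym (+-suc q 0))))
    (initialRunSum-sumAbove G 1 q)))
initialRunSum-sumAbove G (suc d) (suc q) = trans (initialRunSum-sumAbove-peel G (suc d) q)
  (cong (initialRunSum (suc d) (suc q) (λ k → G k (weight (suc d) (suc q))) +_) (cong₂ _+_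
    (trans (cong (λ N → initialRunSum d (suc q) (λ k → sumAbove (G k) k N))
                 (trans (+-suc q _) (cong (λ m → suc (q + m)) (+-suc q d))))
           (initialRunSum-sumAbove G d (suc q)))
    (trans (cong (λ N → initialRunSum (suc (suc d)) q (λ k → sumAbove (G k) k N))
                 (cong (q +_) (sym (+-suc q (suc d)))))
           (initialRunSum-sumAbove G (suc (suc d)) q))))

tree1234-step : ∀ n d q → let X = λ e r → initialRunSum e r (λ k → tree1234 n k (weight e r)) in
  initialRunSum d q (λ k → tree1234 (suc n) k (weight d q))
    ≡ X (suc d) q + (onShrunk d (λ e → X e (suc q)) + shapeSum X d q)
tree1234-step n d q = begin
  initialRunSum d q (λ k → tree1234 (suc n) k (weight d q))
    ≡⟨ initialRunSum-+ d q _ _ ⟩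
  initialRunSum d q (λ k → sumℕ (suc k) (λ i → tree1234 n (suc i) (suc (weight d q))))
    + initialRunSum d q (λ k → sumAbove (tree1234 n k) k (weight d q))
    ≡⟨ cong₂ _+_ (initialRunSum-prefixes d q (λ k → tree1234 n k (suc (weight d q))))
                 (initialRunSum-sumAbove (tree1234 n) d q) ⟩
  (initialRunSum (suc d) q (λ k → tree1234 n k (suc (weight d q)))
     + onShrunk d (λ e → initialRunSum e (suc q) (λ k → tree1234 n k (suc (weight d q))))) + shapeSum X d q
    ≡⟨ cong (_+ shapeSum X d q) (cong₂ _+_
         (cong (λ N → initialRunSum (suc d) q (λ k → tree1234 n k N)) w₁) (shrunk d)) ⟩
  (X (suc d) q + onShrunk d (λ e → X e (suc q))) + shapeSum X d q
    ≡⟨ +-assoc (X (suc d) q) _ _ ⟩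
  X (suc d) q + (onShrunk d (λ e → X e (suc q)) + shapeSum X d q) ∎
  where
  open ≡-Reasoning
  X : ℕ → ℕ → ℕ
  X e r = initialRunSum e r (λ k → tree1234 n k (weight e r))
  w₁ : suc (weight d q) ≡ weight (suc d) q
  w₁ = sym (trans (cong (q +_) (+-suc q d)) (+-suc q (q + d)))
  shrunk : ∀ d → onShrunk d (λ e → initialRunSum e (suc q) (λ k → tree1234 n k (suc (weight d q))))
               ≡ onShrunk d (λ e → X e (suc q))
  shrunk zero    = refl
  shrunk (suc d) = cong (λ m → initialRunSum d (suc q) (λ k → tree1234 n k (suc (q + m)))) (+-suc q d)

-- Induction on n for all shapes at once, since a step refers to larger and to smaller shapes. At n
-- = 0 both sides count the tableaux of the shape.
trees-agree : ∀ n d q → 1 ≤ d + q →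
  ballotSum d q (tree3214 n ∘ descents) ≡ initialRunSum d q (λ k → tree1234 n k (weight d q))
trees-agree zero d q _ = start d q
  where
  start : ∀ d q → ballotSum d q (λ _ → 1) ≡ initialRunSum d q (λ _ → 1)
  start zero    zero    = refl
  start (suc d) zero    = start d zero
  start zero    (suc q) = start 1 q
  start (suc d) (suc q) = cong₂ _+_ (start d (suc q)) (start (suc (suc d)) q)
trees-agree (suc n) d q 1≤ = trans (tree3214-step n d q 1≤) (trans
  (cong₂ _+_ (trees-agree n (suc d) q (s≤s z≤n))
    (cong₂ _+_ (shrunk d) (shapeSum-cong (λ e r → agree₁ e r) d q)))
  (sym (tree1234-step n d q)))
  where
  agree₁ : ∀ e r → ballotSum e (suc r) (tree3214 n ∘ descents)
                 ≡ initialRunSum e (suc r) (λ k → tree1234 n k (weight e (suc r)))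
  agree₁ e r = trees-agree n e (suc r) (≤-trans (s≤s z≤n) (m≤n+m (suc r) e))
  shrunk : ∀ d → onShrunk d (λ e → ballotSum e (suc q) (tree3214 n ∘ descents))
               ≡ onShrunk d (λ e → initialRunSum e (suc q) (λ k → tree1234 n k (weight e (suc q))))
  shrunk zero    = refl
  shrunk (suc d) = agree₁ d q

-- Catalan numbers

-- n C (k ∸ 1), read as 0 when k = 0, so that Pascal's rule holds for every k.
_Cpred_ : ℕ → ℕ → ℕ
n Cpred zero  = 0
n Cpred suc k = n C k

pascal : ∀ n k → suc n C k ≡ n C k + n Cpred k
pascal n zero    = refl
pascal n (suc k) = trans (sym (nCk+nC[k+1]≡[n+1]C[k+1] n k)) (+-comm (n C k) _)

-- This is (k + 1) C(n, k + 1) = (n - k) C(n, k) with the subtraction moved to the other side.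
absorption : ∀ n k → suc k * (n C suc k) + k * (n C k) ≡ n * (n C k)
absorption zero    zero    = refl
absorption zero    (suc k) = cong₂ _+_ (*-zeroʳ (suc (suc k))) (*-zeroʳ (suc k))
absorption (suc n) zero    = trans (+-identityʳ _) (trans (+-identityʳ _) (trans (nC1≡n (suc n)) (sym (*-identityʳ _))))
absorption (suc n) (suc k) = begin
  suc (suc k) * (suc n C suc (suc k)) + suc k * (suc n C suc k)
    ≡⟨ cong₂ (λ x y → suc (suc k) * x + suc k * y) (pascal n (suc (suc k))) (pascal n (suc k)) ⟩
  suc (suc k) * (c + b) + suc k * (b + a)   ≡⟨ expand k a b c ⟩
  (suc (suc k) * c + suc k * b) + (suc k * b + k * a) + (b + a)
    ≡⟨ cong₂ (λ x y → x + y + (b + a)) (absorption n (suc k)) (absorption n k) ⟩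
  n * b + n * a + (b + a)                   ≡⟨ collect n a b ⟩
  suc n * (b + a)                           ≡⟨ cong (suc n *_) (pascal n (suc k)) ⟨
  suc n * (suc n C suc k)                   ∎
  where
  open ≡-Reasoning
  a b c : ℕ
  a = n C k
  b = n C suc k
  c = n C suc (suc k)
  expand : ∀ k a b c → suc (suc k) * (c + b) + suc k * (b + a)
         ≡ (suc (suc k) * c + suc k * b) + (suc k * b + k * a) + (b + a)
  expand = solveℕ-∀
  collect : ∀ n a b → n * b + n * a + (b + a) ≡ suc n * (b + a)
  collect = solveℕ-∀

-- Also the number of lattice paths from height k to 0 with n up-steps that stay nonnegative: i is
-- the height at which the first up-step starts.
tree321 : ℕ → ℕ → ℕ
tree321 zero    k = 1
tree321 (suc n) k = sumℕ (suc k) (λ i → tree321 n (suc i))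

-- The ballot number C(2n + k, n) - C(2n + k, n - 1). Pascal's rule for both binomials matches T(n +
-- 1, k + 1) = T(n + 1, k) + T(n, k + 2); at k = 0 the symmetry of row 2n + 1 closes the recursion.
tree321-ballot : ∀ n k → tree321 n k + (n + n + k) Cpred n ≡ (n + n + k) C n
tree321-ballot zero    k       = refl
tree321-ballot (suc n) zero    = begin
  tree321 n 1 + (suc n + suc n + 0) C n           ≡⟨ cong (λ m → tree321 n 1 + m C n) size ⟩
  tree321 n 1 + suc N C n                         ≡⟨ cong (tree321 n 1 +_) (trans (pascal N n) (+-comm (N C n) _)) ⟩
  tree321 n 1 + (N Cpred n + N C n)               ≡⟨ +-assoc (tree321 n 1) _ _ ⟨
  tree321 n 1 + N Cpred n + N C n                 ≡⟨ cong (_+ N C n) (tree321-ballot n 1) ⟩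
  N C n + N C n                                   ≡⟨ cong (_+ N C n) symmetric ⟩
  N C suc n + N C n                               ≡⟨ pascal N (suc n) ⟨
  suc N C suc n                                   ≡⟨ cong (_C suc n) size ⟨
  (suc n + suc n + 0) C suc n                     ∎
  where
  open ≡-Reasoning
  N : ℕ
  N = n + n + 1
  size : suc n + suc n + 0 ≡ suc N
  size = (λ (eq : ∀ n → suc n + suc n + 0 ≡ suc (n + n + 1)) → eq n) solveℕ-∀
  symmetric : N C n ≡ N C suc n
  symmetric = trans (nCk≡nC[n∸k] (≤-trans (m≤m+n n n) (m≤m+n (n + n) 1)))
    (cong (N C_) (trans (cong (_∸ n) (trans (+-assoc n n 1) (cong (n +_) (+-comm n 1)))) (m+n∸m≡n n (suc n))))
tree321-ballot (suc n) (suc k) = begin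
  (tree321 (suc n) k + tree321 n (suc (suc k))) + (suc n + suc n + suc k) C n
    ≡⟨ cong (λ m → (tree321 (suc n) k + tree321 n (suc (suc k))) + m C n) (+-suc (suc n + suc n) k) ⟩
  (tree321 (suc n) k + tree321 n (suc (suc k))) + suc N C n
    ≡⟨ cong ((tree321 (suc n) k + tree321 n (suc (suc k))) +_) (pascal N n) ⟩
  (tree321 (suc n) k + tree321 n (suc (suc k))) + (N C n + N Cpred n)
    ≡⟨ interchange (tree321 (suc n) k) _ _ _ ⟩
  (tree321 (suc n) k + N C n) + (tree321 n (suc (suc k)) + N Cpred n)
    ≡⟨ cong₂ _+_ (tree321-ballot (suc n) k) (cong (λ m → tree321 n (suc (suc k)) + m Cpred n) size) ⟩
  N C suc n + (tree321 n (suc (suc k)) + (n + n + suc (suc k)) Cpred n)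
    ≡⟨ cong (N C suc n +_) (trans (tree321-ballot n (suc (suc k))) (cong (_C n) (sym size))) ⟩
  N C suc n + N C n
    ≡⟨ pascal N (suc n) ⟨
  suc N C suc n
    ≡⟨ cong (_C suc n) (+-suc (suc n + suc n) k) ⟨
  (suc n + suc n + suc k) C suc n ∎
  where
  open ≡-Reasoning
  N : ℕ
  N = suc n + suc n + k
  size : N ≡ n + n + suc (suc k)
  size = (λ (eq : ∀ n k → suc n + suc n + k ≡ n + n + suc (suc k)) → eq n k) solveℕ-∀

centralBinomial-pred : ∀ n → (2 * n) Cpred n * suc n ≡ n * ((2 * n) C n)
centralBinomial-pred zero    = refl
centralBinomial-pred (suc m) = +-cancelʳ-≡ (m * X) _ _ (begin
  X * suc (suc m) + m * X        ≡⟨ double m X ⟩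
  2 * suc m * X                  ≡⟨ absorption (2 * suc m) m ⟨
  suc m * ((2 * suc m) C suc m) + m * X ∎)
  where
  open ≡-Reasoning
  X : ℕ
  X = (2 * suc m) C m
  double : ∀ m X → X * suc (suc m) + m * X ≡ 2 * suc m * X
  double = solveℕ-∀

tree321-catalan : ∀ n → tree321 n 0 ≡ catalan n
tree321-catalan n = begin
  tree321 n 0                     ≡⟨ m*n/n≡m (tree321 n 0) (suc n) ⟨
  tree321 n 0 * suc n / suc n     ≡⟨ /-congˡ (+-cancelʳ-≡ (n * Y) _ _ main) ⟩
  Y / suc n                       ∎
  where
  open ≡-Reasoning
  Y : ℕ
  Y = (2 * n) C n
  size : n + n + 0 ≡ 2 * n
  size = (λ (eq : ∀ n → n + n + 0 ≡ 2 * n) → eq n) solveℕ-∀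
  main : tree321 n 0 * suc n + n * Y ≡ Y + n * Y
  main = begin
    tree321 n 0 * suc n + n * Y                       ≡⟨ cong (tree321 n 0 * suc n +_) (centralBinomial-pred n) ⟨
    tree321 n 0 * suc n + (2 * n) Cpred n * suc n     ≡⟨ *-distribʳ-+ (suc n) (tree321 n 0) _ ⟨
    (tree321 n 0 + (2 * n) Cpred n) * suc n
      ≡⟨ cong (_* suc n) (subst (λ m → tree321 n 0 + m Cpred n ≡ m C n) size (tree321-ballot n 0)) ⟩
    Y * suc n                                         ≡⟨ *-comm Y (suc n) ⟩
    Y + n * Y                                         ∎

sumℕ-+ : ∀ n (f g : ℕ → ℕ) → sumℕ n (λ i → f i + g i) ≡ sumℕ n f + sumℕ n g
sumℕ-+ zero    f g = refl
sumℕ-+ (suc n) f g = trans (cong (_+ (f n + g n)) (sumℕ-+ n f g)) (interchange (sumℕ n f) _ _ _)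

-- A path from height k + 1 is cut at its first visit to height k; the part before it, with i
-- up-steps, is counted by `tree321 i 0`. For k = 0 and n = m + 1 this reads as one more term of the
-- same convolution, which starts the induction on k.
tree321-convolution : ∀ n k → tree321 n (suc k) ≡ sumℕ (suc n) (λ i → tree321 i 0 * tree321 (n ∸ i) k)
tree321-convolution zero    k    = refl
tree321-convolution (suc n) zero = begin
  tree321 (suc n) 0 + tree321 n 2
    ≡⟨ +-comm (tree321 (suc n) 0) _ ⟩
  tree321 n 2 + tree321 (suc n) 0
    ≡⟨ cong₂ _+_ (tree321-convolution n 1) (sym (trans (cong (λ m → tree321 (suc n) 0 * tree321 m 0) (n∸n≡0 (suc n))) (*-identityʳ _))) ⟩
  sumℕ (suc n) (λ i → tree321 i 0 * tree321 (n ∸ i) 1) + tree321 (suc n) 0 * tree321 (suc n ∸ suc n) 0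
    ≡⟨ cong (_+ tree321 (suc n) 0 * tree321 (suc n ∸ suc n) 0)
         (sumℕ-cong (suc n) λ i i<1+n → cong (λ m → tree321 i 0 * tree321 m 0) (sym (+-∸-assoc 1 (s≤s⁻¹ i<1+n)))) ⟩
  sumℕ (suc (suc n)) (λ i → tree321 i 0 * tree321 (suc n ∸ i) 0) ∎
  where open ≡-Reasoning
tree321-convolution (suc n) (suc k) = begin
  tree321 (suc n) (suc k) + tree321 n (suc (suc (suc k)))
    ≡⟨ cong₂ _+_ (tree321-convolution (suc n) k) (tree321-convolution n (suc (suc k))) ⟩
  (sumℕ (suc n) f + last k) + sumℕ (suc n) g
    ≡⟨ trans (+-assoc (sumℕ (suc n) f) _ _) (trans (cong (sumℕ (suc n) f +_) (+-comm (last k) _)) (sym (+-assoc (sumℕ (suc n) f) _ _))) ⟩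
  (sumℕ (suc n) f + sumℕ (suc n) g) + last k
    ≡⟨ cong₂ _+_ (sym (sumℕ-+ (suc n) f g)) (cong (tree321 (suc n) 0 *_) (trans (cong (λ m → tree321 m k) (n∸n≡0 (suc n))) (cong (λ m → tree321 m (suc k)) (sym (n∸n≡0 (suc n)))))) ⟩
  sumℕ (suc n) (λ i → f i + g i) + last (suc k)
    ≡⟨ cong (_+ last (suc k)) (sumℕ-cong (suc n) merge) ⟩
  sumℕ (suc (suc n)) (λ i → tree321 i 0 * tree321 (suc n ∸ i) (suc k)) ∎
  where
  open ≡-Reasoning
  f g last : ℕ → ℕ
  f i = tree321 i 0 * tree321 (suc n ∸ i) k
  g i = tree321 i 0 * tree321 (n ∸ i) (suc (suc k))
  last k = tree321 (suc n) 0 * tree321 (suc n ∸ suc n) k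
  merge : ∀ i → i < suc n → f i + g i ≡ tree321 i 0 * tree321 (suc n ∸ i) (suc k)
  merge i i<1+n rewrite +-∸-assoc 1 {n} {i} (s≤s⁻¹ i<1+n) =
    sym (*-distribˡ-+ (tree321 i 0) (tree321 (suc (n ∸ i)) k) _)

-- Patterns and insertion of the maximum

Contains : (List ℕ → Set) → List ℕ → Set
Contains Q l = ∃ λ s → s ⊆ l × Q s

Contains-mono : ∀ {Q l l′} → l ⊆ l′ → Contains Q l → Contains Q l′
Contains-mono l⊆l′ (s , s⊆l , q) = s , ⊆-trans s⊆l l⊆l′ , q

contains? : ∀ {Q} → Decidable Q → Decidable (Contains Q)
contains? {Q} Q? []      = map′ (λ q → [] , [] , q) (λ { (.[] , [] , q) → q }) (Q? [])
contains? {Q} Q? (x ∷ l) = map′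
  [ (λ { (s , s⊆l , q) → s , skip x s⊆l , q }) , (λ { (s , s⊆l , q) → x ∷ s , refl ∷ s⊆l , q }) ]′
  (λ { (s , skip .x s⊆l , q) → inj₁ (s , s⊆l , q) ; (.x ∷ s , refl ∷ s⊆l , q) → inj₂ (s , s⊆l , q) })
  (contains? Q? l ⊎-dec contains? (Q? ∘ (x ∷_)) l)

Decreasing Increasing : ℕ → List ℕ → Set
Decreasing j s = AllPairs _>_ s × length s ≡ j
Increasing j s = AllPairs _<_ s × length s ≡ j

-- 3214 and 1234 are studied on reversed words, as 4123 and 4321, so that the active part of a word is a suffix.
Is4123 : List ℕ → Set
Is4123 s = ∃₂ λ d t → s ≡ d ∷ t × All (_< d) t × Increasing 3 t

⊆-insert : ∀ {x : ℕ} a {b} → a ++ b ⊆ a ++ x ∷ b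
⊆-insert {x} a = ++⁺ (⊆-refl {x = a}) (skip x ⊆-refl)

⊆-insert⁻ : ∀ {x : ℕ} a {b s} → s ⊆ a ++ x ∷ b →
  s ⊆ a ++ b ⊎ (∃₂ λ s₁ s₂ → s ≡ s₁ ++ x ∷ s₂ × s₁ ⊆ a × s₂ ⊆ b)
⊆-insert⁻ []      (skip _ s⊆)  = inj₁ s⊆
⊆-insert⁻ []      (refl ∷ s⊆)  = inj₂ ([] , _ , refl , [] , s⊆)
⊆-insert⁻ (y ∷ a) (skip .y s⊆) with ⊆-insert⁻ a s⊆
... | inj₁ s⊆′ = inj₁ (skip y s⊆′)
... | inj₂ (s₁ , s₂ , eq , s₁⊆ , s₂⊆) = inj₂ (s₁ , s₂ , eq , skip y s₁⊆ , s₂⊆)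
⊆-insert⁻ (y ∷ a) (refl ∷ s⊆) with ⊆-insert⁻ a s⊆
... | inj₁ s⊆′ = inj₁ (refl ∷ s⊆′)
... | inj₂ (s₁ , s₂ , refl , s₁⊆ , s₂⊆) = inj₂ (y ∷ s₁ , s₂ , refl , refl ∷ s₁⊆ , s₂⊆)

-- As `m` exceeds all of `a`, a decreasing sequence that uses `m` must start with it.
decreasing-insert⁻ : ∀ {j m} a {b} → All (_< m) a →
  Contains (Decreasing (suc j)) (a ++ m ∷ b) → Contains (Decreasing (suc j)) (a ++ b) ⊎ Contains (Decreasing j) b
decreasing-insert⁻ a a<m (s , s⊆ , dec) with ⊆-insert⁻ a s⊆
... | inj₁ s⊆′ = inj₁ (s , s⊆′ , dec)
decreasing-insert⁻ a a<m (_ , _ , (_ ∷ dec) , len) | inj₂ ([] , s₂ , refl , _ , s₂⊆) =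
  inj₂ (s₂ , s₂⊆ , dec , suc-injective len)
decreasing-insert⁻ a a<m (_ , _ , (y> ∷ _) , _) | inj₂ (y ∷ s₁ , s₂ , refl , s₁⊆ , _) =
  contradiction (All.lookup y> (∈-++⁺ʳ s₁ (here refl))) (<-asym (All.head (All-resp-⊆ s₁⊆ a<m)))

decreasing-cons : ∀ {j m b} → All (_< m) b → Contains (Decreasing j) b → Contains (Decreasing (suc j)) (m ∷ b)
decreasing-cons b<m (s , s⊆ , dec , len) = _ ∷ s , refl ∷ s⊆ , All-resp-⊆ s⊆ b<m ∷ dec , cong suc len

increasing-insert⁻ : ∀ {j m} a {b} → All (_< m) b →
  Contains (Increasing (suc j)) (a ++ m ∷ b) → Contains (Increasing (suc j)) (a ++ b) ⊎ Contains (Increasing j) a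
increasing-insert⁻ a b<m (s , s⊆ , inc) with ⊆-insert⁻ a s⊆
... | inj₁ s⊆′ = inj₁ (s , s⊆′ , inc)
increasing-insert⁻ {j} {m} a b<m (_ , _ , inc , len) | inj₂ (s₁ , [] , refl , s₁⊆ , _) =
  inj₂ (s₁ , s₁⊆ , initial s₁ inc , suc-injective (trans (sym (trans (length-++ s₁) (+-comm _ 1))) len))
  where
  initial : ∀ s → AllPairs _<_ (s ++ [ m ]) → AllPairs _<_ s
  initial []      _            = []
  initial (x ∷ s) (x< ∷ pairs) = Allₚ.++⁻ˡ s x< ∷ initial s pairs
increasing-insert⁻ {j} {m} a b<m (_ , _ , inc , _) | inj₂ (s₁ , y ∷ s₂ , refl , _ , s₂⊆) =
  contradiction (final s₁ inc) (<-asym (All.head (All-resp-⊆ s₂⊆ b<m)))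
  where
  final : ∀ s → AllPairs _<_ (s ++ m ∷ y ∷ s₂) → m < y
  final []      ((m<y ∷ _) ∷ _) = m<y
  final (x ∷ s) (_ ∷ pairs)     = final s pairs

increasing-snoc : ∀ {j m} a {b} → All (_< m) a → Contains (Increasing j) a → Contains (Increasing (suc j)) (a ++ m ∷ b)
increasing-snoc {m = m} a a<m (s , s⊆ , inc , len) =
  s ++ [ m ] , ++⁺ s⊆ (refl ∷ minimum _) ,
  AllPairsₚ.++⁺ inc ([] ∷ []) (All.map (_∷ []) (All-resp-⊆ s⊆ a<m)) ,
  trans (length-++ s) (trans (+-comm _ 1) (cong suc len))

4123-insert⁻ : ∀ {m} a {b} → All (_< m) a →
  Contains Is4123 (a ++ m ∷ b) → Contains Is4123 (a ++ b) ⊎ Contains (Increasing 3) b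
4123-insert⁻ a a<m (s , s⊆ , q) with ⊆-insert⁻ a s⊆
... | inj₁ s⊆′ = inj₁ (s , s⊆′ , q)
4123-insert⁻ a a<m (_ , _ , d , t , refl , _ , inc) | inj₂ ([] , s₂ , refl , _ , s₂⊆) = inj₂ (s₂ , s₂⊆ , inc)
4123-insert⁻ a a<m (_ , _ , d , t , refl , <d , _) | inj₂ (y ∷ s₁ , s₂ , refl , s₁⊆ , _) =
  contradiction (All.lookup <d (∈-++⁺ʳ s₁ (here refl))) (<-asym (All.head (All-resp-⊆ s₁⊆ a<m)))

4123-cons : ∀ {m b} → All (_< m) b → Contains (Increasing 3) b → Contains Is4123 (m ∷ b)
4123-cons b<m (s , s⊆ , inc) = _ ∷ s , refl ∷ s⊆ , _ , _ , refl , All-resp-⊆ s⊆ b<m , inc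

insertSum : ℕ → (List ℕ → ℕ) → List ℕ → ℕ
insertSum m f []      = f [ m ]
insertSum m f (x ∷ l) = f (m ∷ x ∷ l) + insertSum m (f ∘ (x ∷_)) l

module _ {P : List ℕ → Set} (P? : Decidable P) where

  -- The number of P-avoiding lists obtained from l by inserting m, m + 1, …, m + k - 1 in turn.
  descendants : ℕ → ℕ → List ℕ → ℕ
  descendants zero    m l = if does (P? l) then 0 else 1
  descendants (suc k) m l = insertSum m (descendants k (suc m)) l

insertSum-cong : ∀ m {f g} l → (∀ a b → l ≡ a ++ b → f (a ++ m ∷ b) ≡ g (a ++ m ∷ b)) →
  insertSum m f l ≡ insertSum m g l
insertSum-cong m []      eq = eq [] [] refl
insertSum-cong m (x ∷ l) eq =
  cong₂ _+_ (eq [] (x ∷ l) refl) (insertSum-cong m l λ a b l≡ → eq (x ∷ a) b (cong (x ∷_) l≡))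

insertSum-0 : ∀ m l → insertSum m (λ _ → 0) l ≡ 0
insertSum-0 m []      = refl
insertSum-0 m (x ∷ l) = insertSum-0 m l

descendants-0 : ∀ {Q} (Q? : Decidable (Contains Q)) k m l → Contains Q l → descendants Q? k m l ≡ 0
descendants-0 Q? zero    m l c rewrite dec-true (Q? l) c = refl
descendants-0 Q? (suc k) m l c = trans
  (insertSum-cong m l λ a b l≡ → descendants-0 Q? k (suc m) (a ++ m ∷ b)
    (Contains-mono (⊆-insert a) (subst (Contains _) l≡ c)))
  (insertSum-0 m l)

sumℕ-head : ∀ n f → sumℕ (suc n) f ≡ f 0 + sumℕ n (f ∘ suc)
sumℕ-head zero    f = +-comm 0 (f 0)
sumℕ-head (suc n) f = trans (cong (_+ f (suc n)) (sumℕ-head n f)) (+-assoc (f 0) _ _)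

sumℕ-truncate : ∀ n c f → c ≤ n → (∀ i → c ≤ i → i < n → f i ≡ 0) → sumℕ n f ≡ sumℕ c f
sumℕ-truncate zero    zero _ _ _ = refl
sumℕ-truncate (suc n) c    f c≤1+n eq with m≤n⇒m<n∨m≡n c≤1+n
... | inj₂ refl    = refl
... | inj₁ (s≤s c≤n) = trans (cong₂ _+_ (sumℕ-truncate n c f c≤n λ i c≤i i<n → eq i c≤i (m<n⇒m<1+n i<n))
                                         (eq n c≤n (n<1+n n))) (+-identityʳ _)

sumℕ-sumAbove : ∀ N c h f → c ≤ N → (∀ i → c ≤ i → i < N → h i ≡ f (suc i)) → sumℕ N h ≡ sumℕ c h + sumAbove f c N
sumℕ-sumAbove zero    zero h f _ _ = refl
sumℕ-sumAbove (suc N) c    h f c≤1+N eq with m≤n⇒m<n∨m≡n c≤1+N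
... | inj₂ refl      = sym (trans (cong (sumℕ (suc N) h +_) (sumAbove-0 f (suc N) (suc N) ≤-refl)) (+-identityʳ _))
... | inj₁ (s≤s c≤N) = begin
  sumℕ N h + h N                              ≡⟨ cong₂ _+_ (sumℕ-sumAbove N c h f c≤N λ i c≤i i<N → eq i c≤i (m<n⇒m<1+n i<N))
                                                           (eq N c≤N (n<1+n N)) ⟩
  (sumℕ c h + sumAbove f c N) + f (suc N)     ≡⟨ +-assoc (sumℕ c h) _ _ ⟩
  sumℕ c h + (sumAbove f c N + f (suc N))     ≡⟨ cong (sumℕ c h +_) (trans (+-comm _ (f (suc N))) (sym (sumAbove-suc f c N c≤N))) ⟩
  sumℕ c h + sumAbove f c (suc N)             ∎
  where open ≡-Reasoning

insertSum-length : ∀ m f l g → (∀ a b → l ≡ a ++ b → f (a ++ m ∷ b) ≡ g (length b)) →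
  insertSum m f l ≡ sumℕ (suc (length l)) g
insertSum-length m f []      g eq = eq [] [] refl
insertSum-length m f (x ∷ l) g eq = trans
  (cong₂ _+_ (eq [] (x ∷ l) refl) (insertSum-length m (f ∘ (x ∷_)) l g λ a b l≡ → eq (x ∷ a) b (cong (x ∷_) l≡)))
  (+-comm (g (suc (length l))) _)

-- The suffixes of l satisfying P are exactly those longer than n.
record LongestSuffix (P : List ℕ → Set) (l : List ℕ) (n : ℕ) : Set where
  constructor longest
  field
    bound : n ≤ length l
    short : ∀ a b → l ≡ a ++ b → length b ≤ n → ¬ P b
    long  : ∀ a b → l ≡ a ++ b → n < length b → P b

open LongestSuffix

suffix-insert : ∀ {m : ℕ} a {b} a′ b′ → a ++ m ∷ b ≡ a′ ++ b′ →
  (∃ λ c → b ≡ c ++ b′) ⊎ (∃ λ c → a ≡ a′ ++ c × b′ ≡ c ++ m ∷ b)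
suffix-insert a       []       b′ refl = inj₂ (a , refl , refl)
suffix-insert []      (y ∷ a′) b′ eq   = inj₁ (a′ , ∷-injectiveʳ eq)
suffix-insert (x ∷ a) (y ∷ a′) b′ eq with refl , eq′ ← ∷-injective eq with suffix-insert a a′ b′ eq′
... | inj₁ p                  = inj₁ p
... | inj₂ (c , refl , eq″) = inj₂ (c , refl , eq″)

length-suffix : ∀ {l : List ℕ} c {b} → l ≡ c ++ b → length b ≤ length l
length-suffix c {b} refl = length-++-≤ʳ b {c}

length-insert : ∀ {m : ℕ} a {b} → length (a ++ m ∷ b) ≡ suc (length (a ++ b))
length-insert []      = refl
length-insert (x ∷ a) = cong suc (length-insert a)

length-insert-> : ∀ {m : ℕ} c {b} → length b < length (c ++ m ∷ b)
length-insert-> c {b} = length-suffix c refl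

nonempty-decreasing : ∀ {m b} → All (_< m) b → 1 ≤ length b → Contains (Decreasing 2) (m ∷ b)
nonempty-decreasing {m} {y ∷ b} (y<m ∷ _) _ = m ∷ y ∷ [] , refl ∷ refl ∷ minimum b , (y<m ∷ []) ∷ [] ∷ [] , refl

++-suffix : ∀ {l : List ℕ} a {b} c {b′} → l ≡ a ++ b → b ≡ c ++ b′ → l ≡ (a ++ c) ++ b′
++-suffix a c refl refl = sym (++-assoc a c _)

module _ {m : ℕ} {l : List ℕ} (a b : List ℕ) (l≡ : l ≡ a ++ b) (l<m : All (_< m) l) where

  private
    a<m : All (_< m) a
    a<m = Allₚ.++⁻ˡ a (subst (All (_< m)) l≡ l<m)
    b<m : All (_< m) b
    b<m = Allₚ.++⁻ʳ a (subst (All (_< m)) l≡ l<m)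
    suffix<m : ∀ a′ c → a ≡ a′ ++ c → All (_< m) c
    suffix<m a′ c eq = Allₚ.++⁻ʳ a′ (subst (All (_< m)) eq a<m)
    l-suffix : ∀ a′ c → a ≡ a′ ++ c → l ≡ a′ ++ (c ++ b)
    l-suffix a′ c refl = trans l≡ (++-assoc a′ c b)

  insert-bounded : All (_< suc m) (a ++ m ∷ b)
  insert-bounded = Allₚ.++⁺ (All.map m<n⇒m<1+n a<m) (n<1+n m ∷ All.map m<n⇒m<1+n b<m)

  -- A new maximum acts on the longest avoiding suffix in one of three ways: it joins the suffix
  -- (`extend`), it heads a forbidden sequence and leaves only `b` (`cut`), or it lands further left
  -- and changes nothing (`keep`).
  longest-insert-extend : ∀ {j N} → LongestSuffix (Contains (Decreasing (suc j))) l N → length b ≤ N →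
    ¬ Contains (Decreasing j) b →
    LongestSuffix (Contains (Decreasing (suc j))) (a ++ m ∷ b) (suc N)
  longest-insert-extend {j} {N} L b≤N ¬b = longest
    (subst (suc N ≤_) (sym (trans (length-insert a) (cong (suc ∘ length) (sym l≡)))) (s≤s (bound L)))
    (λ a′ b′ eq b′≤ → sh (suffix-insert a a′ b′ eq) b′≤)
    (λ a′ b′ eq <b′ → lo (suffix-insert a a′ b′ eq) <b′)
    where
    sh : ∀ {a′ b′} → (∃ λ c → b ≡ c ++ b′) ⊎ (∃ λ c → a ≡ a′ ++ c × b′ ≡ c ++ m ∷ b) →
      length b′ ≤ suc N → ¬ Contains (Decreasing (suc j)) b′
    sh {b′ = b′} (inj₁ (c , refl)) _ = short L (a ++ c) b′ (++-suffix a c l≡ refl) (≤-trans (length-suffix c refl) b≤N)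
    sh {a′} (inj₂ (c , a≡ , refl)) b′≤ con with decreasing-insert⁻ c (suffix<m a′ c a≡) con
    ... | inj₁ con′ = short L a′ (c ++ b) (l-suffix a′ c a≡) (s≤s⁻¹ (subst (_≤ suc N) (length-insert c) b′≤)) con′
    ... | inj₂ con′ = ¬b con′
    lo : ∀ {a′ b′} → (∃ λ c → b ≡ c ++ b′) ⊎ (∃ λ c → a ≡ a′ ++ c × b′ ≡ c ++ m ∷ b) →
      suc N < length b′ → Contains (Decreasing (suc j)) b′
    lo (inj₁ (c , b≡)) <b′ =
      contradiction (≤-trans (length-suffix c b≡) b≤N) (<⇒≱ (<-trans (n<1+n N) <b′))
    lo {a′} (inj₂ (c , a≡ , refl)) <b′ = Contains-mono (⊆-insert c)
      (long L a′ (c ++ b) (l-suffix a′ c a≡) (s≤s⁻¹ (subst (suc N <_) (length-insert c) <b′)))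

  longest-insert-cut : ∀ {j N} → LongestSuffix (Contains (Decreasing (suc j))) l N → length b ≤ N →
    Contains (Decreasing (suc j)) (m ∷ b) →
    LongestSuffix (Contains (Decreasing (suc j))) (a ++ m ∷ b) (length b)
  longest-insert-cut {j} {N} L b≤N con = longest
    (<⇒≤ (length-insert-> a))
    (λ a′ b′ eq b′≤ → sh (suffix-insert a a′ b′ eq) b′≤)
    (λ a′ b′ eq <b′ → lo (suffix-insert a a′ b′ eq) <b′)
    where
    sh : ∀ {a′ b′} → (∃ λ c → b ≡ c ++ b′) ⊎ (∃ λ c → a ≡ a′ ++ c × b′ ≡ c ++ m ∷ b) →
      length b′ ≤ length b → ¬ Contains (Decreasing (suc j)) b′
    sh {b′ = b′} (inj₁ (c , b≡)) b′≤ = short L (a ++ c) b′ (++-suffix a c l≡ b≡) (≤-trans b′≤ b≤N)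
    sh (inj₂ (c , a≡ , refl)) b′≤ = contradiction (length-insert-> c) (≤⇒≯ b′≤)
    lo : ∀ {a′ b′} → (∃ λ c → b ≡ c ++ b′) ⊎ (∃ λ c → a ≡ a′ ++ c × b′ ≡ c ++ m ∷ b) →
      length b < length b′ → Contains (Decreasing (suc j)) b′
    lo (inj₁ (c , b≡)) <b′ = contradiction (length-suffix c b≡) (<⇒≱ <b′)
    lo (inj₂ (c , a≡ , refl)) _ = Contains-mono (++⁺ˡ c ⊆-refl) con

  longest-insert-keep : ∀ {j N} → LongestSuffix (Contains (Decreasing (suc j))) l N → N < length b →
    LongestSuffix (Contains (Decreasing (suc j))) (a ++ m ∷ b) N
  longest-insert-keep {j} {N} L N<b = longest
    (≤-trans (<⇒≤ N<b) (<⇒≤ (length-insert-> a)))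
    (λ a′ b′ eq b′≤ → sh (suffix-insert a a′ b′ eq) b′≤)
    (λ a′ b′ eq <b′ → lo (suffix-insert a a′ b′ eq) <b′)
    where
    sh : ∀ {a′ b′} → (∃ λ c → b ≡ c ++ b′) ⊎ (∃ λ c → a ≡ a′ ++ c × b′ ≡ c ++ m ∷ b) →
      length b′ ≤ N → ¬ Contains (Decreasing (suc j)) b′
    sh {b′ = b′} (inj₁ (c , b≡)) b′≤ = short L (a ++ c) b′ (++-suffix a c l≡ b≡) b′≤
    sh (inj₂ (c , a≡ , refl)) b′≤ = contradiction (<-trans N<b (length-insert-> c)) (≤⇒≯ b′≤)
    lo : ∀ {a′ b′} → (∃ λ c → b ≡ c ++ b′) ⊎ (∃ λ c → a ≡ a′ ++ c × b′ ≡ c ++ m ∷ b) →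
      N < length b′ → Contains (Decreasing (suc j)) b′
    lo {b′ = b′} (inj₁ (c , b≡)) <b′ = long L (a ++ c) b′ (++-suffix a c l≡ b≡) <b′
    lo (inj₂ (c , a≡ , refl)) _ = Contains-mono (++⁺ˡ c (skip m ⊆-refl)) (long L a b l≡ N<b)

  longest-insert-21 : ∀ {k} → LongestSuffix (Contains (Decreasing 2)) l k → length b ≤ k → 1 ≤ length b →
    LongestSuffix (Contains (Decreasing 2)) (a ++ m ∷ b) (length b)
  longest-insert-21 L b≤k 1≤b = longest-insert-cut L b≤k (nonempty-decreasing b<m 1≤b)

  decreasing-insert⁺ : ∀ {j} → Contains (Decreasing j) b → Contains (Decreasing (suc j)) (a ++ m ∷ b)
  decreasing-insert⁺ c = Contains-mono (++⁺ˡ a ⊆-refl) (decreasing-cons b<m c)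

  longest-insert-321 : ∀ {N} → LongestSuffix (Contains (Decreasing 3)) l N → length b ≤ N → Contains (Decreasing 2) b →
    LongestSuffix (Contains (Decreasing 3)) (a ++ m ∷ b) (length b)
  longest-insert-321 L b≤N c = longest-insert-cut L b≤N (decreasing-cons b<m c)

  ¬decreasing-insert : ∀ {j} → ¬ Contains (Decreasing (suc j)) l → ¬ Contains (Decreasing j) b →
    ¬ Contains (Decreasing (suc j)) (a ++ m ∷ b)
  ¬decreasing-insert {j} ¬l ¬b con with decreasing-insert⁻ a a<m con
  ... | inj₁ con′ = ¬l (subst (Contains (Decreasing (suc j))) (sym l≡) con′)
  ... | inj₂ con′ = ¬b con′

  longest-insert-end : ∀ {k} → LongestSuffix (Contains (Decreasing 2)) l k → length b ≡ 0 →
    LongestSuffix (Contains (Decreasing 2)) (a ++ m ∷ b) (suc k)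
  longest-insert-end L b≡0 = longest-insert-extend L (subst (_≤ _) (sym b≡0) z≤n)
    λ { (s , s⊆ , _ , len) → ¬1 b s b≡0 s⊆ len }
    where
    ¬1 : ∀ b s → length b ≡ 0 → s ⊆ b → length s ≡ 1 → _
    ¬1 [] .[] _ [] ()

-- Descendants of a word as nodes of the generating trees

decreasing? : ∀ j → Decidable (Contains (Decreasing j))
decreasing? j = contains? λ s → allPairs? _>?_ s ×-dec (length s ≟ j)

-- The state is the length c of the longest increasing suffix. A maximum placed at the end gives c +
-- 1; in front of i entries it gives i when 1 ≤ i ≤ c, and completes a 321 when i > c.
descendants-321 : ∀ k m l c → All (_< m) l → ¬ Contains (Decreasing 3) l →
  LongestSuffix (Contains (Decreasing 2)) l c → descendants (decreasing? 3) k m l ≡ tree321 k c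
descendants-321 zero    m l c l<m ¬l L rewrite dec-false (decreasing? 3 l) ¬l = refl
descendants-321 (suc k) m l c l<m ¬l L = begin
  insertSum m (descendants (decreasing? 3) k (suc m)) l   ≡⟨ insertSum-length m _ l g site ⟩
  sumℕ (suc (length l)) g                                 ≡⟨ sumℕ-head (length l) g ⟩
  g 0 + sumℕ (length l) (g ∘ suc)                         ≡⟨ +-comm (g 0) _ ⟩
  sumℕ (length l) (g ∘ suc) + tree321 k (suc c)           ≡⟨ cong (_+ tree321 k (suc c)) (sumℕ-truncate (length l) c (g ∘ suc) (bound L) (λ i c≤i _ → vanish i c≤i)) ⟩
  sumℕ c (g ∘ suc) + tree321 k (suc c)                    ≡⟨ cong (_+ tree321 k (suc c)) (sumℕ-cong c keep) ⟩
  sumℕ (suc c) (λ i → tree321 k (suc i))                  ∎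
  where
  open ≡-Reasoning
  g : ℕ → ℕ
  g zero    = tree321 k (suc c)
  g (suc i) = if does (suc i ≤? c) then tree321 k (suc i) else 0
  vanish : ∀ i → c ≤ i → g (suc i) ≡ 0
  vanish i c≤i rewrite dec-false (suc i ≤? c) (≤⇒≯ c≤i) = refl
  keep : ∀ i → i < c → g (suc i) ≡ tree321 k (suc i)
  keep i i<c rewrite dec-true (suc i ≤? c) i<c = refl
  avoid : ∀ a b → l ≡ a ++ b → length b ≤ c → ¬ Contains (Decreasing 3) (a ++ m ∷ b)
  avoid a b l≡ b≤c = ¬decreasing-insert a b l≡ l<m ¬l (short L a b l≡ b≤c)
  site : ∀ a b → l ≡ a ++ b → descendants (decreasing? 3) k (suc m) (a ++ m ∷ b) ≡ g (length b)
  site a [] l≡ = descendants-321 k (suc m) _ (suc c) (insert-bounded a [] l≡ l<m)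
    (avoid a [] l≡ z≤n) (longest-insert-end a [] l≡ l<m L refl)
  site a b@(_ ∷ b′) l≡ with length b ≤? c
  ... | yes b≤c = trans
    (descendants-321 k (suc m) _ (length b) (insert-bounded a b l≡ l<m)
      (avoid a b l≡ b≤c) (longest-insert-21 a b l≡ l<m L b≤c (s≤s z≤n)))
    (sym (keep (length b′) b≤c))
  ... | no  b≰c = trans
    (descendants-0 (decreasing? 3) k (suc m) _ (decreasing-insert⁺ a b l≡ l<m (long L a b l≡ (≰⇒> b≰c))))
    (sym (vanish (length b′) (s≤s⁻¹ (≰⇒> b≰c))))

descendants-4321 : ∀ k m l c N → All (_< m) l → ¬ Contains (Decreasing 4) l → c ≤ N →
  LongestSuffix (Contains (Decreasing 2)) l c → LongestSuffix (Contains (Decreasing 3)) l N →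
  descendants (decreasing? 4) k m l ≡ tree1234 k c N
descendants-4321 zero    m l c N l<m ¬l c≤N L L′ rewrite dec-false (decreasing? 4 l) ¬l = refl
descendants-4321 (suc k) m l c N l<m ¬l c≤N L L′ = begin
  insertSum m (descendants (decreasing? 4) k (suc m)) l   ≡⟨ insertSum-length m _ l g site ⟩
  sumℕ (suc (length l)) g                                 ≡⟨ sumℕ-head (length l) g ⟩
  g 0 + sumℕ (length l) (g ∘ suc)                         ≡⟨ cong (g 0 +_) (sumℕ-truncate (length l) N (g ∘ suc) (bound L′) (λ i N≤i _ → vanish i N≤i)) ⟩
  g 0 + sumℕ N (g ∘ suc)                                  ≡⟨ cong (g 0 +_) (sumℕ-sumAbove N c (g ∘ suc) (tree1234 k c) c≤N cut) ⟩
  g 0 + (sumℕ c (g ∘ suc) + above)                        ≡⟨ +-assoc (g 0) _ _ ⟨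
  g 0 + sumℕ c (g ∘ suc) + above                          ≡⟨ cong (_+ above) (+-comm (g 0) _) ⟩
  sumℕ c (g ∘ suc) + g 0 + above                          ≡⟨ cong (λ s → s + g 0 + above) (sumℕ-cong c keep) ⟩
  sumℕ (suc c) (λ i → tree1234 k (suc i) (suc N)) + above ∎
  where
  open ≡-Reasoning
  above : ℕ
  above = sumAbove (tree1234 k c) c N
  g : ℕ → ℕ
  g zero    = tree1234 k (suc c) (suc N)
  g (suc i) = if does (suc i ≤? c) then tree1234 k (suc i) (suc N)
              else if does (suc i ≤? N) then tree1234 k c (suc i) else 0
  vanish : ∀ i → N ≤ i → g (suc i) ≡ 0
  vanish i N≤i rewrite dec-false (suc i ≤? c) (≤⇒≯ (≤-trans c≤N N≤i)) | dec-false (suc i ≤? N) (≤⇒≯ N≤i) = refl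
  cut : ∀ i → c ≤ i → i < N → g (suc i) ≡ tree1234 k c (suc i)
  cut i c≤i i<N rewrite dec-false (suc i ≤? c) (≤⇒≯ c≤i) | dec-true (suc i ≤? N) i<N = refl
  keep : ∀ i → i < c → g (suc i) ≡ tree1234 k (suc i) (suc N)
  keep i i<c rewrite dec-true (suc i ≤? c) i<c = refl
  avoid : ∀ a b → l ≡ a ++ b → length b ≤ N → ¬ Contains (Decreasing 4) (a ++ m ∷ b)
  avoid a b l≡ b≤N = ¬decreasing-insert a b l≡ l<m ¬l (short L′ a b l≡ b≤N)
  site : ∀ a b → l ≡ a ++ b → descendants (decreasing? 4) k (suc m) (a ++ m ∷ b) ≡ g (length b)
  site a [] l≡ = descendants-4321 k (suc m) _ (suc c) (suc N) (insert-bounded a [] l≡ l<m)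
    (avoid a [] l≡ z≤n) (s≤s c≤N) (longest-insert-end a [] l≡ l<m L refl)
    (longest-insert-extend a [] l≡ l<m L′ z≤n (short L a [] l≡ z≤n))
  site a b@(_ ∷ b′) l≡ with length b ≤? c
  ... | yes b≤c = trans
    (descendants-4321 k (suc m) _ (length b) (suc N) (insert-bounded a b l≡ l<m)
      (avoid a b l≡ (≤-trans b≤c c≤N)) (m≤n⇒m≤1+n (≤-trans b≤c c≤N))
      (longest-insert-21 a b l≡ l<m L b≤c (s≤s z≤n))
      (longest-insert-extend a b l≡ l<m L′ (≤-trans b≤c c≤N) (short L a b l≡ b≤c)))
    (sym (keep (length b′) b≤c))
  ... | no b≰c with length b ≤? N
  ... | yes b≤N = trans
    (descendants-4321 k (suc m) _ c (length b) (insert-bounded a b l≡ l<m)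
      (avoid a b l≡ b≤N) (<⇒≤ (≰⇒> b≰c))
      (longest-insert-keep a b l≡ l<m L (≰⇒> b≰c))
      (longest-insert-321 a b l≡ l<m L′ b≤N (long L a b l≡ (≰⇒> b≰c))))
    (sym (cut (length b′) (s≤s⁻¹ (≰⇒> b≰c)) b≤N))
  ... | no b≰N = trans
    (descendants-0 (decreasing? 4) k (suc m) _ (decreasing-insert⁺ a b l≡ l<m (long L′ a b l≡ (≰⇒> b≰N))))
    (sym (vanish (length b′) (s≤s⁻¹ (≰⇒> b≰N))))

is4123? : Decidable Is4123
is4123? []      = no λ ()
is4123? (d ∷ t) = map′ (λ p → d , t , refl , p) (λ { (.d , .t , refl , p) → p })
  (All.all? (_<? d) t ×-dec allPairs? _<?_ t ×-dec (length t ≟ 3))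

rises : List ℕ → List Bool
rises []          = []
rises (x ∷ [])    = []
rises (x ∷ y ∷ l) = does (x <? y) ∷ rises (y ∷ l)

insertSum-dead : ∀ m f w u → (∀ w₁ y w₂ → w ≡ w₁ ++ y ∷ w₂ → f (w₁ ++ m ∷ y ∷ w₂ ++ u) ≡ 0) →
  insertSum m f (w ++ u) ≡ insertSum m (f ∘ (w ++_)) u
insertSum-dead m f []      u dead = refl
insertSum-dead m f (y ∷ w) u dead = cong₂ _+_ (dead [] y w refl)
  (insertSum-dead m (f ∘ (y ∷_)) w u λ w₁ z w₂ eq → dead (y ∷ w₁) z w₂ (cong (y ∷_) eq))

rises-falling : ∀ r y t → ¬ Contains (Increasing 2) (r ++ [ y ]) → rises (r ++ y ∷ t) ≡ replicate (length r) false ++ rises (y ∷ t)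
rises-falling []          y t _ = refl
rises-falling (x ∷ [])    y t ¬inc =
  cong (_∷ rises (y ∷ t)) (dec-false (x <? y) λ x<y → ¬inc (x ∷ y ∷ [] , ⊆-refl , (x<y ∷ []) ∷ [] ∷ [] , refl))
rises-falling (x ∷ z ∷ r) y t ¬inc = cong₂ _∷_
  (dec-false (x <? z) λ x<z → ¬inc (x ∷ z ∷ [] , refl ∷ refl ∷ minimum _ , (x<z ∷ []) ∷ [] ∷ [] , refl))
  (rises-falling (z ∷ r) y t λ c → ¬inc (Contains-mono (skip x ⊆-refl) c))

falling-snoc : ∀ r {y z} → ¬ Contains (Increasing 2) (r ++ [ y ]) → ¬ y < z → ¬ Contains (Increasing 2) ((r ++ [ y ]) ++ [ z ])
falling-snoc []      ¬inc y≮z (_ , refl ∷ refl ∷ [] , (y<z ∷ _) ∷ _ , _) = y≮z y<z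
falling-snoc []      ¬inc y≮z (_ , skip _ (skip _ []) , _ , ())
falling-snoc []      ¬inc y≮z (_ , skip _ (refl ∷ []) , _ , ())
falling-snoc []      ¬inc y≮z (_ , refl ∷ skip _ [] , _ , ())
falling-snoc (x ∷ r) ¬inc y≮z (s , skip .x s⊆ , inc) =
  falling-snoc r (λ c → ¬inc (Contains-mono (skip x ⊆-refl) c)) y≮z (s , s⊆ , inc)
falling-snoc (x ∷ r) {y} {z} ¬inc y≮z (.x ∷ s , refl ∷ s⊆ , x<s ∷ inc , len) =
  contradiction (All-resp-⊆ s⊆ (All.tabulate {P = λ v → x ≮ v} above)) (below s len x<s)
  where
  x≮ : ∀ {v} → v ∈ r ++ [ y ] → x ≮ v
  x≮ {v} v∈ x<v = ¬inc (x ∷ v ∷ [] , refl ∷ from∈ v∈ , (x<v ∷ []) ∷ [] ∷ [] , refl)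
  above : ∀ {v} → v ∈ (r ++ [ y ]) ++ [ z ] → x ≮ v
  above v∈ with ∈-++⁻ (r ++ [ y ]) v∈
  ... | inj₁ v∈′        = x≮ v∈′
  ... | inj₂ (here refl) = λ x<z → y≮z (≤-<-trans (≮⇒≥ (x≮ (∈-++⁺ʳ r (here refl)))) x<z)
  below : ∀ s → length (x ∷ s) ≡ 2 → All (x <_) s → ¬ All (λ v → x ≮ v) s
  below (v ∷ []) _ (x<v ∷ []) (x≮v ∷ []) = x≮v x<v

-- Whatever precedes the active suffix u would complete an increasing triple with it.
Blocked : List ℕ → List ℕ → Set
Blocked w u = ∀ w₁ y w₂ → w ≡ w₁ ++ y ∷ w₂ → Contains (Increasing 3) (y ∷ w₂ ++ u)

++-assoc-∷ : ∀ (a b : List ℕ) y c → a ++ b ++ y ∷ c ≡ (a ++ b ++ [ y ]) ++ c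
++-assoc-∷ a b y c = trans (cong (a ++_) (sym (++-assoc b [ y ] c))) (sym (++-assoc a (b ++ [ y ]) c))

last-∈ : ∀ (a : List ℕ) {y} w₁ p w₂ → a ++ [ y ] ≡ w₁ ++ p ∷ w₂ → y ∈ p ∷ w₂
last-∈ []      []       p w₂ refl = here refl
last-∈ []      (_ ∷ []) p w₂ ()
last-∈ []      (_ ∷ _ ∷ _) p w₂ ()
last-∈ (x ∷ a) []       p w₂ refl = there (∈-++⁺ʳ a (here refl))
last-∈ (x ∷ a) (z ∷ w₁) p w₂ eq   = last-∈ a w₁ p w₂ (∷-injectiveʳ eq)

-- After `pre`, the list r ∷ʳ y is the part of the current falling run that precedes the insertion sites in b.
record Scan (m : ℕ) (pre r : List ℕ) (y : ℕ) (b : List ℕ) : Set where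
  field
    bounded  : All (_< m) (pre ++ r ++ y ∷ b)
    avoids   : ¬ Contains Is4123 (pre ++ r ++ y ∷ b)
    no123    : ¬ Contains (Increasing 3) (r ++ y ∷ b)
    falling  : ¬ Contains (Increasing 2) (r ++ [ y ])
    -- Either the triple is already present, or there is a pair in front of the site that the
    -- inserted maximum will complete.
    blocked  : ∀ w₁ p w₂ → pre ≡ w₁ ++ p ∷ w₂ →
      Contains (Increasing 3) (p ∷ w₂ ++ r ++ y ∷ b) ⊎ Contains (Increasing 2) (p ∷ w₂ ++ r ++ [ y ])

-- A maximum inserted anywhere after `z` turns the ascent from `y` to `z` into an increasing triple,
-- so from here on everything up to `y` gets cut off.
scan-climb : ∀ {m pre r y z b} → y < z → Scan m pre r y (z ∷ b) → Scan m (pre ++ r ++ [ y ]) [] z b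
scan-climb {m} {pre} {r} {y} {z} {b} y<z S = record
  { bounded = subst (All (_< m)) (++-assoc-∷ pre r y (z ∷ b)) bounded
  ; avoids  = avoids ∘ subst (Contains Is4123) (sym (++-assoc-∷ pre r y (z ∷ b)))
  ; no123   = no123 ∘ Contains-mono (++⁺ˡ r (skip y ⊆-refl))
  ; falling = λ { (_ , refl ∷ [] , _ , ()) ; (_ , skip _ [] , _ , ()) }
  ; blocked = λ w₁ p w₂ eq → inj₂
      (y ∷ z ∷ [] , ++⁺ (from∈ (last-∈ (pre ++ r) w₁ p w₂ (trans (++-assoc pre r [ y ]) eq))) ⊆-refl ,
       (y<z ∷ []) ∷ [] ∷ [] , refl)
  }
  where open Scan S

scan-fall : ∀ {m pre r y z b} → ¬ y < z → Scan m pre r y (z ∷ b) → Scan m pre (r ++ [ y ]) z b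
scan-fall {m} {pre} {r} {y} {z} {b} y≮z S = record
  { bounded = subst (λ u → All (_< m) (pre ++ u)) assoc bounded
  ; avoids  = avoids ∘ subst (λ u → Contains Is4123 (pre ++ u)) (sym assoc)
  ; no123   = no123 ∘ subst (Contains (Increasing 3)) (sym assoc)
  ; falling = falling-snoc r falling y≮z
  ; blocked = λ w₁ p w₂ eq → [ inj₁ ∘ subst (λ u → Contains (Increasing 3) (p ∷ w₂ ++ u)) assoc
                             , inj₂ ∘ Contains-mono (++⁺ (⊆-refl {x = p ∷ w₂}) (++⁺ʳ [ z ] ⊆-refl)) ]′ (blocked w₁ p w₂ eq)
  }
  where
  open Scan S
  assoc : r ++ y ∷ z ∷ b ≡ (r ++ [ y ]) ++ z ∷ b
  assoc = sym (++-assoc r [ y ] (z ∷ b))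

4123? : Decidable (Contains Is4123)
4123? = contains? is4123?

-- Sites inside the blocked part `w` complete a 4123. The site just before `x` lengthens the active
-- suffix and adds a fall to its word; the sites further right are visited by `descendants-scan`.
descendants-4123 : ∀ k m w x u → All (_< m) (w ++ x ∷ u) → ¬ Contains Is4123 (w ++ x ∷ u) →
  ¬ Contains (Increasing 3) (x ∷ u) → Blocked w (x ∷ u) →
  descendants 4123? k m (w ++ x ∷ u) ≡ tree3214 k (rises (x ∷ u))
descendants-scan : ∀ k m pre r y b → Scan m pre r y b →
  insertSum m (λ z → descendants 4123? k (suc m) (pre ++ r ++ y ∷ z)) b
    ≡ sites (tree3214 k) (length r) (rises (y ∷ b))
descendants-site : ∀ k m pre r y b → Scan m pre r y b →
  descendants 4123? k (suc m) (pre ++ r ++ y ∷ m ∷ b)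
    ≡ tree3214 k (replicate (length r) false ++ rises (y ∷ m ∷ b))

descendants-4123 zero    m w x u _   avoids _ _ rewrite dec-false (4123? (w ++ x ∷ u)) avoids = refl
descendants-4123 (suc k) m w x u l<m avoids no123 blocked = begin
  insertSum m f (w ++ x ∷ u)
    ≡⟨ insertSum-dead m f w (x ∷ u) dead ⟩
  f (w ++ m ∷ x ∷ u) + insertSum m (λ z → f (w ++ x ∷ z)) u
    ≡⟨ cong₂ _+_ front (descendants-scan k m w [] x u scan) ⟩
  tree3214 k (false ∷ rises (x ∷ u)) + sites (tree3214 k) 0 (rises (x ∷ u)) ∎
  where
  open ≡-Reasoning
  f : List ℕ → ℕ
  f = descendants 4123? k (suc m)
  w<m : All (_< m) w
  w<m = Allₚ.++⁻ˡ w l<m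
  u<m : All (_< m) (x ∷ u)
  u<m = Allₚ.++⁻ʳ w l<m
  dead : ∀ w₁ y w₂ → w ≡ w₁ ++ y ∷ w₂ → f (w₁ ++ m ∷ y ∷ w₂ ++ x ∷ u) ≡ 0
  dead w₁ y w₂ eq = descendants-0 4123? k (suc m) _ (Contains-mono (++⁺ˡ w₁ ⊆-refl) (4123-cons
    (Allₚ.++⁻ʳ w₁ (subst (All (_< m)) (trans (cong (_++ x ∷ u) eq) (++-assoc w₁ (y ∷ w₂) (x ∷ u))) l<m))
    (blocked w₁ y w₂ eq)))
  no123′ : ¬ Contains (Increasing 3) (m ∷ x ∷ u)
  no123′ con with increasing-insert⁻ [] u<m con
  ... | inj₁ con′               = no123 con′
  ... | inj₂ ([] , [] , _ , ())
  avoids′ : ¬ Contains Is4123 (w ++ m ∷ x ∷ u)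
  avoids′ con with 4123-insert⁻ w w<m con
  ... | inj₁ con′ = avoids con′
  ... | inj₂ con′ = no123 con′
  front : f (w ++ m ∷ x ∷ u) ≡ tree3214 k (false ∷ rises (x ∷ u))
  front = trans
    (descendants-4123 k (suc m) w m (x ∷ u)
      (Allₚ.++⁺ (All.map m<n⇒m<1+n w<m) (n<1+n m ∷ All.map m<n⇒m<1+n u<m)) avoids′ no123′
      λ w₁ y w₂ eq → Contains-mono (⊆-insert (y ∷ w₂)) (blocked w₁ y w₂ eq))
    (cong (λ c → tree3214 k (c ∷ rises (x ∷ u))) (dec-false (m <? x) (<-asym (All.head u<m))))
  scan : Scan m w [] x u
  scan = record
    { bounded = l<m
    ; avoids  = avoids
    ; no123   = no123
    ; falling = λ { (_ , refl ∷ [] , _ , ()) ; (_ , skip _ [] , _ , ()) }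
    ; blocked = λ w₁ p w₂ eq → inj₁ (blocked w₁ p w₂ eq)
    }

descendants-site k m pre r y b S = trans (startAt r refl)
  (cong (tree3214 k) (rises-falling r y (m ∷ b) falling))
  where
  open Scan S
  pre<m : All (_< m) pre
  pre<m = Allₚ.++⁻ˡ pre bounded
  ry<m : All (_< m) (r ++ [ y ])
  ry<m = Allₚ.++⁻ˡ (r ++ [ y ]) (subst (All (_< m)) (sym (++-assoc r [ y ] b)) (Allₚ.++⁻ʳ pre bounded))
  b<m : All (_< m) b
  b<m = All.tail (Allₚ.++⁻ʳ r (Allₚ.++⁻ʳ pre bounded))
  bounded′ : All (_< suc m) (pre ++ r ++ y ∷ m ∷ b)
  bounded′ = subst (All (_< suc m)) (sym (++-assoc-∷ pre r y (m ∷ b)))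
    (Allₚ.++⁺ (All.map m<n⇒m<1+n (Allₚ.++⁺ pre<m ry<m)) (n<1+n m ∷ All.map m<n⇒m<1+n b<m))
  avoids′ : ¬ Contains Is4123 (pre ++ r ++ y ∷ m ∷ b)
  avoids′ con with 4123-insert⁻ (pre ++ r ++ [ y ]) (Allₚ.++⁺ pre<m ry<m)
                     (subst (Contains Is4123) (++-assoc-∷ pre r y (m ∷ b)) con)
  ... | inj₁ con′ = avoids (subst (Contains Is4123) (sym (++-assoc-∷ pre r y b)) con′)
  ... | inj₂ con′ = no123 (Contains-mono (++⁺ˡ r (skip y ⊆-refl)) con′)
  no123′ : ¬ Contains (Increasing 3) (r ++ y ∷ m ∷ b)
  no123′ con with increasing-insert⁻ (r ++ [ y ]) b<m
                    (subst (Contains (Increasing 3)) (sym (++-assoc r [ y ] (m ∷ b))) con)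
  ... | inj₁ con′ = no123 (subst (Contains (Increasing 3)) (++-assoc r [ y ] b) con′)
  ... | inj₂ con′ = falling con′
  blocked′ : Blocked pre (r ++ y ∷ m ∷ b)
  blocked′ w₁ p w₂ eq with blocked w₁ p w₂ eq
  ... | inj₁ con = subst (Contains (Increasing 3)) (sym (++-assoc-∷ (p ∷ w₂) r y (m ∷ b)))
    (Contains-mono (⊆-insert (p ∷ w₂ ++ r ++ [ y ])) (subst (Contains (Increasing 3)) (++-assoc-∷ (p ∷ w₂) r y b) con))
  ... | inj₂ con = subst (Contains (Increasing 3)) (sym (++-assoc-∷ (p ∷ w₂) r y (m ∷ b)))
    (increasing-snoc (p ∷ w₂ ++ r ++ [ y ])
      (Allₚ.++⁺ (Allₚ.++⁻ʳ w₁ (subst (All (_< m)) eq pre<m)) ry<m) con)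
  -- `descendants-4123` wants the head of the active suffix exposed; this head comes from `r` unless
  -- `r` is empty.
  startAt : ∀ r′ → r′ ≡ r → descendants 4123? k (suc m) (pre ++ r ++ y ∷ m ∷ b) ≡ tree3214 k (rises (r ++ y ∷ m ∷ b))
  startAt []       refl = descendants-4123 k (suc m) pre y (m ∷ b) bounded′ avoids′ no123′ blocked′
  startAt (x ∷ r′) refl = descendants-4123 k (suc m) pre x (r′ ++ y ∷ m ∷ b) bounded′ avoids′ no123′ blocked′

descendants-scan k m pre r y [] S = trans (descendants-site k m pre r y [] S)
  (cong (λ c → tree3214 k (replicate (length r) false ++ c ∷ [])) (dec-true (y <? m) y<m))
  where
  y<m : y < m
  y<m = All.head (Allₚ.++⁻ʳ r (Allₚ.++⁻ʳ pre (Scan.bounded S)))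
descendants-scan k m pre r y (z ∷ b) S = cong₂ _+_ here′ (next (y <? z))
  where
  z≮ : All (_< m) (y ∷ z ∷ b)
  z≮ = Allₚ.++⁻ʳ r (Allₚ.++⁻ʳ pre (Scan.bounded S))
  here′ : descendants 4123? k (suc m) (pre ++ r ++ y ∷ m ∷ z ∷ b)
        ≡ tree3214 k (replicate (length r) false ++ true ∷ false ∷ rises (z ∷ b))
  here′ = trans (descendants-site k m pre r y (z ∷ b) S)
    (cong₂ (λ c c′ → tree3214 k (replicate (length r) false ++ c ∷ c′ ∷ rises (z ∷ b)))
      (dec-true (y <? m) (All.head z≮)) (dec-false (m <? z) (<-asym (All.head (All.tail z≮)))))
  next : Dec (y < z) → insertSum m (λ v → descendants 4123? k (suc m) (pre ++ r ++ y ∷ z ∷ v)) b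
       ≡ sites (tree3214 k) (if does (y <? z) then 0 else suc (length r)) (rises (z ∷ b))
  next (yes y<z) rewrite dec-true (y <? z) y<z = trans
    (insertSum-cong m b λ a c _ → cong (descendants 4123? k (suc m)) (++-assoc-∷ pre r y (z ∷ a ++ m ∷ c)))
    (descendants-scan k m (pre ++ r ++ [ y ]) [] z b (scan-climb y<z S))
  next (no y≮z) rewrite dec-false (y <? z) y≮z = trans
    (insertSum-cong m b λ a c _ → cong (λ v → descendants 4123? k (suc m) (pre ++ v)) (sym (++-assoc r [ y ] (z ∷ a ++ m ∷ c))))
    (trans (descendants-scan k m pre (r ++ [ y ]) z b (scan-fall y≮z S))
      (cong (λ j → sites (tree3214 k) j (rises (z ∷ b))) (trans (length-++ r) (+-comm (length r) 1))))

-- Permutations as lists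

unique-⊆⇒length-≤ : ∀ {A : Set} {xs ys : List A} → Unique xs → (∀ {x} → x ∈ xs → x ∈ ys) → length xs ≤ length ys
unique-⊆⇒length-≤ []            sub = z≤n
unique-⊆⇒length-≤ {xs = x ∷ xs} (x∉ ∷ uniq) sub with ∈-∃++ (sub (here refl))
... | as , bs , refl = ≤-trans (s≤s (unique-⊆⇒length-≤ uniq sub′)) (≤-reflexive (sym (↭-length (shift x as bs))))
  where
  sub′ : ∀ {y} → y ∈ xs → y ∈ as ++ bs
  sub′ {y} y∈ with ∈-resp-↭ (shift x as bs) (sub (there y∈))
  ... | here refl = contradiction refl (All.lookup x∉ y∈)
  ... | there y∈′ = y∈′

unique-map : ∀ {A B : Set} (f : A → B) {xs} → (∀ {x y} → x ∈ xs → y ∈ xs → f x ≡ f y → x ≡ y) →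
  Unique xs → Unique (map f xs)
unique-map f inj []            = []
unique-map f {x ∷ xs} inj (x∉ ∷ uniq) =
  Allₚ.map⁺ (All.tabulate λ y∈ eq → All.lookup x∉ y∈ (inj (here refl) (there y∈) eq))
  ∷ unique-map f (λ x∈ y∈ → inj (there x∈) (there y∈)) uniq

length-bijection : ∀ {A B : Set} (f : A → B) {xs ys} → Unique xs → Unique ys →
  (∀ {x y} → x ∈ xs → y ∈ xs → f x ≡ f y → x ≡ y) →
  (∀ {x} → x ∈ xs → f x ∈ ys) → (∀ {y} → y ∈ ys → ∃ λ x → x ∈ xs × f x ≡ y) → length xs ≡ length ys
length-bijection f {xs} {ys} uxs uys inj into onto = ≤-antisym
  (subst (_≤ length ys) (length-map f xs) (unique-⊆⇒length-≤ (unique-map f inj uxs) λ y∈ →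
    let x , x∈ , eq = ∈-map⁻ f y∈ in subst (_∈ ys) (sym eq) (into x∈)))
  (subst (length ys ≤_) (length-map f xs) (unique-⊆⇒length-≤ uys λ y∈ →
    let x , x∈ , eq = onto y∈ in subst (_∈ map f xs) eq (∈-map⁺ f x∈)))

unique-concatMap : ∀ {A B : Set} (f : A → List B) {xs} → Unique xs → (∀ {x} → x ∈ xs → Unique (f x)) →
  (∀ {x y z} → x ∈ xs → y ∈ xs → z ∈ f x → z ∈ f y → x ≡ y) → Unique (concatMap f xs)
unique-concatMap f []                     each apart = []
unique-concatMap f {x ∷ xs} (x∉ ∷ uniq) each apart =
  Uniqueₚ.++⁺ (each (here refl))
    (unique-concatMap f uniq (each ∘ there) λ x∈ y∈ → apart (there x∈) (there y∈))
    λ { (z∈ , z∈′) → let y , y∈ , z∈fy = find (∈-concatMap⁻ f {xs} z∈′) in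
        All.lookup x∉ y∈ (apart (here refl) (there y∈) z∈ z∈fy) }

PermutationOf : ℕ → List ℕ → Set
PermutationOf n l = Unique l × All (_< n) l × length l ≡ n

permutationOf-resp-↭ : ∀ {n l l′} → l ↭ l′ → PermutationOf n l → PermutationOf n l′
permutationOf-resp-↭ l↭l′ (uniq , bound , len) =
  Permutationₛ.Unique-resp-↭ (setoid ℕ) (↭⇒↭ₛ l↭l′) uniq , All-resp-↭ l↭l′ bound , trans (sym (↭-length l↭l′)) len

insertions : ℕ → List ℕ → List (List ℕ)
insertions m []      = [ [ m ] ]
insertions m (x ∷ l) = (m ∷ x ∷ l) ∷ map (x ∷_) (insertions m l)

∈-insertions⁻ : ∀ {m z} l → z ∈ insertions m l → ∃₂ λ a b → l ≡ a ++ b × z ≡ a ++ m ∷ b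
∈-insertions⁻ []      (here refl) = [] , [] , refl , refl
∈-insertions⁻ (x ∷ l) (here refl) = [] , x ∷ l , refl , refl
∈-insertions⁻ (x ∷ l) (there z∈) with ∈-map⁻ (x ∷_) z∈
... | z′ , z′∈ , refl with ∈-insertions⁻ l z′∈
... | a , b , refl , refl = x ∷ a , b , refl , refl

∈-insertions⁺ : ∀ {m} a b → a ++ m ∷ b ∈ insertions m (a ++ b)
∈-insertions⁺ []      []      = here refl
∈-insertions⁺ []      (x ∷ b) = here refl
∈-insertions⁺ (x ∷ a) b       = there (∈-map⁺ (x ∷_) (∈-insertions⁺ a b))

unique-insertions : ∀ {m} l → m ∉ l → Unique (insertions m l)
unique-insertions []      m∉ = [] ∷ []
unique-insertions (x ∷ l) m∉ =
  Allₚ.map⁺ (All.tabulate λ _ eq → m∉ (here (∷-injectiveˡ eq)))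
  ∷ Uniqueₚ.map⁺ ∷-injectiveʳ (unique-insertions l (m∉ ∘ there))

delete-injective : ∀ {m : ℕ} a {b} a′ {b′} → m ∉ a ++ b → m ∉ a′ ++ b′ → a ++ m ∷ b ≡ a′ ++ m ∷ b′ → a ++ b ≡ a′ ++ b′
delete-injective []      []        _  _   eq = ∷-injectiveʳ eq
delete-injective []      (x ∷ a′)  _  m∉  eq = contradiction (here (∷-injectiveˡ eq)) m∉
delete-injective (x ∷ a) []        m∉ _   eq = contradiction (here (sym (∷-injectiveˡ eq))) m∉
delete-injective (x ∷ a) (x′ ∷ a′) m∉ m∉′ eq =
  cong₂ _∷_ (∷-injectiveˡ eq) (delete-injective a a′ (m∉ ∘ there) (m∉′ ∘ there) (∷-injectiveʳ eq))

bounded⇒∉ : ∀ {n l} → All (_< n) l → n ∉ l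
bounded⇒∉ bound n∈ = <-irrefl refl (All.lookup bound n∈)

permutations : ℕ → List (List ℕ)
permutations zero    = [ [] ]
permutations (suc n) = concatMap (insertions n) (permutations n)

∈-permutations⁻ : ∀ {n l} → l ∈ permutations n → PermutationOf n l
∈-permutations⁻ {zero}  (here refl) = [] , [] , refl
∈-permutations⁻ {suc n} l∈ with find (∈-concatMap⁻ (insertions n) {permutations n} l∈)
... | l′ , l′∈ , l∈′ with ∈-insertions⁻ l′ l∈′
... | a , b , refl , refl with ∈-permutations⁻ l′∈
... | uniq , bound , len = permutationOf-resp-↭ (↭-sym (shift n a b))
  (All.map (λ x<n eq → <-irrefl (sym eq) x<n) bound ∷ uniq , n<1+n n ∷ All.map m<n⇒m<1+n bound , cong suc len)

-- A missing value `v` would make `v ∷ l` a list of more than n distinct numbers below n.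
covers : ∀ {n l} → Unique l → All (_< n) l → n ≤ length l → ∀ {v} → v < n → v ∈ l
covers {n} {l} uniq bound n≤ {v} v<n with v ∈? l
  where open import Data.List.Membership.DecPropositional _≟_ using (_∈?_)
... | yes v∈ = v∈
... | no  v∉ = contradiction (≤-trans (s≤s n≤) (unique-⊆⇒length-≤ {ys = upTo n} (All.tabulate (λ {x} x∈ eq → v∉ (subst (_∈ l) (sym eq) x∈)) ∷ uniq) sub))
                             (subst (λ k → ¬ suc n ≤ k) (sym (length-upTo n)) 1+n≰n)
  where
  sub : ∀ {x} → x ∈ v ∷ l → x ∈ upTo n
  sub (here refl) = ∈-upTo⁺ v<n
  sub (there x∈)  = ∈-upTo⁺ (All.lookup bound x∈)

∈-permutations⁺ : ∀ {n l} → PermutationOf n l → l ∈ permutations n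
∈-permutations⁺ {zero}  {[]} _ = here refl
∈-permutations⁺ {suc n} p@(uniq , bound , len) with ∈-∃++ (covers uniq bound (≤-reflexive (sym len)) (n<1+n n))
... | a , b , refl with permutationOf-resp-↭ (shift n a b) p
... | n∉ ∷ uniq′ , _ ∷ bound′ , len′ = ∈-concatMap⁺ (insertions n) (lose
  (∈-permutations⁺ (uniq′ , All.tabulate (λ x∈ → ≤∧≢⇒< (s≤s⁻¹ (All.lookup bound′ x∈)) (≢-sym (All.lookup n∉ x∈))) , suc-injective len′))
  (∈-insertions⁺ a b))

unique-permutations : ∀ n → Unique (permutations n)
unique-permutations zero    = [] ∷ []
unique-permutations (suc n) = unique-concatMap (insertions n) (unique-permutations n)
  (λ {l} l∈ → unique-insertions l (n∉ l∈))
  λ {l} {l′} l∈ l′∈ z∈ z∈′ → apart l∈ l′∈ (∈-insertions⁻ l z∈) (∈-insertions⁻ l′ z∈′)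
  where
  n∉ : ∀ {l} → l ∈ permutations n → n ∉ l
  n∉ l∈ = bounded⇒∉ (proj₁ (proj₂ (∈-permutations⁻ l∈)))
  apart : ∀ {l l′ z} → l ∈ permutations n → l′ ∈ permutations n →
    (∃₂ λ a b → l ≡ a ++ b × z ≡ a ++ n ∷ b) → (∃₂ λ a b → l′ ≡ a ++ b × z ≡ a ++ n ∷ b) → l ≡ l′
  apart l∈ l′∈ (a , b , refl , refl) (a′ , b′ , refl , eq) = delete-injective a a′ (n∉ l∈) (n∉ l′∈) eq

insertSum-insertions : ∀ m f l → insertSum m f l ≡ sum (map f (insertions m l))
insertSum-insertions m f []      = sym (+-identityʳ _)
insertSum-insertions m f (x ∷ l) = cong (f (m ∷ x ∷ l) +_)
  (trans (insertSum-insertions m (f ∘ (x ∷_)) l) (cong sum (map-∘ (insertions m l))))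

sum-concatMap : ∀ {A B : Set} (f : B → ℕ) (g : A → List B) xs →
  sum (map f (concatMap g xs)) ≡ sum (map (λ x → sum (map f (g x))) xs)
sum-concatMap f g []       = refl
sum-concatMap f g (x ∷ xs) = trans (cong sum (map-++ f (g x) (concatMap g xs)))
  (trans (sum-++ (map f (g x)) _) (cong (sum (map f (g x)) +_) (sum-concatMap f g xs)))

module _ {P : List ℕ → Set} (P? : Decidable P) where

  -- One round of insertions turns `permutations m` into `permutations (suc m)`, so after k rounds
  -- each permutation of k + m values is tested exactly once.
  descendants-permutations : ∀ k m →
    sum (map (descendants P? k m) (permutations m)) ≡ length (filter (¬? ∘ P?) (permutations (k + m)))
  descendants-permutations zero m = indicator (permutations m)
    where
    indicator : ∀ ls → sum (map (descendants P? zero m) ls) ≡ length (filter (¬? ∘ P?) ls)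
    indicator []       = refl
    indicator (l ∷ ls) with P? l
    ... | yes _ = indicator ls
    ... | no  _ = cong suc (indicator ls)
  descendants-permutations (suc k) m = begin
    sum (map (λ l → insertSum m (descendants P? k (suc m)) l) (permutations m))
      ≡⟨ cong sum (map-cong (insertSum-insertions m (descendants P? k (suc m))) (permutations m)) ⟩
    sum (map (λ l → sum (map (descendants P? k (suc m)) (insertions m l))) (permutations m))
      ≡⟨ sum-concatMap (descendants P? k (suc m)) (insertions m) (permutations m) ⟨
    sum (map (descendants P? k (suc m)) (permutations (suc m)))
      ≡⟨ descendants-permutations k (suc m) ⟩
    length (filter (¬? ∘ P?) (permutations (k + suc m)))
      ≡⟨ cong (length ∘ filter (¬? ∘ P?) ∘ permutations) (+-suc k m) ⟩
    length (filter (¬? ∘ P?) (permutations (suc k + m))) ∎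
    where open ≡-Reasoning

  count-avoiders : ∀ n → length (filter (¬? ∘ P?) (permutations n)) ≡ descendants P? n 0 []
  count-avoiders n = trans (cong (length ∘ filter (¬? ∘ P?) ∘ permutations) (sym (+-identityʳ n)))
    (trans (sym (descendants-permutations n 0)) (+-identityʳ _))

-- From vectors over `Fin` to words

word : ∀ {m k} → Vec (Fin m) k → List ℕ
word v = map toℕ (toList v)

word-injective : ∀ {m k} {v v′ : Vec (Fin m) k} → word v ≡ word v′ → v ≡ v′
word-injective {v = []}    {[]}     _  = refl
word-injective {v = x ∷ v} {y ∷ v′} eq =
  cong₂ _∷_ (toℕ-injective (∷-injectiveˡ eq)) (word-injective (∷-injectiveʳ eq))

word-bounded : ∀ {m k} (v : Vec (Fin m) k) → All (_< m) (word v)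
word-bounded []      = []
word-bounded (x ∷ v) = toℕ<n x ∷ word-bounded v

length-word : ∀ {m k} (v : Vec (Fin m) k) → length (word v) ≡ k
length-word []      = refl
length-word (x ∷ v) = cong suc (length-word v)

word-surjective : ∀ {m} l → All (_< m) l → ∃ λ (v : Vec (Fin m) (length l)) → word v ≡ l
word-surjective []      []            = [] , refl
word-surjective (x ∷ l) (x<m ∷ bound) with word-surjective l bound
... | v , eq = fromℕ< x<m ∷ v , cong₂ _∷_ (toℕ-fromℕ< x<m) eq

∈-word⁺ : ∀ {m k} (v : Vec (Fin m) k) i → toℕ (lookup v i) ∈ word v
∈-word⁺ (x ∷ v) fzero    = here refl
∈-word⁺ (x ∷ v) (fsuc i) = there (∈-word⁺ v i)

∈-word⁻ : ∀ {m k} (v : Vec (Fin m) k) {y} → y ∈ word v → ∃ λ i → toℕ (lookup v i) ≡ y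
∈-word⁻ (x ∷ v) (here refl) = fzero , refl
∈-word⁻ (x ∷ v) (there y∈) with ∈-word⁻ v y∈
... | i , eq = fsuc i , eq

unique⇒lookup-injective : ∀ {m k} (v : Vec (Fin m) k) → Unique (word v) → ∀ i j → lookup v i ≡ lookup v j → i ≡ j
unique⇒lookup-injective (x ∷ v) _            fzero    fzero    _  = refl
unique⇒lookup-injective (x ∷ v) (x∉ ∷ _)     fzero    (fsuc j) eq = contradiction (cong toℕ eq) (All.lookup x∉ (∈-word⁺ v j))
unique⇒lookup-injective (x ∷ v) (x∉ ∷ _)     (fsuc i) fzero    eq = contradiction (cong toℕ (sym eq)) (All.lookup x∉ (∈-word⁺ v i))
unique⇒lookup-injective (x ∷ v) (_ ∷ unique) (fsuc i) (fsuc j) eq = cong fsuc (unique⇒lookup-injective v unique i j eq)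

lookup-injective⇒unique : ∀ {m k} (v : Vec (Fin m) k) → (∀ i j → lookup v i ≡ lookup v j → i ≡ j) → Unique (word v)
lookup-injective⇒unique []      inj = []
lookup-injective⇒unique (x ∷ v) inj =
  All.tabulate (λ y∈ eq → let i , eq′ = ∈-word⁻ v y∈ in
    contradiction (inj fzero (fsuc i) (toℕ-injective (trans eq (sym eq′)))) λ ())
  ∷ lookup-injective⇒unique v λ i j eq → fsuc-injective (inj (fsuc i) (fsuc j) eq)

∈-allVec : ∀ {m k} (v : Vec (Fin m) k) → v ∈ allVec k m
∈-allVec []      = here refl
∈-allVec (x ∷ v) = ∈-concatMap⁺ _ (lose (∈-allFin x) (∈-map⁺ (x ∷_) (∈-allVec v)))

unique-allVec : ∀ k m → Unique (allVec k m)
unique-allVec zero    m = [] ∷ []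
unique-allVec (suc k) m = unique-concatMap _ (Uniqueₚ.allFin⁺ m)
  (λ _ → Uniqueₚ.map⁺ (λ { refl → refl }) (unique-allVec k m))
  λ {x} {y} _ _ z∈ z∈′ → apart (∈-map⁻ (x ∷_) z∈) (∈-map⁻ (y ∷_) z∈′)
  where
  apart : ∀ {x y : Fin m} {z} → (∃ λ v → v ∈ allVec k m × z ≡ x ∷ v) → (∃ λ v → v ∈ allVec k m × z ≡ y ∷ v) → x ≡ y
  apart (_ , _ , refl) (_ , _ , refl) = refl

isPerm⇒permutationOf : ∀ {n} (π : Vec (Fin n) n) → IsPerm π → PermutationOf n (word π)
isPerm⇒permutationOf π perm = lookup-injective⇒unique π perm , word-bounded π , length-word π

permutationOf⇒isPerm : ∀ {n l} → PermutationOf n l → ∃ λ (π : Vec (Fin n) n) → IsPerm π × word π ≡ l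
permutationOf⇒isPerm {l = l} (uniq , bound , refl) with word-surjective l bound
... | π , eq = π , unique⇒lookup-injective π (subst Unique (sym eq) uniq) , eq

-- h is the identity or the reversal.
countPerms-permutations : ∀ n {P : Vec (Fin n) n → Set} (P? : ∀ π → Dec (P π)) {Q : List ℕ → Set} (Q? : Decidable Q) (h : List ℕ → List ℕ) →
  (∀ l → h (h l) ≡ l) → (∀ l → l ↭ h l) → (∀ π → IsPerm π → P π ⇔ Q (h (word π))) →
  countPerms n P? ≡ length (filter Q? (permutations n))
countPerms-permutations n {P} P? {Q} Q? h inv perm P⇔Q = length-bijection (λ (π : Vec (Fin n) n) → h (word π))
  (Uniqueₚ.filter⁺ (λ π → isPerm? π ×-dec P? π) (unique-allVec n n))
  (Uniqueₚ.filter⁺ Q? (unique-permutations n))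
  (λ {π} {π′} _ _ eq → word-injective (trans (sym (inv (word π))) (trans (cong h eq) (inv (word π′)))))
  (λ {π} π∈ → let _ , isPerm , p = ∈-filter⁻ (λ π → isPerm? π ×-dec P? π) {xs = allVec n n} π∈ in
    ∈-filter⁺ Q? (∈-permutations⁺ (permutationOf-resp-↭ (perm _) (isPerm⇒permutationOf π isPerm)))
      (Equivalence.to (P⇔Q π isPerm) p))
  (λ {l} l∈ → let l∈′ , q = ∈-filter⁻ Q? {xs = permutations n} l∈
                  π , isPerm , eq = permutationOf⇒isPerm (permutationOf-resp-↭ (perm l) (∈-permutations⁻ l∈′))
                  eq′ = trans (cong h eq) (inv l) in
    π , ∈-filter⁺ (λ π → isPerm? π ×-dec P? π) (∈-allVec π)
          (isPerm , Equivalence.from (P⇔Q π isPerm) (subst Q (sym eq′) q)) , eq′)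

valueAt : ∀ {m k} → Vec (Fin m) k → Fin k → ℕ
valueAt v i = toℕ (lookup v i)

unshift : ∀ {k} (is : List (Fin (suc k))) → All (fzero {k} <ᶠ_) is → AllPairs _<ᶠ_ is →
  ∃ λ is′ → is ≡ map fsuc is′ × AllPairs _<ᶠ_ is′
unshift []            _           _             = [] , refl , []
unshift (fsuc i ∷ is) (_ ∷ 0<is) (i<is ∷ pairs) with unshift is 0<is pairs
... | is′ , refl , pairs′ = i ∷ is′ , refl , All.map s≤s⁻¹ (Allₚ.map⁻ i<is) ∷ pairs′

positions⇒⊆ : ∀ {m k} (v : Vec (Fin m) k) is → AllPairs _<ᶠ_ is → map (valueAt v) is ⊆ word v
positions⇒⊆ v       []            _              = minimum _
positions⇒⊆ (x ∷ v) (fzero ∷ is)  (0<is ∷ pairs) with unshift is 0<is pairs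
... | is′ , refl , pairs′ = refl ∷ subst (_⊆ word v) (map-∘ is′) (positions⇒⊆ v is′ pairs′)
positions⇒⊆ (x ∷ v) (fsuc i ∷ is) (i<is ∷ pairs) with unshift is (All.map (≤-<-trans z≤n) i<is) pairs
... | is′ , refl , pairs′ = skip (toℕ x) (subst (λ s → valueAt v i ∷ s ⊆ word v) (map-∘ is′)
  (positions⇒⊆ v (i ∷ is′) (All.map s≤s⁻¹ (Allₚ.map⁻ i<is) ∷ pairs′)))

⊆⇒positions : ∀ {m k} (v : Vec (Fin m) k) {s} → s ⊆ word v → ∃ λ is → s ≡ map (valueAt v) is × AllPairs _<ᶠ_ is
⊆⇒positions []      []          = [] , refl , []
⊆⇒positions (x ∷ v) (skip _ s⊆) with ⊆⇒positions v s⊆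
... | is , refl , pairs = map fsuc is , map-∘ is , AllPairsₚ.map⁺ (AllPairs.map s≤s pairs)
⊆⇒positions (x ∷ v) (refl ∷ s⊆) with ⊆⇒positions v s⊆
... | is , refl , pairs = fzero ∷ map fsuc is , cong (toℕ x ∷_) (map-∘ is) ,
  Allₚ.map⁺ (All.universal (λ _ → s≤s z≤n) is) ∷ AllPairsₚ.map⁺ (AllPairs.map s≤s pairs)

three : ∀ {A : Set} {_≺_ : A → A → Set} → (∀ {a b c} → a ≺ b → b ≺ c → a ≺ c) →
  ∀ {a b c} → a ≺ b → b ≺ c → AllPairs _≺_ (a ∷ b ∷ c ∷ [])
three tr ab bc = (ab ∷ tr ab bc ∷ []) ∷ (bc ∷ []) ∷ [] ∷ []

four : ∀ {A : Set} {_≺_ : A → A → Set} → (∀ {a b c} → a ≺ b → b ≺ c → a ≺ c) →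
  ∀ {a b c d} → a ≺ b → b ≺ c → c ≺ d → AllPairs _≺_ (a ∷ b ∷ c ∷ d ∷ [])
four tr ab bc cd = (ab ∷ tr ab bc ∷ tr ab (tr bc cd) ∷ []) ∷ three tr bc cd

contains321⇔ : ∀ {n} (π : Vec (Fin n) n) → Contains321 π ⇔ Contains (Decreasing 3) (word π)
contains321⇔ π = mk⇔
  (λ { (i , j , l , i<j , j<l , l<j , j<i) →
    _ , positions⇒⊆ π (i ∷ j ∷ l ∷ []) (three <-trans i<j j<l) , three (λ p q → <-trans q p) j<i l<j , refl })
  (λ { (s , s⊆ , dec) → to s (⊆⇒positions π s⊆) dec })
  where
  to : ∀ s → (∃ λ is → s ≡ map (valueAt π) is × AllPairs _<ᶠ_ is) → Decreasing 3 s → Contains321 π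
  to _ (i ∷ j ∷ l ∷ [] , refl , (i<j ∷ _) ∷ (j<l ∷ _) ∷ _) ((j<i ∷ _) ∷ (l<j ∷ _) ∷ _ , _) =
    i , j , l , i<j , j<l , l<j , j<i
  to _ ([] , refl , _) (_ , ())
  to _ (_ ∷ [] , refl , _) (_ , ())
  to _ (_ ∷ _ ∷ [] , refl , _) (_ , ())
  to _ (_ ∷ _ ∷ _ ∷ _ ∷ _ , refl , _) (_ , ())

contains-reverse : ∀ {Q l} → Contains (Q ∘ reverse) l ⇔ Contains Q (reverse l)
contains-reverse {Q} {l} = mk⇔
  (λ { (s , s⊆ , q) → reverse s , reverse⁺ s⊆ , q })
  (λ { (s , s⊆ , q) → reverse s , subst (reverse s ⊆_) (reverse-involutive l) (reverse⁺ s⊆) ,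
                      subst Q (sym (reverse-involutive s)) q })

fourPositions : ∀ {n} (π : Vec (Fin n) n) {Q : List ℕ → Set} → (∀ {s} → Q s → length s ≡ 4) →
  Contains Q (word π) → ∃ λ i → ∃ λ j → ∃ λ l → ∃ λ m → (i <ᶠ j) × (j <ᶠ l) × (l <ᶠ m) ×
    Q (valueAt π i ∷ valueAt π j ∷ valueAt π l ∷ valueAt π m ∷ [])
fourPositions π {Q} len (s , s⊆ , q) = to s (⊆⇒positions π s⊆) q (len q)
  where
  to : ∀ s → (∃ λ is → s ≡ map (valueAt π) is × AllPairs _<ᶠ_ is) → Q s → length s ≡ 4 →
    ∃ λ i → ∃ λ j → ∃ λ l → ∃ λ m → (i <ᶠ j) × (j <ᶠ l) × (l <ᶠ m) ×
      Q (valueAt π i ∷ valueAt π j ∷ valueAt π l ∷ valueAt π m ∷ [])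
  to _ (i ∷ j ∷ l ∷ m ∷ [] , refl , (i<j ∷ _) ∷ (j<l ∷ _) ∷ (l<m ∷ _) ∷ _) q _ = i , j , l , m , i<j , j<l , l<m , q
  to _ ([] , refl , _) _ ()
  to _ (_ ∷ [] , refl , _) _ ()
  to _ (_ ∷ _ ∷ [] , refl , _) _ ()
  to _ (_ ∷ _ ∷ _ ∷ [] , refl , _) _ ()
  to _ (_ ∷ _ ∷ _ ∷ _ ∷ _ ∷ _ , refl , _) _ ()

contains1234⇔ : ∀ {n} (π : Vec (Fin n) n) → Contains1234 π ⇔ Contains (Decreasing 4) (reverse (word π))
contains1234⇔ π = mk⇔
  (λ { (i , j , l , m , i<j , j<l , l<m , i<j′ , j<l′ , l<m′) → Equivalence.to contains-reverse
    (_ , positions⇒⊆ π (i ∷ j ∷ l ∷ m ∷ []) (four <-trans i<j j<l l<m) , four (λ p q → <-trans q p) l<m′ j<l′ i<j′ , refl) })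
  (λ c → from (fourPositions π (λ {s} → len {s}) (Equivalence.from contains-reverse c)))
  where
  len : ∀ {s} → Decreasing 4 (reverse s) → length s ≡ 4
  len {s} (_ , eq) = trans (sym (length-reverse s)) eq
  from : (∃ λ i → ∃ λ j → ∃ λ l → ∃ λ m → (i <ᶠ j) × (j <ᶠ l) × (l <ᶠ m) ×
    Decreasing 4 (valueAt π m ∷ valueAt π l ∷ valueAt π j ∷ valueAt π i ∷ [])) → Contains1234 π
  from (i , j , l , m , i<j , j<l , l<m , (l<m′ ∷ _) ∷ (j<l′ ∷ _) ∷ (i<j′ ∷ _) ∷ _ , _) =
    i , j , l , m , i<j , j<l , l<m , i<j′ , j<l′ , l<m′

contains3214⇔ : ∀ {n} (π : Vec (Fin n) n) → Contains3214 π ⇔ Contains Is4123 (reverse (word π))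
contains3214⇔ π = mk⇔
  (λ { (i , j , l , m , i<j , j<l , l<m , l<j′ , j<i′ , i<m′) → Equivalence.to contains-reverse
    (_ , positions⇒⊆ π (i ∷ j ∷ l ∷ m ∷ []) (four <-trans i<j j<l l<m) ,
     _ , _ , refl , (<-trans l<j′ (<-trans j<i′ i<m′) ∷ <-trans j<i′ i<m′ ∷ i<m′ ∷ []) , three <-trans l<j′ j<i′ , refl) })
  (λ c → from (fourPositions π (λ {s} → len {s}) (Equivalence.from contains-reverse c)))
  where
  len : ∀ {s} → Is4123 (reverse s) → length s ≡ 4
  len {s} (_ , _ , eq , _ , _ , len) = trans (sym (length-reverse s)) (trans (cong length eq) (cong suc len))
  from : (∃ λ i → ∃ λ j → ∃ λ l → ∃ λ m → (i <ᶠ j) × (j <ᶠ l) × (l <ᶠ m) ×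
    Is4123 (valueAt π m ∷ valueAt π l ∷ valueAt π j ∷ valueAt π i ∷ [])) → Contains3214 π
  from (i , j , l , m , i<j , j<l , l<m , _ , _ , refl , (_ ∷ _ ∷ i<m′ ∷ []) , ((l<j′ ∷ _) ∷ (j<i′ ∷ _) ∷ _) , _) =
    i , j , l , m , i<j , j<l , l<m , l<j′ , j<i′ , i<m′

¬-⇔ : ∀ {A B : Set} → A ⇔ B → (¬ A) ⇔ (¬ B)
¬-⇔ e = mk⇔ (_∘ Equivalence.from e) (_∘ Equivalence.to e)

longest-[] : ∀ {j} → LongestSuffix (Contains (Decreasing (suc j))) [] 0
longest-[] = longest z≤n (λ { [] .[] refl _ (_ , [] , _ , ()) }) (λ { [] .[] refl () })

E-tree : ∀ n → E n ≡ tree1234 n 0 0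
E-tree n = trans
  (countPerms-permutations n (λ π → ¬? (contains1234? π)) (¬? ∘ decreasing? 4) reverse reverse-involutive
    (λ l → ↭-sym (↭-reverse l)) (λ π _ → ¬-⇔ (contains1234⇔ π)))
  (trans (count-avoiders (decreasing? 4) n)
    (descendants-4321 n 0 [] 0 0 [] (λ { (_ , [] , _ , ()) }) z≤n longest-[] longest-[]))

av321-catalan : ∀ n → length (filter (¬? ∘ decreasing? 3) (permutations n)) ≡ catalan n
av321-catalan n = trans (count-avoiders (decreasing? 3) n)
  (trans (descendants-321 n 0 [] 0 [] (λ { (_ , [] , _ , ()) }) longest-[]) (tree321-catalan n))

-- The root of both trees is the shape with a single box.
av4123-E : ∀ n → length (filter (¬? ∘ 4123?) (permutations n)) ≡ E n
av4123-E zero    = refl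
av4123-E (suc n) = begin
  length (filter (¬? ∘ 4123?) (permutations (suc n)))   ≡⟨ count-avoiders 4123? (suc n) ⟩
  descendants 4123? n 1 [ 0 ]
    ≡⟨ descendants-4123 n 1 [] 0 [] (s≤s z≤n ∷ []) (λ { (_ , s⊆ , q) → ¬4123 s⊆ q }) (λ { (_ , s⊆ , q) → ¬123 s⊆ q }) (λ { [] y w₂ () ; (_ ∷ _) y w₂ () }) ⟩
  tree3214 n []                                         ≡⟨ trees-agree n 1 0 (s≤s z≤n) ⟩
  -- The empty word has state (0 , 0), and its only insertion leads to (1 , 1).
  tree1234 n 1 1                                        ≡⟨ +-identityʳ _ ⟨
  tree1234 (suc n) 0 0                                  ≡⟨ E-tree (suc n) ⟨
  E (suc n)                                             ∎
  where
  open ≡-Reasoning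
  ¬4123 : ∀ {s} → s ⊆ [ 0 ] → ¬ Is4123 s
  ¬4123 (refl ∷ []) (_ , .[] , refl , _ , _ , ())
  ¬4123 (skip _ []) (_ , _ , () , _)
  ¬123 : ∀ {s} → s ⊆ [ 0 ] → ¬ Increasing 3 s
  ¬123 (refl ∷ []) (_ , ())
  ¬123 (skip _ []) (_ , ())

-- First components

count-∷ : ∀ {A : Set} {P : A → Set} (P? : Decidable P) x xs →
  length (filter P? (x ∷ xs)) ≡ (if does (P? x) then 1 else 0) + length (filter P? xs)
count-∷ P? x xs with P? x
... | yes _ = refl
... | no  _ = refl

count-⇔ : ∀ {A : Set} {P Q : A → Set} (P? : Decidable P) (Q? : Decidable Q) xs →
  (∀ {x} → x ∈ xs → P x ⇔ Q x) → length (filter P? xs) ≡ length (filter Q? xs)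
count-⇔ P? Q? []       _   = refl
count-⇔ P? Q? (x ∷ xs) P⇔Q with P? x | Q? x
... | yes _ | yes _  = cong suc (count-⇔ P? Q? xs (P⇔Q ∘ there))
... | no  _ | no  _  = count-⇔ P? Q? xs (P⇔Q ∘ there)
... | yes p | no  ¬q = contradiction (Equivalence.to (P⇔Q (here refl)) p) ¬q
... | no ¬p | yes q  = contradiction (Equivalence.from (P⇔Q (here refl)) q) ¬p

sumℕ-0 : ∀ n {f} → (∀ i → i < n → f i ≡ 0) → sumℕ n f ≡ 0
sumℕ-0 n eq = trans (sumℕ-truncate n 0 _ z≤n λ i _ → eq i) refl

sumℕ-single : ∀ n {f m} → m < n → (∀ i → i < n → i ≢ m → f i ≡ 0) → sumℕ n f ≡ f m
sumℕ-single (suc n) {f} {m} (s≤s m≤n) eq with m≤n⇒m<n∨m≡n m≤n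
... | inj₂ refl = cong (_+ f n) (sumℕ-0 n λ i i<n → eq i (m<n⇒m<1+n i<n) (<⇒≢ i<n))
... | inj₁ m<n  = trans (cong₂ _+_ (sumℕ-single n m<n λ i i<n → eq i (m<n⇒m<1+n i<n)) (eq n (n<1+n n) (≢-sym (<⇒≢ m<n)))) (+-identityʳ _)

count-split : ∀ {A : Set} {Q : A → Set} {R : ℕ → A → Set} (Q? : Decidable Q) (R? : ∀ m → Decidable (R m)) M xs →
  (∀ {x} → x ∈ xs → Q x → ∃ λ m → m < M × R m x × (∀ i → i < M → R i x → i ≡ m)) →
  length (filter Q? xs) ≡ sumℕ M (λ m → length (filter (λ x → Q? x ×-dec R? m x) xs))
count-split Q? R? M []       _     = sym (sumℕ-0 M λ _ _ → refl)
count-split {Q = Q} {R} Q? R? M (x ∷ xs) class = begin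
  length (filter Q? (x ∷ xs))                                          ≡⟨ count-∷ Q? x xs ⟩
  (if does (Q? x) then 1 else 0) + length (filter Q? xs)
    ≡⟨ cong₂ _+_ (indicator (Q? x)) (count-split Q? R? M xs (class ∘ there)) ⟩
  sumℕ M ind + sumℕ M (λ m → length (filter (QR? m) xs))               ≡⟨ sumℕ-+ M ind _ ⟨
  sumℕ M (λ m → ind m + length (filter (QR? m) xs))                    ≡⟨ sumℕ-cong M (λ m _ → count-∷ (QR? m) x xs) ⟨
  sumℕ M (λ m → length (filter (QR? m) (x ∷ xs)))                      ∎
  where
  open ≡-Reasoning
  QR? : ∀ m → Decidable (λ x → Q x × R m x)
  QR? m x = Q? x ×-dec R? m x
  ind : ℕ → ℕ
  ind m = if does (QR? m x) then 1 else 0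
  indicator : Dec (Q x) → (if does (Q? x) then 1 else 0) ≡ sumℕ M ind
  indicator (no ¬q) rewrite dec-false (Q? x) ¬q = sym (sumℕ-0 M λ _ _ → refl)
  indicator (yes q) with class (here refl) q
  ... | m , m<M , r , only = begin
    (if does (Q? x) then 1 else 0)  ≡⟨ cong (λ b → if b then 1 else 0) (dec-true (Q? x) q) ⟩
    1                               ≡⟨ cong (λ b → if b then 1 else 0) (dec-true (QR? m x) (q , r)) ⟨
    ind m                           ≡⟨ sumℕ-single M m<M (λ i i<M i≢m → cong (λ b → if b then 1 else 0) (dec-false (QR? i x) (i≢m ∘ only i i<M ∘ proj₂))) ⟨
    sumℕ M ind                      ∎

length-cartesianProduct : ∀ {A B : Set} (xs : List A) (ys : List B) → length (cartesianProduct xs ys) ≡ length xs * length ys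
length-cartesianProduct []       ys = refl
length-cartesianProduct (x ∷ xs) ys =
  trans (length-++ (map (x ,_) ys)) (cong₂ _+_ (length-map (x ,_) ys) (length-cartesianProduct xs ys))

-- By pigeonhole, m distinct entries below m are exactly 0, ..., m - 1; this is how the bound on
-- `take m l` corresponds to `PrefixInit`.
Indec : List ℕ → Set
Indec l = 1 ≤ length l × (∀ {m} → m < length l → 1 ≤ m → ¬ All (_< m) (take m l))

indec? : Decidable Indec
indec? l = (1 ≤? length l) ×-dec allUpTo? (λ m → (1 ≤? m) →-dec ¬? (All.all? (_<? m) (take m l))) (length l)

-- For a permutation `l`, this expresses that the first m entries form its first component.
Prefix : ℕ → List ℕ → Set
Prefix m l = Indec (take m l) × All (_< m) (take m l)

prefix? : ∀ m → Decidable (Prefix m)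
prefix? m l = indec? (take m l) ×-dec All.all? (_<? m) (take m l)

length-take-≤ : ∀ {m} {l : List ℕ} → m ≤ length l → length (take m l) ≡ m
length-take-≤ {m} {l} m≤ = trans (length-take m l) (m≤n⇒m⊓n≡m m≤)

take-take-≤ : ∀ {i m} (l : List ℕ) → i ≤ m → take i (take m l) ≡ take i l
take-take-≤ {i} {m} l i≤m = trans (take-take i m l) (cong (λ j → take j l) (m≤n⇒m⊓n≡m i≤m))

least : ∀ {P : ℕ → Set} → Decidable P → ∀ n → P n → ∃ λ m → m ≤ n × P m × (∀ {i} → i < m → ¬ P i)
least {P} P? = <-rec _ λ n rec p → search n rec p (anyUpTo? P? n)
  where
  search : ∀ n → (∀ {i} → i < n → P i → ∃ λ m → m ≤ i × P m × (∀ {i} → i < m → ¬ P i)) → P n →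
    Dec (∃ λ i → i < n × P i) → ∃ λ m → m ≤ n × P m × (∀ {i} → i < m → ¬ P i)
  search n rec p (no ¬any) = n , ≤-refl , p , λ i<n pi → ¬any (_ , i<n , pi)
  search n rec p (yes (i , i<n , pi)) with rec i<n pi
  ... | m , m≤i , pm , minimal = m , ≤-trans m≤i (<⇒≤ i<n) , pm , minimal

-- The shortest prefix that is closed downwards is indecomposable because it is shortest, and a
-- longer indecomposable prefix would have to contain it properly.
firstComponent : ∀ {n l} → PermutationOf n l → 1 ≤ n →
  ∃ λ m → m < n × Prefix (suc m) l × (∀ i → i < n → Prefix (suc i) l → i ≡ m)
firstComponent {suc n} {l} (uniq , bound , len) _
  with least (λ m → All.all? (_<? suc m) (take (suc m) l)) n (subst (All (_< suc n)) (sym (take-all (suc n) l (≤-reflexive len))) bound)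
... | m , m≤n , below , minimal = m , s≤s m≤n , (indec , below) , only
  where
  m<len : suc m ≤ length l
  m<len = subst (suc m ≤_) (sym len) (s≤s m≤n)
  indec : Indec (take (suc m) l)
  indec = subst (1 ≤_) (sym (length-take-≤ {l = l} m<len)) (s≤s z≤n) ,
    λ { {suc i} i< _ all → let i<m = subst (suc i <_) (length-take-≤ {l = l} m<len) i< in
        minimal (s≤s⁻¹ i<m) (subst (All (_< suc i)) (take-take-≤ l (<⇒≤ i<m)) all) }
  only : ∀ i → i < suc n → Prefix (suc i) l → i ≡ m
  only i i<1+n ((_ , ind) , below′) with <-cmp i m
  ... | tri< i<m _ _ = contradiction below′ (minimal i<m)
  ... | tri≈ _ i≡m _ = i≡m
  ... | tri> _ _ m<i = contradiction (subst (All (_< suc m)) (sym (take-take-≤ l (s≤s (<⇒≤ m<i)))) below)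
    (ind (subst (suc m <_) (sym (length-take-≤ {l = l} (subst (suc i ≤_) (sym len) i<1+n))) (s≤s m<i)) (s≤s z≤n))

infixr 5 _⊕_

_⊕_ : List ℕ → List ℕ → List ℕ
σ ⊕ τ = σ ++ map (length σ +_) τ

take-⊕ : ∀ σ (τ : List ℕ) → take (length σ) (σ ++ τ) ≡ σ
take-⊕ []      τ = refl
take-⊕ (x ∷ σ) τ = cong (x ∷_) (take-⊕ σ τ)

⊕-permutationOf : ∀ {m n σ τ} → PermutationOf m σ → PermutationOf n τ → PermutationOf (m + n) (σ ⊕ τ)
⊕-permutationOf {m} {n} {σ} {τ} (uσ , bσ , refl) (uτ , bτ , lτ) =
  Uniqueₚ.++⁺ uσ (Uniqueₚ.map⁺ (+-cancelˡ-≡ m _ _) uτ)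
    (λ { (v∈σ , v∈τ) → let y , _ , eq = ∈-map⁻ (m +_) v∈τ in
         <⇒≱ (All.lookup bσ v∈σ) (subst (m ≤_) (sym eq) (m≤m+n m y)) }) ,
  Allₚ.++⁺ (All.map (λ x<m → ≤-trans x<m (m≤m+n m n)) bσ) (Allₚ.map⁺ (All.map (+-monoʳ-< m) bτ)) ,
  trans (length-++ σ) (cong (m +_) (trans (length-map (m +_) τ) lτ))

⊕-injective : ∀ {σ σ′ τ τ′} → length σ ≡ length σ′ → σ ⊕ τ ≡ σ′ ⊕ τ′ → σ ≡ σ′ × τ ≡ τ′
⊕-injective {σ} {σ′} {τ} {τ′} len eq with
  trans (sym (take-⊕ σ _)) (trans (cong (take (length σ)) eq) (trans (cong (λ j → take j (σ′ ⊕ τ′)) len) (take-⊕ σ′ _)))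
... | refl = refl , map-injective (+-cancelˡ-≡ (length σ) _ _) (++-cancelˡ σ _ _ eq)

⊕-prefix : ∀ {m σ} τ → PermutationOf m σ → Indec σ → Prefix m (σ ⊕ τ)
⊕-prefix {σ = σ} τ (_ , bound , refl) ind = subst (λ u → Indec u × All (_< length σ) u) (sym (take-⊕ σ _)) (ind , bound)

⊕-decompose : ∀ {n m l} → PermutationOf n l → m ≤ n → All (_< m) (take m l) →
  ∃ λ τ → PermutationOf m (take m l) × PermutationOf (n ∸ m) τ × take m l ⊕ τ ≡ l
⊕-decompose {n} {m} {l} (uniq , bound , len) m≤n below = τ ,
  (uσ , below , lσ) , (uτ , All.tabulate bτ , lτ) ,
  trans (cong (λ j → take m l ++ map (j +_) τ) lσ) (trans (cong (take m l ++_) shifted) (take++drop≡id m l))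
  where
  τ : List ℕ
  τ = map (_∸ m) (drop m l)
  uσ : Unique (take m l)
  uσ = Uniqueₚ.take⁺ m uniq
  lσ : length (take m l) ≡ m
  lσ = length-take-≤ {l = l} (subst (m ≤_) (sym len) m≤n)
  above : ∀ {v} → v ∈ drop m l → m ≤ v
  -- The first m entries exhaust the values below m, so a smaller entry among the later ones would
  -- be a repetition.
  above {v} v∈ = ≮⇒≥ λ v<m → disjoint (take m l) (subst Unique (sym (take++drop≡id m l)) uniq)
      (covers uσ below (≤-reflexive (sym lσ)) v<m) v∈
    where
    disjoint : ∀ {ys} xs → Unique (xs ++ ys) → v ∈ xs → v ∉ ys
    disjoint (x ∷ xs) (x∉ ∷ _)  (here refl) v∈ys = All.lookup (Allₚ.++⁻ʳ xs x∉) v∈ys refl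
    disjoint (x ∷ xs) (_ ∷ uxs) (there v∈)  v∈ys = disjoint xs uxs v∈ v∈ys
  shifted : map (m +_) τ ≡ drop m l
  shifted = trans (sym (map-∘ (drop m l))) (map-id-local (All.tabulate λ v∈ → m+[n∸m]≡n (above v∈)))
  uτ : Unique τ
  uτ = Uniqueₚ.map⁻ (subst Unique (sym shifted) (Uniqueₚ.drop⁺ m uniq))
  bτ : ∀ {v} → v ∈ τ → v < n ∸ m
  bτ v∈ = let v′ , v′∈ , eq = ∈-map⁻ (_∸ m) v∈ in
    subst (_< n ∸ m) (sym eq) (∸-monoˡ-< (All.lookup (Allₚ.drop⁺ m bound) v′∈) (above v′∈))
  lτ : length τ ≡ n ∸ m
  lτ = trans (length-map (_∸ m) (drop m l)) (trans (length-drop m l) (cong (_∸ m) len))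

-- The bijection between pairs (σ , τ) and σ ⊕ τ. The conditions `S` and `T` on the two parts may
-- differ, as 3214 requires: 321 for σ, 3214 for τ.
count-prefix : ∀ {Q S T : List ℕ → Set} (Q? : Decidable Q) (S? : Decidable S) (T? : Decidable T) {n m} → m ≤ n →
  (∀ {σ τ} → PermutationOf m σ → PermutationOf (n ∸ m) τ → Q (σ ⊕ τ) ⇔ (S σ × T τ)) →
  length (filter (λ l → Q? l ×-dec prefix? m l) (permutations n))
    ≡ length (filter (λ σ → S? σ ×-dec indec? σ) (permutations m)) * length (filter T? (permutations (n ∸ m)))
count-prefix {Q} Q? S? T? {n} {m} m≤n Q⇔ = trans
  (sym (length-bijection (λ (σ , τ) → σ ⊕ τ)
    (Uniqueₚ.cartesianProduct⁺ (Uniqueₚ.filter⁺ SI? (unique-permutations m)) (Uniqueₚ.filter⁺ T? (unique-permutations (n ∸ m))))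
    (Uniqueₚ.filter⁺ QP? (unique-permutations n))
    (λ x∈ y∈ eq → let (pσ , _) , _ = split x∈ ; (pσ′ , _) , _ = split y∈
                      eqσ , eqτ = ⊕-injective (trans (proj₂ (proj₂ pσ)) (sym (proj₂ (proj₂ pσ′)))) eq
                  in cong₂ _,_ eqσ eqτ)
    (λ {(σ , τ)} x∈ → let (pσ , s , ind) , pτ , t = split x∈ in
      ∈-filter⁺ QP? (∈-permutations⁺ (subst (λ k → PermutationOf k (σ ⊕ τ)) (m+[n∸m]≡n m≤n) (⊕-permutationOf pσ pτ)))
        (Equivalence.from (Q⇔ pσ pτ) (s , t) , ⊕-prefix τ pσ ind))
    (λ {l} l∈ → let l∈′ , q , ind , below = ∈-filter⁻ QP? {xs = permutations n} l∈
                    τ , pσ , pτ , eq = ⊕-decompose (∈-permutations⁻ l∈′) m≤n below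
                    s , t = Equivalence.to (Q⇔ pσ pτ) (subst Q (sym eq) q) in
      (take m l , τ) , ∈-cartesianProduct⁺ (∈-filter⁺ SI? (∈-permutations⁺ pσ) (s , ind)) (∈-filter⁺ T? (∈-permutations⁺ pτ) t) , eq)))
  (length-cartesianProduct (filter SI? (permutations m)) (filter T? (permutations (n ∸ m))))
  where
  SI? = λ σ → S? σ ×-dec indec? σ
  QP? = λ l → Q? l ×-dec prefix? m l
  split : ∀ {σ τ} → (σ , τ) ∈ cartesianProduct (filter SI? (permutations m)) (filter T? (permutations (n ∸ m))) →
    (PermutationOf m σ × _ × Indec σ) × PermutationOf (n ∸ m) τ × _
  split x∈ =
    let σ∈ , τ∈ = ∈-cartesianProduct⁻ (filter SI? (permutations m)) _ x∈
        σ∈′ , s , ind = ∈-filter⁻ SI? {xs = permutations m} σ∈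
        τ∈′ , t = ∈-filter⁻ T? {xs = permutations (n ∸ m)} τ∈
    in (∈-permutations⁻ σ∈′ , s , ind) , ∈-permutations⁻ τ∈′ , t

-- Patterns and descents of direct sums

⊆-++⁻ : ∀ {s : List ℕ} a {b} → s ⊆ a ++ b → ∃₂ λ s₁ s₂ → s ≡ s₁ ++ s₂ × s₁ ⊆ a × s₂ ⊆ b
⊆-++⁻ []      s⊆ = [] , _ , refl , [] , s⊆
⊆-++⁻ (x ∷ a) (skip .x s⊆) with ⊆-++⁻ a s⊆
... | s₁ , s₂ , eq , s₁⊆ , s₂⊆ = s₁ , s₂ , eq , skip x s₁⊆ , s₂⊆
⊆-++⁻ (x ∷ a) (refl ∷ s⊆) with ⊆-++⁻ a s⊆
... | s₁ , s₂ , refl , s₁⊆ , s₂⊆ = x ∷ s₁ , s₂ , refl , refl ∷ s₁⊆ , s₂⊆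

⊆-map⁻ : ∀ (f : ℕ → ℕ) {s} l → s ⊆ map f l → ∃ λ s′ → s ≡ map f s′ × s′ ⊆ l
⊆-map⁻ f []      []          = [] , refl , []
⊆-map⁻ f (x ∷ l) (skip _ s⊆) with ⊆-map⁻ f l s⊆
... | s′ , eq , s′⊆ = s′ , eq , skip x s′⊆
⊆-map⁻ f (x ∷ l) (refl ∷ s⊆) with ⊆-map⁻ f l s⊆
... | s′ , refl , s′⊆ = x ∷ s′ , refl , refl ∷ s′⊆

contains-map : ∀ {Q} f → (∀ s → Q s ⇔ Q (map f s)) → ∀ {l} → Contains Q l ⇔ Contains Q (map f l)
contains-map {Q} f inv {l} = mk⇔
  (λ { (s , s⊆ , q) → map f s , ⊆-map⁺ f s⊆ , Equivalence.to (inv s) q })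
  (λ { (s , s⊆ , q) → let s′ , eq , s′⊆ = ⊆-map⁻ f l s⊆ in s′ , s′⊆ , Equivalence.from (inv s′) (subst Q eq q) })

decreasing-shift : ∀ m {j} s → Decreasing j s ⇔ Decreasing j (map (m +_) s)
decreasing-shift m s = mk⇔
  (λ { (dec , len) → AllPairsₚ.map⁺ (AllPairs.map (+-monoʳ-< m) dec) , trans (length-map (m +_) s) len })
  (λ { (dec , len) → AllPairs.map (+-cancelˡ-< m _ _) (AllPairsₚ.map⁻ dec) , trans (sym (length-map (m +_) s)) len })

increasing-shift : ∀ m {j} s → Increasing j s ⇔ Increasing j (map (m +_) s)
increasing-shift m s = mk⇔
  (λ { (inc , len) → AllPairsₚ.map⁺ (AllPairs.map (+-monoʳ-< m) inc) , trans (length-map (m +_) s) len })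
  (λ { (inc , len) → AllPairs.map (+-cancelˡ-< m _ _) (AllPairsₚ.map⁻ inc) , trans (sym (length-map (m +_) s)) len })

4123-shift : ∀ m s → Is4123 s ⇔ Is4123 (map (m +_) s)
4123-shift m s = mk⇔
  (λ { (d , t , refl , t<d , inc) → m + d , map (m +_) t , refl ,
       Allₚ.map⁺ (All.map (+-monoʳ-< m) t<d) , Equivalence.to (increasing-shift m t) inc })
  (from s)
  where
  from : ∀ s → Is4123 (map (m +_) s) → Is4123 s
  from (d ∷ t) (_ , _ , refl , t<d , inc) =
    d , t , refl , All.map (+-cancelˡ-< m _ _) (Allₚ.map⁻ t<d) , Equivalence.from (increasing-shift m t) inc

decreasing-++⁻ : ∀ {j m} a b → All (_< m) a → All (m ≤_) b →
  Contains (Decreasing j) (a ++ b) → Contains (Decreasing j) a ⊎ Contains (Decreasing j) b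
decreasing-++⁻ {j} a b a<m m≤b (s , s⊆ , dec) with ⊆-++⁻ a s⊆
... | []     , s₂      , refl , _   , s₂⊆ = inj₂ (s₂ , s₂⊆ , dec)
... | x ∷ s₁ , []      , refl , s₁⊆ , _   = inj₁ (x ∷ s₁ , s₁⊆ , subst (Decreasing j) (++-identityʳ (x ∷ s₁)) dec)
decreasing-++⁻ a b a<m m≤b (_ , _ , x> ∷ _ , _) | x ∷ s₁ , y ∷ s₂ , refl , s₁⊆ , s₂⊆ =
  contradiction (All.head (Allₚ.++⁻ʳ s₁ x>))
    (<-asym (<-≤-trans (All.head (All-resp-⊆ s₁⊆ a<m)) (All.head (All-resp-⊆ s₂⊆ m≤b))))

-- Words are reversed, so the large part `b` comes first. Once the 1 of a 4123 lies in `b`, no later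
-- letter in `a` can exceed it; hence the 123 lies in `a` or the whole 4123 lies in `b`.
4123-++⁻ : ∀ {m} b a → All (_< m) a → All (m ≤_) b →
  Contains Is4123 (b ++ a) → Contains (Increasing 3) a ⊎ Contains Is4123 b
4123-++⁻ b a a<m m≤b (s , s⊆ , q) with ⊆-++⁻ b s⊆
4123-++⁻ b a a<m m≤b (_ , _ , d , t , refl , t<d , inc) | [] , _ , refl , _ , s₂⊆ =
  inj₁ (t , ⊆-trans (skip d ⊆-refl) s₂⊆ , inc)
4123-++⁻ b a a<m m≤b (_ , _ , d , _ , refl , t<d , inc) | _ ∷ [] , s₂ , refl , _ , s₂⊆ =
  inj₁ (s₂ , s₂⊆ , inc)
4123-++⁻ b a a<m m≤b (_ , _ , q) | d ∷ x ∷ t , [] , refl , s₁⊆ , _ =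
  inj₂ (d ∷ x ∷ t , s₁⊆ , subst Is4123 (++-identityʳ (d ∷ x ∷ t)) q)
4123-++⁻ b a a<m m≤b (_ , _ , d , _ , refl , _ , x< ∷ _ , _) | _ ∷ x ∷ t , y ∷ s₂ , refl , s₁⊆ , s₂⊆ =
  contradiction (All.head (Allₚ.++⁻ʳ t x<))
    (<-asym (<-≤-trans (All.head (All-resp-⊆ s₂⊆ a<m)) (All.head (All.tail (All-resp-⊆ s₁⊆ m≤b)))))

increasing-reverse : ∀ {l} → Contains (Increasing 3) (reverse l) ⇔ Contains (Decreasing 3) l
increasing-reverse {l} = mk⇔
  (λ c → let s , s⊆ , inc , len = Equivalence.from (contains-reverse {Increasing 3}) c in s , s⊆ , to s (trans (sym (length-reverse s)) len) inc)
  (λ { (s , s⊆ , dec , len) → Equivalence.to (contains-reverse {Increasing 3}) (s , s⊆ , from s len dec) })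
  where
  to : ∀ s → length s ≡ 3 → AllPairs _<_ (reverse s) → Decreasing 3 s
  to (a ∷ b ∷ c ∷ []) _ ((c<b ∷ c<a ∷ []) ∷ (b<a ∷ []) ∷ _) = (b<a ∷ c<a ∷ []) ∷ (c<b ∷ []) ∷ [] ∷ [] , refl
  from : ∀ s → length s ≡ 3 → AllPairs _>_ s → Increasing 3 (reverse s)
  from (a ∷ b ∷ c ∷ []) _ ((b<a ∷ c<a ∷ []) ∷ (c<b ∷ []) ∷ _) = (c<b ∷ c<a ∷ []) ∷ (b<a ∷ []) ∷ [] ∷ [] , refl

module _ {m σ} (τ : List ℕ) (pσ : PermutationOf m σ) where

  private
    σ<m : All (_< length σ) σ
    σ<m = subst (λ k → All (_< k) σ) (sym (proj₂ (proj₂ pσ))) (proj₁ (proj₂ pσ))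
    m≤τ : All (length σ ≤_) (map (length σ +_) τ)
    m≤τ = Allₚ.map⁺ (All.universal (m≤m+n (length σ)) τ)

  321-⊕ : Contains (Decreasing 3) (σ ⊕ τ) ⇔ (Contains (Decreasing 3) σ ⊎ Contains (Decreasing 3) τ)
  321-⊕ = mk⇔
    (λ c → [ inj₁ , inj₂ ∘ Equivalence.from shift321 ]′ (decreasing-++⁻ σ _ σ<m m≤τ c))
    [ Contains-mono (++⁺ʳ _ ⊆-refl) , Contains-mono (++⁺ˡ σ ⊆-refl) ∘ Equivalence.to shift321 ]′
    where
    shift321 : Contains (Decreasing 3) τ ⇔ Contains (Decreasing 3) (map (length σ +_) τ)
    shift321 = contains-map (length σ +_) (decreasing-shift (length σ))

  3214-⊕ : 1 ≤ length τ → Contains Is4123 (reverse (σ ⊕ τ)) ⇔ (Contains (Decreasing 3) σ ⊎ Contains Is4123 (reverse τ))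
  3214-⊕ 1≤τ = mk⇔
    (λ c → [ inj₁ ∘ Equivalence.to increasing-reverse , inj₂ ∘ unshifted ]′
      (4123-++⁻ (reverse τ′) (reverse σ) (All-reverse σ<m) (All-reverse m≤τ) (subst (Contains Is4123) (reverse-++ σ τ′) c)))
    [ (λ c → subst (Contains Is4123) (sym (reverse-++ σ τ′)) (extend 1≤τ (Equivalence.from increasing-reverse c)))
    , (λ c → subst (Contains Is4123) (sym (reverse-++ σ τ′)) (Contains-mono (++⁺ʳ (reverse σ) ⊆-refl) (shifted c))) ]′
    where
    τ′ : List ℕ
    τ′ = map (length σ +_) τ
    All-reverse : ∀ {P : ℕ → Set} {l} → All P l → All P (reverse l)
    All-reverse ps = All-resp-↭ (↭-sym (↭-reverse _)) ps
    unshifted : Contains Is4123 (reverse τ′) → Contains Is4123 (reverse τ)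
    unshifted c = Equivalence.from (contains-map (length σ +_) (4123-shift (length σ)))
      (subst (Contains Is4123) (sym (reverse-map (length σ +_) τ)) c)
    shifted : Contains Is4123 (reverse τ) → Contains Is4123 (reverse τ′)
    shifted c = subst (Contains Is4123) (reverse-map (length σ +_) τ)
      (Equivalence.to (contains-map (length σ +_) (4123-shift (length σ))) c)
    extend : 1 ≤ length τ → Contains (Increasing 3) (reverse σ) → Contains Is4123 (reverse τ′ ++ reverse σ)
    extend 1≤τ (s , s⊆ , inc) with reverse τ′ in eq
    ... | []    = contradiction (trans (sym (trans (length-reverse τ′) (length-map (length σ +_) τ))) (cong length eq)) (≢-sym (<⇒≢ 1≤τ))
    -- The last entry of the shifted `τ`, which comes first after reversal, serves as the 4.
    ... | d ∷ t = d ∷ s , refl ∷ ++⁺ˡ t s⊆ , d , s , refl ,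
      All.map (λ x<m → <-≤-trans x<m (All.head (subst (All (length σ ≤_)) eq (All-reverse m≤τ)))) (All-resp-⊆ s⊆ (All-reverse σ<m)) , inc

  desList-⊕ : desList (σ ⊕ τ) ≡ desList σ + desList τ
  desList-⊕ = append σ σ<m
    where
    M : ℕ
    M = length σ
    <ᵇ-≥ : ∀ {x y} → y ≤ x → (x <ᵇ y) ≡ false
    <ᵇ-≥ {x} {y} y≤x = dec-false (x <? y) (≤⇒≯ y≤x)
    <ᵇ-shift : ∀ k x y → ((k + x) <ᵇ (k + y)) ≡ (x <ᵇ y)
    <ᵇ-shift zero    x y = refl
    <ᵇ-shift (suc k) x y = <ᵇ-shift k x y
    desList-shift : ∀ τ → desList (map (M +_) τ) ≡ desList τ
    desList-shift []          = refl
    desList-shift (x ∷ [])    = refl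
    desList-shift (x ∷ y ∷ τ) = cong₂ (λ b k → (if b then 1 else 0) + k) (<ᵇ-shift M y x) (desList-shift (y ∷ τ))
    append : ∀ ρ → All (_< M) ρ → desList (ρ ++ map (M +_) τ) ≡ desList ρ + desList τ
    append []          _           = desList-shift τ
    append (x ∷ [])    (x<M ∷ [])  = last τ
      where
      last : ∀ τ′ → desList (x ∷ map (M +_) τ′) ≡ desList τ′
      last []       = refl
      -- No descent at the junction: the step goes from below `M` to at least `M`.
      last (y ∷ τ′) = trans (cong (λ b → (if b then 1 else 0) + desList (map (M +_) (y ∷ τ′))) (<ᵇ-≥ (≤-trans (<⇒≤ x<M) (m≤m+n M y)))) (desList-shift (y ∷ τ′))
    append (x ∷ y ∷ ρ) (_ ∷ y∷ρ<M) =
      trans (cong ((if y <ᵇ x then 1 else 0) +_) (append (y ∷ ρ) y∷ρ<M)) (sym (+-assoc (if y <ᵇ x then 1 else 0) _ _))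

-- The counts of the theorem as counts of words

∈-take-word⁺ : ∀ {m k} (v : Vec (Fin m) k) p {i} → toℕ p < i → valueAt v p ∈ take i (word v)
∈-take-word⁺ (x ∷ v) fzero    {suc i} _         = here refl
∈-take-word⁺ (x ∷ v) (fsuc p) {suc i} (s≤s p<i) = there (∈-take-word⁺ v p p<i)

∈-take-word⁻ : ∀ {m k} (v : Vec (Fin m) k) {y} i → y ∈ take i (word v) → ∃ λ p → toℕ p < i × valueAt v p ≡ y
∈-take-word⁻ []      zero    ()
∈-take-word⁻ []      (suc i) ()
∈-take-word⁻ (x ∷ v) (suc i) (here refl) = fzero , s≤s z≤n , refl
∈-take-word⁻ (x ∷ v) (suc i) (there y∈) with ∈-take-word⁻ v i y∈
... | p , p<i , eq = fsuc p , s≤s p<i , eq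

prefixInit⇔ : ∀ {n} (π : Vec (Fin n) n) → IsPerm π → ∀ {i} → i ≤ n → PrefixInit π i ⇔ All (_< i) (take i (word π))
prefixInit⇔ {n} π perm {i} i≤n = mk⇔
  (λ { (below , _) → All.tabulate λ y∈ → let p , p<i , eq = ∈-take-word⁻ π i y∈ in subst (_< i) eq (below p p<i) })
  (λ below → (λ p p<i → All.lookup below (∈-take-word⁺ π p p<i)) ,
    λ v v<i → let p , p<i , eq = ∈-take-word⁻ π i (covers (Uniqueₚ.take⁺ i uniq) below i≤take v<i) in
              p , p<i , toℕ-injective eq)
  where
  uniq : Unique (word π)
  uniq = lookup-injective⇒unique π perm
  i≤take : i ≤ length (take i (word π))
  i≤take = ≤-reflexive (sym (length-take-≤ {l = word π} (subst (i ≤_) (sym (length-word π)) i≤n)))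

indecomposable⇔ : ∀ {n} (π : Vec (Fin n) n) → IsPerm π → Indecomposable π ⇔ Indec (word π)
indecomposable⇔ {n} π perm = mk⇔
  (λ { (1≤n , none) → subst (1 ≤_) (sym (length-word π)) 1≤n , λ {m} m<len 1≤m below →
    let m<n = subst (m <_) (length-word π) m<len
        eq  = sym (toℕ-fromℕ< m<n)
    in none (fromℕ< m<n) (subst (1 ≤_) eq 1≤m)
         (subst (PrefixInit π) eq (Equivalence.from (prefixInit⇔ π perm (<⇒≤ m<n)) below)) })
  (λ { (1≤len , none) → subst (1 ≤_) (length-word π) 1≤len , λ i 1≤i init →
    none (subst (toℕ i <_) (sym (length-word π)) (toℕ<n i)) 1≤i (Equivalence.to (prefixInit⇔ π perm (<⇒≤ (toℕ<n i))) init) })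

count : ∀ {P : List ℕ → Set} → Decidable P → ℕ → ℕ
count P? n = length (filter P? (permutations n))

avoids321? : Decidable (λ l → ¬ Contains (Decreasing 3) l)
avoids321? = ¬? ∘ decreasing? 3

avoids3214? : Decidable (λ l → ¬ Contains Is4123 (reverse l))
avoids3214? l = ¬? (4123? (reverse l))

countPerms-count : ∀ n {P : Vec (Fin n) n → Set} (P? : ∀ π → Dec (P π)) {Q : List ℕ → Set} (Q? : Decidable Q) →
  (∀ π → IsPerm π → P π ⇔ Q (word π)) → countPerms n P? ≡ count Q? n
countPerms-count n P? Q? = countPerms-permutations n P? Q? id (λ _ → refl) (λ _ → ↭-refl)

avoids3214⇔ : ∀ {n} (π : Vec (Fin n) n) → (¬ Contains3214 π) ⇔ (¬ Contains Is4123 (reverse (word π)))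
avoids3214⇔ π = ¬-⇔ (contains3214⇔ π)

A3214-count : ∀ n k → A3214 n k ≡ count (λ l → avoids3214? l ×-dec (desList l ≟ k)) n
A3214-count n k = countPerms-count n (λ π → ¬? (contains3214? π) ×-dec (des π ≟ k)) _
  λ π perm → avoids3214⇔ π ×-⇔ ⇔-refl

I3214-count : ∀ n k → I3214 n k ≡ count (λ l → (avoids3214? l ×-dec (desList l ≟ k)) ×-dec indec? l) n
I3214-count n k = countPerms-count n (λ π → ¬? (contains3214? π) ×-dec indecomposable? π ×-dec (des π ≟ k)) _
  λ π perm → ⇔-trans (avoids3214⇔ π ×-⇔ (indecomposable⇔ π perm ×-⇔ ⇔-refl))
    (mk⇔ (λ (a , i , d) → (a , d) , i) (λ ((a , d) , i) → a , i , d))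

I321-count : ∀ n k → I321 n k ≡ count (λ l → (avoids321? l ×-dec (desList l ≟ k)) ×-dec indec? l) n
I321-count n k = countPerms-count n (λ π → ¬? (contains321? π) ×-dec indecomposable? π ×-dec (des π ≟ k)) _
  λ π perm → ⇔-trans (¬-⇔ (contains321⇔ π) ×-⇔ (indecomposable⇔ π perm ×-⇔ ⇔-refl))
    (mk⇔ (λ (a , i , d) → (a , d) , i) (λ ((a , d) , i) → a , i , d))

I3214ₙ-count : ∀ n → I3214ₙ n ≡ count (λ l → avoids3214? l ×-dec indec? l) n
I3214ₙ-count n = countPerms-count n (λ π → ¬? (contains3214? π) ×-dec indecomposable? π) _
  λ π perm → avoids3214⇔ π ×-⇔ indecomposable⇔ π perm

avoids3214-E : ∀ n → count avoids3214? n ≡ E n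
avoids3214-E n = trans
  (sym (countPerms-count n (λ π → ¬? (contains3214? π)) avoids3214? λ π _ → avoids3214⇔ π))
  (trans (countPerms-permutations n (λ π → ¬? (contains3214? π)) (¬? ∘ 4123?) reverse reverse-involutive
    (λ l → ↭-sym (↭-reverse l)) (λ π _ → avoids3214⇔ π)) (av4123-E n))

-- Decompositions by the first component

count-firstComponent : ∀ {Q : List ℕ → Set} (Q? : Decidable Q) n →
  count Q? (suc n) ≡ sumℕ n (λ m → length (filter (λ l → Q? l ×-dec prefix? (suc m) l) (permutations (suc n))))
                     + count (λ l → Q? l ×-dec indec? l) (suc n)
count-firstComponent Q? n = trans
  (count-split Q? (prefix? ∘ suc) (suc n) (permutations (suc n)) λ l∈ _ → firstComponent (∈-permutations⁻ l∈) (s≤s z≤n))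
  (cong (sumℕ n (λ m → length (filter (λ l → Q? l ×-dec prefix? (suc m) l) (permutations (suc n)))) +_) (count-⇔ (λ l → Q? l ×-dec prefix? (suc n) l) (λ l → Q? l ×-dec indec? l) (permutations (suc n))
    λ {l} l∈ → ⇔-refl ×-⇔ whole (∈-permutations⁻ l∈)))
  where
  whole : ∀ {l} → PermutationOf (suc n) l → Prefix (suc n) l ⇔ Indec l
  whole {l} (_ , bound , len) with take (suc n) l | take-all (suc n) l (≤-reflexive len)
  ... | .l | refl = mk⇔ proj₁ (_, bound)

¬-⊎ : ∀ {A B C : Set} → A ⇔ (B ⊎ C) → (¬ A) ⇔ (¬ B × ¬ C)
¬-⊎ e = mk⇔ (λ ¬a → ¬a ∘ Equivalence.from e ∘ inj₁ , ¬a ∘ Equivalence.from e ∘ inj₂)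
             (λ (¬b , ¬c) → [ ¬b , ¬c ]′ ∘ Equivalence.to e)

nonempty : ∀ {n m τ} → m < n → PermutationOf (n ∸ m) τ → 1 ≤ length τ
nonempty m<n (_ , _ , len) = subst (1 ≤_) (sym len) (m<n⇒0<n∸m m<n)

-- Components are nonempty; index m stands for length m + 1, so that the value is the m-th Catalan
-- number.
indec321 : ℕ → ℕ
indec321 m = count (λ l → avoids321? l ×-dec indec? l) (suc m)

catalan-decomposition : ∀ n → catalan (suc n) ≡ sumℕ n (λ m → indec321 m * catalan (n ∸ m)) + indec321 n
catalan-decomposition n = begin
  catalan (suc n)                                                ≡⟨ av321-catalan (suc n) ⟨
  count avoids321? (suc n)                                       ≡⟨ count-firstComponent avoids321? n ⟩
  sumℕ n (λ m → length (filter (λ l → avoids321? l ×-dec prefix? (suc m) l) (permutations (suc n)))) + indec321 n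
    ≡⟨ cong (_+ indec321 n) (sumℕ-cong n λ m m<n → trans
         (count-prefix avoids321? avoids321? avoids321? (s≤s (<⇒≤ m<n)) λ {_} {τ} pσ _ → ¬-⊎ (321-⊕ τ pσ))
         (cong (indec321 m *_) (av321-catalan (n ∸ m)))) ⟩
  sumℕ n (λ m → indec321 m * catalan (n ∸ m)) + indec321 n       ∎
  where open ≡-Reasoning

catalan-convolution : ∀ n → catalan (suc n) ≡ sumℕ (suc n) (λ i → catalan i * catalan (n ∸ i))
catalan-convolution n = begin
  catalan (suc n)                                              ≡⟨ tree321-catalan (suc n) ⟨
  tree321 n 1                                                  ≡⟨ tree321-convolution n 0 ⟩
  sumℕ (suc n) (λ i → tree321 i 0 * tree321 (n ∸ i) 0)
    ≡⟨ sumℕ-cong (suc n) (λ i _ → cong₂ _*_ (tree321-catalan i) (tree321-catalan (n ∸ i))) ⟩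
  sumℕ (suc n) (λ i → catalan i * catalan (n ∸ i))             ∎
  where open ≡-Reasoning

-- The decomposition by first components and the Catalan convolution both compute `catalan (suc n)`.
-- By induction their terms below n agree, so the last terms agree too.
indec321-catalan : ∀ n → indec321 n ≡ catalan n
indec321-catalan = <-rec _ λ n rec → +-cancelˡ-≡ (sumℕ n (λ m → catalan m * catalan (n ∸ m))) _ _ (begin
  sumℕ n (λ m → catalan m * catalan (n ∸ m)) + indec321 n
    ≡⟨ cong (_+ indec321 n) (sumℕ-cong n λ m m<n → cong (_* catalan (n ∸ m)) (rec m<n)) ⟨
  sumℕ n (λ m → indec321 m * catalan (n ∸ m)) + indec321 n     ≡⟨ catalan-decomposition n ⟨
  catalan (suc n)                                              ≡⟨ catalan-convolution n ⟩
  sumℕ n (λ m → catalan m * catalan (n ∸ m)) + catalan n * catalan (n ∸ n)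
    ≡⟨ cong (sumℕ n (λ m → catalan m * catalan (n ∸ m)) +_) (trans (cong (λ j → catalan n * catalan j) (n∸n≡0 n)) (*-identityʳ _)) ⟩
  sumℕ n (λ m → catalan m * catalan (n ∸ m)) + catalan n       ∎)
  where open ≡-Reasoning

E-decomposition : ∀ n → E (suc n) ≡ sumℕ n (λ m → catalan m * E (n ∸ m)) + I3214ₙ (suc n)
E-decomposition n = begin
  E (suc n)                                                      ≡⟨ avoids3214-E (suc n) ⟨
  count avoids3214? (suc n)                                      ≡⟨ count-firstComponent avoids3214? n ⟩
  sumℕ n (λ m → length (filter (λ l → avoids3214? l ×-dec prefix? (suc m) l) (permutations (suc n))))
    + count (λ l → avoids3214? l ×-dec indec? l) (suc n)
    ≡⟨ cong₂ _+_ (sumℕ-cong n λ m m<n → trans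
         (count-prefix avoids3214? avoids321? avoids3214? (s≤s (<⇒≤ m<n))
           λ {_} {τ} pσ pτ → ¬-⊎ (3214-⊕ τ pσ (nonempty (s≤s m<n) pτ)))
         (cong₂ _*_ (indec321-catalan m) (avoids3214-E (n ∸ m))))
       (sym (I3214ₙ-count (suc n))) ⟩
  sumℕ n (λ m → catalan m * E (n ∸ m)) + I3214ₙ (suc n)          ∎
  where open ≡-Reasoning

-- The bound m < n keeps τ nonempty, which corresponds to the factor A - 1. The inner sum sorts by
-- the descents of the first component.
A3214-decomposition : ∀ n k → A3214 (suc n) k ≡ I3214 (suc n) k
  + sumℕ n (λ m → sumℕ (suc k) (λ j → I321 (suc m) j * A3214 (n ∸ m) (k ∸ j)))
A3214-decomposition n k = begin
  A3214 (suc n) k                 ≡⟨ A3214-count (suc n) k ⟩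
  count Q? (suc n)                ≡⟨ count-firstComponent Q? n ⟩
  sumℕ n (λ m → length (filter (QP? m) (permutations (suc n)))) + count (λ l → Q? l ×-dec indec? l) (suc n)
    ≡⟨ cong₂ _+_ (sumℕ-cong n byDescents) (sym (I3214-count (suc n) k)) ⟩
  sumℕ n (λ m → sumℕ (suc k) (λ j → I321 (suc m) j * A3214 (n ∸ m) (k ∸ j))) + I3214 (suc n) k
    ≡⟨ +-comm (sumℕ n _) (I3214 (suc n) k) ⟩
  I3214 (suc n) k + sumℕ n (λ m → sumℕ (suc k) (λ j → I321 (suc m) j * A3214 (n ∸ m) (k ∸ j))) ∎
  where
  open ≡-Reasoning
  Q : List ℕ → Set
  Q l = ¬ Contains Is4123 (reverse l) × desList l ≡ k
  Q? : Decidable Q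
  Q? l = avoids3214? l ×-dec (desList l ≟ k)
  QP? : ∀ m → Decidable (λ l → Q l × Prefix (suc m) l)
  QP? m l = Q? l ×-dec prefix? (suc m) l
  R? : ∀ m j → Decidable (λ l → desList (take (suc m) l) ≡ j)
  R? m j l = desList (take (suc m) l) ≟ j
  byDescents : ∀ m → m < n → length (filter (QP? m) (permutations (suc n)))
    ≡ sumℕ (suc k) (λ j → I321 (suc m) j * A3214 (n ∸ m) (k ∸ j))
  byDescents m m<n = trans
    (count-split (QP? m) (R? m) (suc k) (permutations (suc n)) λ {l} l∈ ((_ , d) , _ , below) →
      -- Descents add up to k over the two parts, so the first part has at most k of them and k + 1
      -- classes suffice.
      desList (take (suc m) l) , s≤s (atMost (∈-permutations⁻ l∈) d below) , refl , λ _ _ eq → sym eq)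
    (sumℕ-cong (suc k) product)
    where
    atMost : ∀ {l} → PermutationOf (suc n) l → desList l ≡ k → All (_< suc m) (take (suc m) l) → desList (take (suc m) l) ≤ k
    atMost {l} p d below with ⊕-decompose p (s≤s (<⇒≤ m<n)) below
    ... | τ , pσ , _ , eq = ≤-trans (m≤m+n _ (desList τ))
      (≤-reflexive (trans (sym (desList-⊕ τ pσ)) (trans (cong desList eq) d)))
    product : ∀ j → j < suc k → length (filter (λ l → QP? m l ×-dec R? m j l) (permutations (suc n)))
      ≡ I321 (suc m) j * A3214 (n ∸ m) (k ∸ j)
    product j (s≤s j≤k) = begin
      length (filter (λ l → QP? m l ×-dec R? m j l) (permutations (suc n)))
        ≡⟨ count-⇔ (λ l → QP? m l ×-dec R? m j l) (λ l → (Q? l ×-dec R? m j l) ×-dec prefix? (suc m) l) (permutations (suc n))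
             (λ _ → mk⇔ (λ ((q , p) , r) → (q , r) , p) (λ ((q , r) , p) → (q , p) , r)) ⟩
      length (filter (λ l → (Q? l ×-dec R? m j l) ×-dec prefix? (suc m) l) (permutations (suc n)))
        ≡⟨ count-prefix (λ l → Q? l ×-dec R? m j l) (λ σ → avoids321? σ ×-dec (desList σ ≟ j))
             (λ τ → avoids3214? τ ×-dec (desList τ ≟ (k ∸ j))) (s≤s (<⇒≤ m<n)) class ⟩
      count (λ σ → (avoids321? σ ×-dec (desList σ ≟ j)) ×-dec indec? σ) (suc m)
        * count (λ τ → avoids3214? τ ×-dec (desList τ ≟ (k ∸ j))) (n ∸ m)
        ≡⟨ cong₂ _*_ (I321-count (suc m) j) (A3214-count (n ∸ m) (k ∸ j)) ⟨
      I321 (suc m) j * A3214 (n ∸ m) (k ∸ j) ∎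
      where
      class : ∀ {σ τ} → PermutationOf (suc m) σ → PermutationOf (n ∸ m) τ →
        (Q (σ ⊕ τ) × desList (take (suc m) (σ ⊕ τ)) ≡ j) ⇔
        ((¬ Contains (Decreasing 3) σ × desList σ ≡ j) × (¬ Contains Is4123 (reverse τ) × desList τ ≡ k ∸ j))
      class {σ} {τ} pσ@(_ , _ , len) pτ = mk⇔
        (λ { ((a , d) , eq) →
          let s , t = Equivalence.to avoid a
              dσ = trans (cong desList (sym take-σ)) eq
          in (s , dσ) , t , trans (sym (m+n∸m≡n (desList σ) (desList τ)))
                              (cong₂ _∸_ (trans (sym (desList-⊕ τ pσ)) d) dσ) })
        (λ { ((s , dσ) , t , dτ) →
          (Equivalence.from avoid (s , t) , trans (desList-⊕ τ pσ) (trans (cong₂ _+_ dσ dτ) (m+[n∸m]≡n j≤k))) ,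
          trans (cong desList take-σ) dσ })
        where
        take-σ : take (suc m) (σ ⊕ τ) ≡ σ
        take-σ = subst (λ i → take i (σ ⊕ τ) ≡ σ) len (take-⊕ σ _)
        avoid : (¬ Contains Is4123 (reverse (σ ⊕ τ))) ⇔ (¬ Contains (Decreasing 3) σ × ¬ Contains Is4123 (reverse τ))
        avoid = ¬-⊎ (3214-⊕ τ pσ (nonempty (s≤s m<n) pτ))

open import Data.Integer using (ℤ; +_; 0ℤ; 1ℤ) renaming (_+_ to _+ℤ_; _-_ to _-ℤ_; _*_ to _*ℤ_; -_ to -ℤ_)
import Data.Integer.Properties as ℤ
open import Algebra.Properties.AbelianGroup ℤ.+-0-abelianGroup using (∙-cancelʳ)
open import Data.Integer.Tactic.RingSolver using (solve-∀)

-- Power series over ℤ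

sumℤ-cong : ∀ n {f g : ℕ → ℤ} → (∀ i → i < n → f i ≡ g i) → sumℤ n f ≡ sumℤ n g
sumℤ-cong zero    eq = refl
sumℤ-cong (suc n) eq = cong₂ _+ℤ_ (sumℤ-cong n λ i i<n → eq i (m<n⇒m<1+n i<n)) (eq n (n<1+n n))

sumℤ-head : ∀ n f → sumℤ (suc n) f ≡ f 0 +ℤ sumℤ n (f ∘ suc)
sumℤ-head zero    f = ℤ.+-comm 0ℤ (f 0)
sumℤ-head (suc n) f = trans (cong (_+ℤ f (suc n)) (sumℤ-head n f)) (ℤ.+-assoc (f 0) _ _)

sumℤ-scale : ∀ n c f → sumℤ n (λ i → c *ℤ + f i) ≡ c *ℤ + sumℕ n f
sumℤ-scale zero    c f = sym (ℤ.*-zeroʳ c)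
sumℤ-scale (suc n) c f = trans (cong (_+ℤ c *ℤ + f n) (sumℤ-scale n c f)) (sym (ℤ.*-distribˡ-+ c (+ sumℕ n f) (+ f n)))

-- The two end terms contain the top coefficient; the middle sum involves earlier coefficients only.
cauchy-square : ∀ s n → s 0 ≡ + 1 →
  cauchy s s (suc n) ≡ + 2 *ℤ s (suc n) +ℤ sumℤ n (λ i → s (suc i) *ℤ s (n ∸ i))
cauchy-square s n s₀ = begin
  cauchy s s (suc n)                                              ≡⟨ sumℤ-head (suc n) _ ⟩
  s 0 *ℤ s (suc n) +ℤ (M +ℤ s (suc n) *ℤ s (n ∸ n))
    ≡⟨ cong₂ (λ x y → x *ℤ s (suc n) +ℤ (M +ℤ s (suc n) *ℤ y)) s₀ (trans (cong s (n∸n≡0 n)) s₀) ⟩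
  + 1 *ℤ s (suc n) +ℤ (M +ℤ s (suc n) *ℤ + 1)                     ≡⟨ collect (s (suc n)) M ⟩
  + 2 *ℤ s (suc n) +ℤ M                                           ∎
  where
  open ≡-Reasoning
  M : ℤ
  M = sumℤ n (λ i → s (suc i) *ℤ s (n ∸ i))
  collect : ∀ x M → + 1 *ℤ x +ℤ (M +ℤ x *ℤ + 1) ≡ + 2 *ℤ x +ℤ M
  collect = solve-∀

-- Once the earlier coefficients are known, the next coefficient of the square fixes 2 s(n + 1), and
-- 2 can be cancelled in ℤ.
sqrt-unique : ∀ s t → s 0 ≡ + 1 → t 0 ≡ + 1 → (∀ n → cauchy s s n ≡ cauchy t t n) → ∀ n → s n ≡ t n
sqrt-unique s t s₀ t₀ eq = <-rec _ step
  where
  open ≡-Reasoning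
  step : ∀ n → (∀ {i} → i < n → s i ≡ t i) → s n ≡ t n
  step zero    _   = trans s₀ (sym t₀)
  step (suc n) rec = ℤ.*-cancelˡ-≡ (+ 2) _ _ (∙-cancelʳ (sumℤ n (λ i → t (suc i) *ℤ t (n ∸ i))) _ _ (begin
    + 2 *ℤ s (suc n) +ℤ sumℤ n (λ i → t (suc i) *ℤ t (n ∸ i))
      ≡⟨ cong (+ 2 *ℤ s (suc n) +ℤ_) (sumℤ-cong n λ i i<n → cong₂ _*ℤ_ (rec (s≤s i<n)) (rec (s≤s (m∸n≤m n i)))) ⟨
    + 2 *ℤ s (suc n) +ℤ sumℤ n (λ i → s (suc i) *ℤ s (n ∸ i))  ≡⟨ cauchy-square s n s₀ ⟨
    cauchy s s (suc n)                                         ≡⟨ eq (suc n) ⟩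
    cauchy t t (suc n)                                         ≡⟨ cauchy-square t n t₀ ⟩
    + 2 *ℤ t (suc n) +ℤ sumℤ n (λ i → t (suc i) *ℤ t (n ∸ i))  ∎))

-- √(1 - 4x) = 1 - 2x C(x).
sqrtSeries : ℕ → ℤ
sqrtSeries zero    = + 1
sqrtSeries (suc n) = -ℤ + 2 *ℤ + catalan n

-- From degree 2 on, the end terms contribute -4 C(n + 1) and the middle terms 4 ∑ C(i) C(n - i);
-- they cancel by the Catalan convolution.
sqrtSeries-square : ∀ n → cauchy sqrtSeries sqrtSeries n ≡ oneMinus4x n
sqrtSeries-square zero          = refl
sqrtSeries-square (suc zero)    = refl
sqrtSeries-square (suc (suc n)) = begin
  cauchy sqrtSeries sqrtSeries (suc (suc n))                                ≡⟨ cauchy-square sqrtSeries (suc n) refl ⟩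
  + 2 *ℤ (-ℤ + 2 *ℤ + catalan (suc n)) +ℤ sumℤ (suc n) (λ i → sqrtSeries (suc i) *ℤ sqrtSeries (suc n ∸ i))
    ≡⟨ cong (+ 2 *ℤ (-ℤ + 2 *ℤ + catalan (suc n)) +ℤ_) (trans (sumℤ-cong (suc n) term) (sumℤ-scale (suc n) (+ 4) _)) ⟩
  + 2 *ℤ (-ℤ + 2 *ℤ + catalan (suc n)) +ℤ + 4 *ℤ + sumℕ (suc n) (λ i → catalan i * catalan (n ∸ i))
    ≡⟨ cong (λ x → + 2 *ℤ (-ℤ + 2 *ℤ + catalan (suc n)) +ℤ + 4 *ℤ + x) (catalan-convolution n) ⟨
  + 2 *ℤ (-ℤ + 2 *ℤ + catalan (suc n)) +ℤ + 4 *ℤ + catalan (suc n)          ≡⟨ cancel (+ catalan (suc n)) ⟩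
  0ℤ                                                                        ∎
  where
  open ≡-Reasoning
  cancel : ∀ x → + 2 *ℤ (-ℤ + 2 *ℤ x) +ℤ + 4 *ℤ x ≡ 0ℤ
  cancel = solve-∀
  multiply : ∀ x y → (-ℤ + 2 *ℤ x) *ℤ (-ℤ + 2 *ℤ y) ≡ + 4 *ℤ (x *ℤ y)
  multiply = solve-∀
  term : ∀ i → i < suc n → sqrtSeries (suc i) *ℤ sqrtSeries (suc n ∸ i) ≡ + 4 *ℤ + (catalan i * catalan (n ∸ i))
  term i (s≤s i≤n) = begin
    sqrtSeries (suc i) *ℤ sqrtSeries (suc n ∸ i)     ≡⟨ cong (λ j → sqrtSeries (suc i) *ℤ sqrtSeries j) (+-∸-assoc 1 i≤n) ⟩
    sqrtSeries (suc i) *ℤ sqrtSeries (suc (n ∸ i))   ≡⟨ multiply (+ catalan i) (+ catalan (n ∸ i)) ⟩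
    + 4 *ℤ (+ catalan i *ℤ + catalan (n ∸ i))        ≡⟨ cong (+ 4 *ℤ_) (ℤ.pos-* (catalan i) (catalan (n ∸ i))) ⟨
    + 4 *ℤ + (catalan i * catalan (n ∸ i))           ∎

I3214ₙ-formula : ∀ n → + I3214ₙ (suc n) ≡ Eℤ (suc n) -ℤ + sumℕ n (λ i → catalan i * E (n ∸ i))
I3214ₙ-formula n = begin
  + I3214ₙ (suc n)                            ≡⟨ cancel (+ S) (+ I3214ₙ (suc n)) ⟩
  (+ S +ℤ + I3214ₙ (suc n)) -ℤ + S            ≡⟨ cong (λ x → + x -ℤ + S) (E-decomposition n) ⟨
  Eℤ (suc n) -ℤ + S                           ∎
  where
  open ≡-Reasoning
  S : ℕ
  S = sumℕ n (λ i → catalan i * E (n ∸ i))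
  cancel : ∀ x y → y ≡ (x +ℤ y) -ℤ x
  cancel = solve-∀

-- By uniqueness `s` is 1 - 2x C(x), so the product is (2 - 2x C(x)) (E(x) - 1), and its
-- coefficients are twice those of `I3214ₙ-formula`.
I3214ₙ-series : ∀ s → s 0 ≡ + 1 → (∀ n → cauchy s s n ≡ oneMinus4x n) →
  ∀ n → + 2 *ℤ + I3214ₙ n ≡ cauchy (λ i → s i +ℤ oneS i) (λ i → Eℤ i -ℤ oneS i) n
I3214ₙ-series s s₀ square zero    = sym (trans (cong (0ℤ +ℤ_) (ℤ.*-zeroʳ (s 0 +ℤ 1ℤ))) refl)
I3214ₙ-series s s₀ square (suc n) = sym (begin
  cauchy (λ i → s i +ℤ oneS i) (λ i → Eℤ i -ℤ oneS i) (suc n)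
    ≡⟨ sumℤ-cong (suc (suc n)) (λ i _ → cong (λ x → (x +ℤ oneS i) *ℤ (Eℤ (suc n ∸ i) -ℤ oneS (suc n ∸ i)))
         (sqrt-unique s sqrtSeries s₀ refl (λ n → trans (square n) (sym (sqrtSeries-square n))) i)) ⟩
  cauchy (λ i → sqrtSeries i +ℤ oneS i) (λ i → Eℤ i -ℤ oneS i) (suc n)
    ≡⟨ sumℤ-head (suc n) _ ⟩
  + 2 *ℤ (Eℤ (suc n) -ℤ 0ℤ) +ℤ (sumℤ n (λ i → (-ℤ + 2 *ℤ + catalan i +ℤ 0ℤ) *ℤ (Eℤ (n ∸ i) -ℤ oneS (n ∸ i)))
      +ℤ (-ℤ + 2 *ℤ + catalan n +ℤ 0ℤ) *ℤ (Eℤ (n ∸ n) -ℤ oneS (n ∸ n)))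
    -- The term with i = n vanishes because E(x) - 1 has no constant term; in the others n - i is
    -- positive, so `oneS` contributes nothing.
    ≡⟨ cong₂ (λ x j → + 2 *ℤ (Eℤ (suc n) -ℤ 0ℤ) +ℤ (x +ℤ (-ℤ + 2 *ℤ + catalan n +ℤ 0ℤ) *ℤ (Eℤ j -ℤ oneS j)))
         (trans (sumℤ-cong n term) (sumℤ-scale n (-ℤ + 2) _)) (n∸n≡0 n) ⟩
  + 2 *ℤ (Eℤ (suc n) -ℤ 0ℤ) +ℤ (-ℤ + 2 *ℤ + S +ℤ (-ℤ + 2 *ℤ + catalan n +ℤ 0ℤ) *ℤ 0ℤ)
    ≡⟨ collect (Eℤ (suc n)) (+ S) (+ catalan n) ⟩
  + 2 *ℤ (Eℤ (suc n) -ℤ + S)      ≡⟨ cong (+ 2 *ℤ_) (I3214ₙ-formula n) ⟨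
  + 2 *ℤ + I3214ₙ (suc n)         ∎)
  where
  open ≡-Reasoning
  S : ℕ
  S = sumℕ n (λ i → catalan i * E (n ∸ i))
  collect : ∀ e s c → + 2 *ℤ (e -ℤ 0ℤ) +ℤ (-ℤ + 2 *ℤ s +ℤ (-ℤ + 2 *ℤ c +ℤ 0ℤ) *ℤ 0ℤ) ≡ + 2 *ℤ (e -ℤ s)
  collect = solve-∀
  simplify : ∀ c e → (-ℤ + 2 *ℤ c +ℤ 0ℤ) *ℤ (e -ℤ 0ℤ) ≡ -ℤ + 2 *ℤ (c *ℤ e)
  simplify = solve-∀
  positive : ∀ c j → 1 ≤ j → (-ℤ + 2 *ℤ + c +ℤ 0ℤ) *ℤ (Eℤ j -ℤ oneS j) ≡ -ℤ + 2 *ℤ + (c * E j)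
  positive c (suc j) _ = trans (simplify (+ c) (Eℤ (suc j))) (cong (-ℤ + 2 *ℤ_) (sym (ℤ.pos-* c (E (suc j)))))
  term : ∀ i → i < n → (-ℤ + 2 *ℤ + catalan i +ℤ 0ℤ) *ℤ (Eℤ (n ∸ i) -ℤ oneS (n ∸ i)) ≡ -ℤ + 2 *ℤ + (catalan i * E (n ∸ i))
  term i i<n = positive (catalan i) (n ∸ i) (m<n⇒0<n∸m i<n)

theorem3p11 :
    -- A^{3214}(x,q) = 1 + I^{3214}(x,q) + I^{321}(x,q) (A^{3214}(x,q) - 1), coefficient of x^n q^k, n ≥ 1
    ((n k : ℕ) → 1 ≤ n →
    A3214 n k ≡ I3214 n k
    + sumℕ (n ∸ 1) (λ m′ → sumℕ (suc k) (λ j → I321 (suc m′) j * A3214 (n ∸ suc m′) (k ∸ j))))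
    ×
    -- I^{3214}(x) = (1/2)(√(1-4x) + 1)(E(x) - 1), where √(1-4x) is the power series s with s₀ = 1, s² = 1 - 4x
    ((s : ℕ → ℤ) → s 0 ≡ + 1 → ((n : ℕ) → cauchy s s n ≡ oneMinus4x n) →
    (n : ℕ) → + 2 *ℤ + I3214ₙ n
    ≡ cauchy (λ i → s i +ℤ oneS i) (λ i → Eℤ i -ℤ oneS i) n)
    ×
    (I3214ₙ 1 ≡ 1)
    ×
    ((n : ℕ) → 2 ≤ n →
    + I3214ₙ n ≡ Eℤ n -ℤ + sumℕ (n ∸ 1) (λ i → catalan i * E (n ∸ 1 ∸ i)))
theorem3p11 =
  (λ { (suc n) k _ → A3214-decomposition n k }) ,
  I3214ₙ-series ,
  refl ,
  λ { (suc n) _ → I3214ₙ-formula n }
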